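{- Let $W:\mathsf{Alg}_{\underline{\mathcal{L}}}\to\mathsf{Alg}_{\mathcal{L}}$ be the Lazardian Witt vector functor and $\Delta:\mathsf{Alg}_{\mathcal{L}}\to\mathsf{Alg}_{\underline{\mathcal{L}}}$ the Lazardian jet algebra functor (defined below). Then there is an adjunction $\Delta\dashv W$; moreover $W$ sends perfect $\underline{\mathcal{L}}$-algebras into $\mathsf{CRP}_{\mathcal{L}}$, and the restricted functor $W:\mathsf{PerfAlg}_{\underline{\mathcal{L}}}\to\mathsf{CRP}_{\mathcal{L}}$ together with the residue functor $U:=-\otimes_{\mathcal{L}}\underline{\mathcal{L}}:\mathsf{CRP}_{\mathcal{L}}\to\mathsf{PerfAlg}_{\underline{\mathcal{L}}}$ forms an adjoint equivalence $W\dashv U$.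
   Context: Fix a prime $p$. Let $\mathcal{L}:=\mathbf{Z}[\omega_i^{p^{ -\infty}}\mid i\ge1][[\pi]]/(p-\sum_{i\ge1}\omega_i\pi^i)$ (all $p^n$-th roots of the $\omega_i$ adjoined) and $\underline{\mathcal{L}}:=\mathbf{F}_p[\omega_i\mid i\ge1]^{\mathrm{pf}}=\mathcal{L}/\pi\mathcal{L}$ (perfection). For a ring $R$ complete with respect to an ideal $I$ with $R/I$ a perfect $\mathbf{F}_p$-algebra, $[-]:R/I\to R$ denotes the unique multiplicative section. Let $\mathcal{R}$ be the $\pi$-adic completion of $\mathcal{L}[X_i^{p^{ -\infty}},Y_i^{p^{ -\infty}}\mid i\in\mathbf{N}]$; its reduction mod $\pi$ is the perfect ring $\underline{\mathcal{L}}[X_i^{p^{ -\infty}},Y_i^{p^{ -\infty}}]$. For $\ast\in\{+,\times\}$, the arithmetic polynomials $Q^{\ast}_{n}$ are the unique elements of $\underline{\mathcal{L}}[X_i^{p^{ -\infty}},Y_i^{p^{ -\infty}}]$ with $\sum_iX_i^{p^{ -i}}\pi^i\ast\sum_iY_i^{p^{ -i}}\pi^i=\sum_i[Q^{\ast}_i(X,Y)^{p^{ -i}}]\pi^i$ in $\mathcal{R}$; each $Q^\ast_n$ is a polynomial in $X_0,\dots,X_n,Y_0,\dots,Y_n$ with coefficients in $\underline{\mathcal{L}}$. For an $\underline{\mathcal{L}}$-algebra $k$, $W(k)$ is the set $k^{\mathbf{N}}$ of sequences $(\alpha_i)_{i\ge0}$ with $(\alpha+\beta)_n:=Q^+_n(\alpha,\beta)$,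 $(\alpha\beta)_n:=Q^\times_n(\alpha,\beta)$; this is an $\mathcal{L}$-algebra with structure map $\omega_j\mapsto(\omega_j,0,0,\dots)$, $\pi\mapsto(0,1,0,\dots)$, and $W$ acts on morphisms coordinatewise. Every $x\in\mathcal{L}$ has a unique expansion $x=\sum_n[x_n^{p^{ -n}}]\pi^n$ with $x_n\in\underline{\mathcal{L}}$. For an $\mathcal{L}$-algebra $A$, $\Delta(A):=\underline{\mathcal{L}}[d^{[n]}x\mid x\in A,n\ge0]/\sim$, where $\sim$ is the ideal generated by $d^{[n]}(x\ast y)-Q^\ast_n(d^{[0]}x,\dots,d^{[n]}x;d^{[0]}y,\dots,d^{[n]}y)$ for $x,y\in A$, $\ast\in\{+,\times\}$, and $d^{[n]}x-x_n$ for $x\in\mathcal{L}$; a morphism $\phi$ induces $\Delta(\phi):d^{[n]}x\mapsto d^{[n]}\phi(x)$. $\mathsf{CRP}_{\mathcal{L}}$ is the full subcategory of $\mathcal{L}$-algebras $B$ that are $\pi B$-adically complete, with $B/\pi B$ a perfect $\mathbf{F}_p$-algebra, and with $\pi\mathcal{L}\otimes_{\mathcal{L}}B\to B$ injective. $\mathsf{PerfAlg}_{\underline{\mathcal{L}}}$ is the category of $\underline{\mathcal{L}}$-algebras that are perfect $\mathbf{F}_p$-algebras. -}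

module Defs where

open import Algebra.Bundles using (CommutativeRing; RawRing)
open import Algebra.Module.Bundles using (LeftModule)
open import Algebra.Morphism.Bundles using (RingHomomorphism)
open import Algebra.Structures using (IsCommutativeRing)
import Algebra.Definitions
import Algebra.Morphism.Construct.Composition as Composition
import Algebra.Morphism.Construct.Identity as Identity
import Algebra.Properties.CommutativeSemigroup
import Algebra.Properties.Group
import Algebra.Properties.Ring
import Algebra.Properties.Semiring.Divisibility
import Algebra.Properties.Semiring.Exp
import Algebra.Properties.Semiring.Mult
import Algebra.Properties.Semiring.Sum
open import Data.Empty.Polymorphic using (⊥)
open import Data.Fin.Base using (Fin; toℕ; fromℕ; inject₁) renaming (zero to fzero; suc to fsuc)
import Data.Fin.Properties as Fin
open import Data.Integer.Base using (+_)
import Data.Integer.Properties as ℤ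
open ℤ using () renaming (+-*-commutativeRing to ℤ-ring)
open import Data.List.Base using (List; []; _∷_; _++_; map; foldr; [_])
import Data.List.Properties as List
open import Data.Nat.Base using (ℕ; zero; suc; _∸_)
import Data.Nat.Base as ℕ
open import Data.Product.Base using (Σ; ∃-syntax; _×_; _,_; proj₁; proj₂)
open import Data.Sum.Base using (_⊎_; inj₁; inj₂; [_,_]′)
open import Function.Base using (_∘_; id)
open import Function.Definitions using (Injective; Bijective)
open import Level using (Level; _⊔_; 0ℓ) renaming (suc to lsuc)
open import Relation.Binary.Core using (Rel)
open import Relation.Binary.PropositionalEquality.Core as ≡ using (_≡_)
open import Relation.Binary.Structures using (IsEquivalence)
import Relation.Binary.Reasoning.Setoid as SetoidReasoning

private
  variable
    o m e o′ m′ e′ ℓ ℓ′ ℓ″ c c′ a b r g s : Level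

record Category o m e : Set (lsuc (o ⊔ m ⊔ e)) where
  infix  4 _≈_
  infixr 9 _∘ᶜ_
  field
    Obj       : Set o
    Hom       : Obj → Obj → Set m
    _≈_       : ∀ {A B} → Rel (Hom A B) e
    idᶜ       : ∀ {A} → Hom A A
    _∘ᶜ_      : ∀ {A B C} → Hom B C → Hom A B → Hom A C
    equiv     : ∀ {A B} → IsEquivalence (_≈_ {A} {B})
    ∘-resp-≈  : ∀ {A B C} {f f′ : Hom B C} {g g′ : Hom A B} →
                f ≈ f′ → g ≈ g′ → f ∘ᶜ g ≈ f′ ∘ᶜ g′
    assoc     : ∀ {A B C D} {f : Hom C D} {g : Hom B C} {h : Hom A B} →
                (f ∘ᶜ g) ∘ᶜ h ≈ f ∘ᶜ (g ∘ᶜ h)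
    identityˡ : ∀ {A B} {f : Hom A B} → idᶜ ∘ᶜ f ≈ f
    identityʳ : ∀ {A B} {f : Hom A B} → f ∘ᶜ idᶜ ≈ f

  record IsIso {A B} (f : Hom A B) : Set (m ⊔ e) where
    field
      inv  : Hom B A
      invˡ : inv ∘ᶜ f ≈ idᶜ
      invʳ : f ∘ᶜ inv ≈ idᶜ

record Functor (C : Category o m e) (D : Category o′ m′ e′) :
               Set (o ⊔ m ⊔ e ⊔ o′ ⊔ m′ ⊔ e′) where
  private
    module C = Category C
    module D = Category D
  field
    F₀       : C.Obj → D.Obj
    F₁       : ∀ {A B} → C.Hom A B → D.Hom (F₀ A) (F₀ B)
    F-resp-≈ : ∀ {A B} {f g : C.Hom A B} → f C.≈ g → F₁ f D.≈ F₁ g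
    F-id     : ∀ {A} → F₁ (C.idᶜ {A}) D.≈ D.idᶜ
    F-∘      : ∀ {A B C} {f : C.Hom B C} {g : C.Hom A B} →
               F₁ (f C.∘ᶜ g) D.≈ F₁ f D.∘ᶜ F₁ g

infix 3 _⊣_ _⊣ₑ_

record _⊣_ {C : Category o m e} {D : Category o′ m′ e′}
           (L : Functor C D) (R : Functor D C) :
           Set (o ⊔ m ⊔ e ⊔ o′ ⊔ m′ ⊔ e′) where
  private
    module C = Category C
    module D = Category D
    module L = Functor L
    module R = Functor R
  field
    unit           : ∀ A → C.Hom A (R.F₀ (L.F₀ A))
    unit-natural   : ∀ {A B} (f : C.Hom A B) →
                     unit B C.∘ᶜ f C.≈ R.F₁ (L.F₁ f) C.∘ᶜ unit A
    counit         : ∀ X → D.Hom (L.F₀ (R.F₀ X)) X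
    counit-natural : ∀ {X Y} (f : D.Hom X Y) →
                     counit Y D.∘ᶜ L.F₁ (R.F₁ f) D.≈ f D.∘ᶜ counit X
    triangleˡ      : ∀ A → counit (L.F₀ A) D.∘ᶜ L.F₁ (unit A) D.≈ D.idᶜ
    triangleʳ      : ∀ X → R.F₁ (counit X) C.∘ᶜ unit (R.F₀ X) C.≈ C.idᶜ

record _⊣ₑ_ {C : Category o m e} {D : Category o′ m′ e′}
            (L : Functor C D) (R : Functor D C) :
            Set (o ⊔ m ⊔ e ⊔ o′ ⊔ m′ ⊔ e′) where
  field
    adjunction : L ⊣ R
  open _⊣_ adjunction public
  field
    unit-iso   : ∀ A → Category.IsIso C (unit A)
    counit-iso : ∀ X → Category.IsIso D (counit X)

FullSubcategory : (C : Category o m e) → (Category.Obj C → Set ℓ) → Category (o ⊔ ℓ) m e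
FullSubcategory C P = record
  { Obj       = Σ Obj P
  ; Hom       = λ A B → Hom (proj₁ A) (proj₁ B)
  ; _≈_       = _≈_
  ; idᶜ       = idᶜ
  ; _∘ᶜ_      = _∘ᶜ_
  ; equiv     = equiv
  ; ∘-resp-≈  = ∘-resp-≈
  ; assoc     = assoc
  ; identityˡ = identityˡ
  ; identityʳ = identityʳ
  } where open Category C

restrict : {C : Category o m e} {D : Category o′ m′ e′}
           {P : Category.Obj C → Set ℓ} {Q : Category.Obj D → Set ℓ′}
           (F : Functor C D) → (∀ A → P A → Q (Functor.F₀ F A)) →
           Functor (FullSubcategory C P) (FullSubcategory D Q)
restrict F P⇒Q = record
  { F₀       = λ { (A , PA) → F₀ A , P⇒Q A PA }
  ; F₁       = F₁
  ; F-resp-≈ = F-resp-≈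
  ; F-id     = F-id
  ; F-∘      = F-∘
  } where open Functor F

∣_∣ : CommutativeRing c ℓ → Set c
∣ R ∣ = CommutativeRing.Carrier R

infix 4 _⟶_

_⟶_ : CommutativeRing a ℓ → CommutativeRing b ℓ′ → Set (a ⊔ ℓ ⊔ b ⊔ ℓ′)
R ⟶ S = RingHomomorphism (CommutativeRing.rawRing R) (CommutativeRing.rawRing S)

open RingHomomorphism using (⟦_⟧)

module _ {A : Set a} (_≈_ : Rel A ℓ) (_+_ _*_ : A → A → A) (-_ : A → A) (0# 1# : A) where

  open Algebra.Definitions _≈_

  record IsCommutativeRingˡ : Set (a ⊔ ℓ) where
    field
      isEquivalence : IsEquivalence _≈_
      +-cong        : Congruent₂ _+_
      +-assoc       : Associative _+_
      +-comm        : Commutative _+_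
      +-identityˡ   : LeftIdentity 0# _+_
      -‿cong        : Congruent₁ -_
      -‿inverseˡ    : LeftInverse 0# -_ _+_
      *-cong        : Congruent₂ _*_
      *-assoc       : Associative _*_
      *-comm        : Commutative _*_
      *-identityˡ   : LeftIdentity 1# _*_
      distribˡ      : _*_ DistributesOverˡ _+_

    open IsEquivalence isEquivalence

    isCommutativeRing : IsCommutativeRing _≈_ _+_ _*_ -_ 0# 1#
    isCommutativeRing = record
      { isRing = record
        { +-isAbelianGroup = record
          { isGroup = record
            { isMonoid = record
              { isSemigroup = record
                { isMagma = record { isEquivalence = isEquivalence ; ∙-cong = +-cong }
                ; assoc   = +-assoc
                }
              ; identity = +-identityˡ , λ x → trans (+-comm x 0#) (+-identityˡ x)
              }
            ; inverse = -‿inverseˡ , λ x → trans (+-comm x (- x)) (-‿inverseˡ x)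
            ; ⁻¹-cong = -‿cong
            }
          ; comm = +-comm
          }
        ; *-cong     = *-cong
        ; *-assoc    = *-assoc
        ; *-identity = *-identityˡ , λ x → trans (*-comm x 1#) (*-identityˡ x)
        ; distrib    = distribˡ , λ x y z →
            trans (*-comm (y + z) x)
                  (trans (distribˡ x y z) (+-cong (*-comm x y) (*-comm x z)))
        }
      ; *-comm = *-comm
      }

module _ (R : CommutativeRing a ℓ) (S : CommutativeRing b ℓ′) where
  private
    module R = CommutativeRing R
    module S = CommutativeRing S
  open Algebra.Properties.Group S.+-group using (identityʳ-unique; inverseˡ-unique)

  mkHom : (f : ∣ R ∣ → ∣ S ∣) →
          (∀ {x y} → x R.≈ y → f x S.≈ f y) →
          (∀ x y → f (x R.+ y) S.≈ f x S.+ f y) →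
          (∀ x y → f (x R.* y) S.≈ f x S.* f y) →
          f R.1# S.≈ S.1# →
          R ⟶ S
  mkHom f f-cong f-+ f-* f-1 = record
    { ⟦_⟧ = f
    ; isRingHomomorphism = record
      { isSemiringHomomorphism = record
        { isNearSemiringHomomorphism = record
          { +-isMonoidHomomorphism = record
            { isMagmaHomomorphism = record
              { isRelHomomorphism = record { cong = f-cong }
              ; homo = f-+
              }
            ; ε-homo = f-0
            }
          ; *-homo = f-*
          }
        ; 1#-homo = f-1
        }
      ; -‿homo = λ x → inverseˡ-unique (f (R.- x)) (f x)
          (S.trans (S.sym (f-+ (R.- x) x)) (S.trans (f-cong (R.-‿inverseˡ x)) f-0))
      }
    }
    where
    f-0 : f R.0# S.≈ S.0#
    f-0 = identityʳ-unique (f R.0#) (f R.0#)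
            (S.trans (S.sym (f-+ R.0# R.0#)) (f-cong (R.+-identityˡ R.0#)))

idʰ : (R : CommutativeRing a ℓ) → R ⟶ R
idʰ R = record
  { isRingHomomorphism = Identity.isRingHomomorphism (CommutativeRing.rawRing R) (CommutativeRing.refl R) }

compose : {R : RawRing a ℓ} {S : RawRing b ℓ′} (T : CommutativeRing c ℓ″) →
          RingHomomorphism S (CommutativeRing.rawRing T) → RingHomomorphism R S →
          RingHomomorphism R (CommutativeRing.rawRing T)
compose T G F = record
  { isRingHomomorphism = Composition.isRingHomomorphism (CommutativeRing.trans T)
      (RingHomomorphism.isRingHomomorphism F) (RingHomomorphism.isRingHomomorphism G) }

pow : (R : CommutativeRing a ℓ) → ∣ R ∣ → ℕ → ∣ R ∣
pow R = Algebra.Properties.Semiring.Exp._^_ (CommutativeRing.semiring R)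

record IsPerfect (p : ℕ) (R : CommutativeRing a ℓ) : Set (a ⊔ ℓ) where
  open CommutativeRing R
  open Algebra.Properties.Semiring.Mult semiring using () renaming (_×_ to _times_)
  field
    char-p              : p times 1# ≈ 0#
    frobenius-bijective : Bijective _≈_ _≈_ (λ x → pow R x p)

record Algebra (R : CommutativeRing a ℓ) c : Set (a ⊔ ℓ ⊔ lsuc c) where
  field
    commutativeRing : CommutativeRing c c
    ι               : R ⟶ commutativeRing
  open CommutativeRing commutativeRing public

record AlgHom {R : CommutativeRing a ℓ} (A : Algebra R b) (B : Algebra R c) :
              Set (a ⊔ b ⊔ c) where
  private
    module A = Algebra A
    module B = Algebra B
  field
    hom : A.commutativeRing ⟶ B.commutativeRing
  open RingHomomorphism hom public renaming (⟦_⟧ to fun; ⟦⟧-cong to cong)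
  field
    commutes : ∀ x → fun (⟦ A.ι ⟧ x) B.≈ ⟦ B.ι ⟧ x

open AlgHom using (fun)

Alg : (R : CommutativeRing a ℓ) → ∀ c → Category (a ⊔ ℓ ⊔ lsuc c) (a ⊔ c) c
Alg R c = record
  { Obj       = Algebra R c
  ; Hom       = AlgHom
  ; _≈_       = λ {A} {B} f g → ∀ x → Algebra._≈_ B (fun f x) (fun g x)
  ; idᶜ       = λ {A} → record
    { hom      = idʰ (Algebra.commutativeRing A)
    ; commutes = λ _ → Algebra.refl A
    }
  ; _∘ᶜ_      = λ {A} {B} {C} f g → record
    { hom      = compose (Algebra.commutativeRing C) (AlgHom.hom f) (AlgHom.hom g)
    ; commutes = λ x → Algebra.trans C (AlgHom.cong f (AlgHom.commutes g x)) (AlgHom.commutes f x)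
    }
  ; equiv     = λ {A} {B} → record
    { refl  = λ _ → Algebra.refl B
    ; sym   = λ f≈g x → Algebra.sym B (f≈g x)
    ; trans = λ f≈g g≈h x → Algebra.trans B (f≈g x) (g≈h x)
    }
  ; ∘-resp-≈  = λ {A} {B} {C} {f} {f′} {g} {g′} f≈f′ g≈g′ x →
      Algebra.trans C (AlgHom.cong f (g≈g′ x)) (f≈f′ (fun g′ x))
  ; assoc     = λ {A} {B} {C} {D} _ → Algebra.refl D
  ; identityˡ = λ {A} {B} _ → Algebra.refl B
  ; identityʳ = λ {A} {B} _ → Algebra.refl B
  }

restrictScalars : {R : CommutativeRing a ℓ} {S : CommutativeRing b ℓ′} →
                  R ⟶ S → Algebra S c → Algebra R c
restrictScalars φ A = record
  { commutativeRing = Algebra.commutativeRing A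
  ; ι               = compose (Algebra.commutativeRing A) (Algebra.ι A) φ
  }

module Mod (R : CommutativeRing a ℓ) where
  open CommutativeRing R
  open Algebra.Properties.Semiring.Divisibility semiring public using (_∣_; _,_)
  open Algebra.Properties.Ring ring
  open Algebra.Properties.CommutativeSemigroup +-commutativeSemigroup using (interchange)
  open SetoidReasoning setoid

  infix 4 _≡_[mod_]

  _≡_[mod_] : ∣ R ∣ → ∣ R ∣ → ∣ R ∣ → Set (a ⊔ ℓ)
  x ≡ y [mod f ] = f ∣ (x - y)

  module _ {f : ∣ R ∣} where

    private
      ∣-+ : ∀ {x y} → f ∣ x → f ∣ y → f ∣ (x + y)
      ∣-+ (q , qf≈x) (r , rf≈y) = q + r , trans (distribʳ f q r) (+-cong qf≈x rf≈y)

      ∣-neg : ∀ {x} → f ∣ x → f ∣ (- x)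
      ∣-neg (q , qf≈x) = - q , trans (sym (-‿distribˡ-* q f)) (-‿cong qf≈x)

      ∣-*ˡ : ∀ x {y} → f ∣ y → f ∣ (x * y)
      ∣-*ˡ x (q , qf≈y) = x * q , trans (*-assoc x q f) (*-congˡ qf≈y)

      ∣-resp : ∀ {x y} → x ≈ y → f ∣ x → f ∣ y
      ∣-resp x≈y (q , qf≈x) = q , trans qf≈x x≈y

    ≈⇒mod : ∀ {x y} → x ≈ y → x ≡ y [mod f ]
    ≈⇒mod {x} {y} x≈y = 0# , trans (zeroˡ f) (sym (trans (+-congʳ x≈y) (-‿inverseʳ y)))

    mod-isEquivalence : IsEquivalence (λ x y → x ≡ y [mod f ])
    mod-isEquivalence = record
      { refl  = ≈⇒mod refl
      ; sym   = λ {x} {y} d → ∣-resp (begin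
          - (x - y)      ≈⟨ -‿+-comm x (- y) ⟨
          - x - - y      ≈⟨ +-congˡ (-‿involutive y) ⟩
          - x + y        ≈⟨ +-comm (- x) y ⟩
          y - x          ∎) (∣-neg d)
      ; trans = λ {x} {y} {z} d e → ∣-resp (begin
          (x - y) + (y - z)    ≈⟨ +-assoc x (- y) (y - z) ⟩
          x + (- y + (y - z))  ≈⟨ +-congˡ (+-assoc (- y) y (- z)) ⟨
          x + ((- y + y) - z)  ≈⟨ +-congˡ (+-congʳ (-‿inverseˡ y)) ⟩
          x + (0# - z)         ≈⟨ +-congˡ (+-identityˡ (- z)) ⟩
          x - z                ∎) (∣-+ d e)
      }

    mod-+-cong : ∀ {x x′ y y′} → x ≡ x′ [mod f ] → y ≡ y′ [mod f ] → x + y ≡ x′ + y′ [mod f ]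
    mod-+-cong {x} {x′} {y} {y′} d e = ∣-resp (begin
      (x - x′) + (y - y′)      ≈⟨ interchange x (- x′) y (- y′) ⟩
      (x + y) + (- x′ - y′)    ≈⟨ +-congˡ (-‿+-comm x′ y′) ⟩
      (x + y) - (x′ + y′)      ∎) (∣-+ d e)

    mod-neg-cong : ∀ {x y} → x ≡ y [mod f ] → - x ≡ - y [mod f ]
    mod-neg-cong {x} {y} d = ∣-resp (sym (-‿+-comm x (- y))) (∣-neg d)

    mod-*-cong : ∀ {x x′ y y′} → x ≡ x′ [mod f ] → y ≡ y′ [mod f ] → x * y ≡ x′ * y′ [mod f ]
    mod-*-cong {x} {x′} {y} {y′} d e = ∣-resp (begin
      y * (x - x′) + x′ * (y - y′)              ≈⟨ +-cong (trans (*-comm y _) (distribʳ y x (- x′))) (distribˡ x′ y (- y′)) ⟩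
      (x * y + - x′ * y) + (x′ * y + x′ * - y′)  ≈⟨ +-assoc _ _ _ ⟩
      x * y + (- x′ * y + (x′ * y + x′ * - y′))  ≈⟨ +-congˡ (+-assoc _ _ _) ⟨
      x * y + ((- x′ * y + x′ * y) + x′ * - y′)  ≈⟨ +-congˡ (+-congʳ (+-congʳ (-‿distribˡ-* x′ y))) ⟨
      x * y + ((- (x′ * y) + x′ * y) + x′ * - y′) ≈⟨ +-congˡ (+-congʳ (-‿inverseˡ (x′ * y))) ⟩
      x * y + (0# + x′ * - y′)                   ≈⟨ +-congˡ (+-identityˡ _) ⟩
      x * y + x′ * - y′                          ≈⟨ +-congˡ (-‿distribʳ-* x′ y′) ⟨
      x * y - x′ * y′                            ∎) (∣-+ (∣-*ˡ y d) (∣-*ˡ x′ e))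

module _ (R : CommutativeRing a ℓ) where
  open CommutativeRing R
  open Mod R

  infixl 7 _/_

  _/_ : ∣ R ∣ → CommutativeRing a (a ⊔ ℓ)
  _/_ f = record
    { _≈_ = λ x y → x ≡ y [mod f ]
    ; isCommutativeRing = IsCommutativeRingˡ.isCommutativeRing (record
      { isEquivalence = mod-isEquivalence
      ; +-cong        = mod-+-cong
      ; +-assoc       = λ x y z → ≈⇒mod (+-assoc x y z)
      ; +-comm        = λ x y → ≈⇒mod (+-comm x y)
      ; +-identityˡ   = λ x → ≈⇒mod (+-identityˡ x)
      ; -‿cong        = mod-neg-cong
      ; -‿inverseˡ    = λ x → ≈⇒mod (-‿inverseˡ x)
      ; *-cong        = mod-*-cong
      ; *-assoc       = λ x y z → ≈⇒mod (*-assoc x y z)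
      ; *-comm        = λ x y → ≈⇒mod (*-comm x y)
      ; *-identityˡ   = λ x → ≈⇒mod (*-identityˡ x)
      ; distribˡ      = λ x y z → ≈⇒mod (distribˡ x y z)
      })
    }

  quotientMap : ∀ f → R ⟶ _/_ f
  quotientMap f = mkHom R (_/_ f) id ≈⇒mod (λ _ _ → ≈⇒mod refl) (λ _ _ → ≈⇒mod refl) (≈⇒mod refl)

module _ (R : CommutativeRing a ℓ) (S : CommutativeRing b ℓ′) (φ : R ⟶ S) where
  private
    module R = CommutativeRing R
    module S = CommutativeRing S
  open Mod R
  open RingHomomorphism φ using (⟦⟧-cong; +-homo; *-homo; -‿homo)
  open Algebra.Properties.Group S.+-group using (x∙y⁻¹≈ε⇒x≈y)

  kills⇒resp-mod : ∀ {f} → ⟦ φ ⟧ f S.≈ S.0# → ∀ {x y} → x ≡ y [mod f ] → ⟦ φ ⟧ x S.≈ ⟦ φ ⟧ y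
  kills⇒resp-mod {f} φf≈0 {x} {y} (q , qf≈x-y) = x∙y⁻¹≈ε⇒x≈y _ _ (begin
    ⟦ φ ⟧ x S.- ⟦ φ ⟧ y        ≈⟨ S.+-congˡ (-‿homo y) ⟨
    ⟦ φ ⟧ x S.+ ⟦ φ ⟧ (R.- y)  ≈⟨ +-homo x (R.- y) ⟨
    ⟦ φ ⟧ (x R.- y)            ≈⟨ ⟦⟧-cong qf≈x-y ⟨
    ⟦ φ ⟧ (q R.* f)            ≈⟨ *-homo q f ⟩
    ⟦ φ ⟧ q S.* ⟦ φ ⟧ f        ≈⟨ S.*-congˡ φf≈0 ⟩
    ⟦ φ ⟧ q S.* S.0#           ≈⟨ S.zeroʳ _ ⟩
    S.0#                       ∎)
    where open SetoidReasoning S.setoid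

infixl 6 _:+_
infixl 7 _:*_
infix  8 :-_

data Term (C : Set c) (G : Set g) : Set (c ⊔ g) where
  con       : C → Term C G
  gen       : G → Term C G
  _:+_ _:*_ : Term C G → Term C G → Term C G
  :-_       : Term C G → Term C G

_>>=_ : {C : Set c} {G : Set g} {H : Set s} → Term C G → (G → Term C H) → Term C H
con x    >>= σ = con x
gen i    >>= σ = σ i
(t :+ u) >>= σ = (t >>= σ) :+ (u >>= σ)
(t :* u) >>= σ = (t >>= σ) :* (u >>= σ)
(:- t)   >>= σ = :- (t >>= σ)

-- Kept in its own module because its constructors share their names with
-- the laws of CommutativeRing.
module Presentation where

  module _ (R : CommutativeRing 0ℓ 0ℓ) {G : Set g} (_⊢_ : Rel (Term ∣ R ∣ G) g) where
    private
      module R = CommutativeRing R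
      T = Term ∣ R ∣ G

    data Equal : T → T → Set g where
      refl        : ∀ {t} → Equal t t
      sym         : ∀ {t u} → Equal t u → Equal u t
      trans       : ∀ {t u v} → Equal t u → Equal u v → Equal t v
      +-cong      : ∀ {t t′ u u′} → Equal t t′ → Equal u u′ → Equal (t :+ u) (t′ :+ u′)
      *-cong      : ∀ {t t′ u u′} → Equal t t′ → Equal u u′ → Equal (t :* u) (t′ :* u′)
      -‿cong      : ∀ {t t′} → Equal t t′ → Equal (:- t) (:- t′)
      +-assoc     : ∀ t u v → Equal ((t :+ u) :+ v) (t :+ (u :+ v))
      +-comm      : ∀ t u → Equal (t :+ u) (u :+ t)
      +-identityˡ : ∀ t → Equal (con R.0# :+ t) t
      -‿inverseˡ  : ∀ t → Equal ((:- t) :+ t) (con R.0#)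
      *-assoc     : ∀ t u v → Equal ((t :* u) :* v) (t :* (u :* v))
      *-comm      : ∀ t u → Equal (t :* u) (u :* t)
      *-identityˡ : ∀ t → Equal (con R.1# :* t) t
      distribˡ    : ∀ t u v → Equal (t :* (u :+ v)) ((t :* u) :+ (t :* v))
      con-cong    : ∀ {x y} → x R.≈ y → Equal (con x) (con y)
      con-+       : ∀ x y → Equal (con (x R.+ y)) (con x :+ con y)
      con-*       : ∀ x y → Equal (con (x R.* y)) (con x :* con y)
      relation    : ∀ {t u} → t ⊢ u → Equal t u

    ⟨_∣_⟩ : Algebra R g
    ⟨_∣_⟩ = record
      { commutativeRing = ring
      ; ι = mkHom R ring con con-cong con-+ con-* refl
      }
      where
      ring : CommutativeRing g g
      ring = record
        { Carrier = T
        ; _≈_ = Equal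
        ; isCommutativeRing = IsCommutativeRingˡ.isCommutativeRing (record
          { isEquivalence = record { refl = refl ; sym = sym ; trans = trans }
          ; +-cong        = +-cong
          ; +-assoc       = +-assoc
          ; +-comm        = +-comm
          ; +-identityˡ   = +-identityˡ
          ; -‿cong        = -‿cong
          ; -‿inverseˡ    = -‿inverseˡ
          ; *-cong        = *-cong
          ; *-assoc       = *-assoc
          ; *-comm        = *-comm
          ; *-identityˡ   = *-identityˡ
          ; distribˡ      = distribˡ
          })
        }

open Presentation using (Equal; module Equal; ⟨_∣_⟩)

module _ {R : CommutativeRing a ℓ} (A : Algebra R c) where
  open Algebra A

  eval : {G : Set g} → (G → ∣ commutativeRing ∣) → Term ∣ R ∣ G → ∣ commutativeRing ∣
  eval ρ (con x)  = ⟦ ι ⟧ x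
  eval ρ (gen i)  = ρ i
  eval ρ (t :+ u) = eval ρ t + eval ρ u
  eval ρ (t :* u) = eval ρ t * eval ρ u
  eval ρ (:- t)   = - eval ρ t

  eval-cong-ρ : {G : Set g} {ρ σ : G → ∣ commutativeRing ∣} → (∀ i → ρ i ≈ σ i) →
                ∀ t → eval ρ t ≈ eval σ t
  eval-cong-ρ ρ≈σ (con x)  = refl
  eval-cong-ρ ρ≈σ (gen i)  = ρ≈σ i
  eval-cong-ρ ρ≈σ (t :+ u) = +-cong (eval-cong-ρ ρ≈σ t) (eval-cong-ρ ρ≈σ u)
  eval-cong-ρ ρ≈σ (t :* u) = *-cong (eval-cong-ρ ρ≈σ t) (eval-cong-ρ ρ≈σ u)
  eval-cong-ρ ρ≈σ (:- t)   = -‿cong (eval-cong-ρ ρ≈σ t)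

  eval->>= : {G : Set g} {H : Set s} (ρ : H → ∣ commutativeRing ∣) (σ : G → Term ∣ R ∣ H) →
             ∀ t → eval ρ (t >>= σ) ≈ eval (eval ρ ∘ σ) t
  eval->>= ρ σ (con x)  = refl
  eval->>= ρ σ (gen i)  = refl
  eval->>= ρ σ (t :+ u) = +-cong (eval->>= ρ σ t) (eval->>= ρ σ u)
  eval->>= ρ σ (t :* u) = *-cong (eval->>= ρ σ t) (eval->>= ρ σ u)
  eval->>= ρ σ (:- t)   = -‿cong (eval->>= ρ σ t)

module _ {R : CommutativeRing a ℓ} {A : Algebra R b} {B : Algebra R c} (f : AlgHom A B) where
  open Algebra B
  open AlgHom f using (+-homo; *-homo; -‿homo; commutes)

  eval-natural : {G : Set g} (ρ : G → Algebra.Carrier A) →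
                 ∀ t → fun f (eval A ρ t) ≈ eval B (fun f ∘ ρ) t
  eval-natural ρ (con x)  = commutes x
  eval-natural ρ (gen i)  = refl
  eval-natural ρ (t :+ u) = trans (+-homo _ _) (+-cong (eval-natural ρ t) (eval-natural ρ u))
  eval-natural ρ (t :* u) = trans (*-homo _ _) (*-cong (eval-natural ρ t) (eval-natural ρ u))
  eval-natural ρ (:- t)   = trans (-‿homo _) (-‿cong (eval-natural ρ t))

module _ (R : CommutativeRing 0ℓ 0ℓ) {G : Set g} (_⊢_ : Rel (Term ∣ R ∣ G) g) (A : Algebra R c) where
  open Algebra A

  module _ (ρ : G → ∣ commutativeRing ∣)
           (resp : ∀ {t u} → t ⊢ u → eval A ρ t ≈ eval A ρ u) where

    eval-cong : ∀ {t u} → Equal R _⊢_ t u → eval A ρ t ≈ eval A ρ u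
    eval-cong Equal.refl              = refl
    eval-cong (Equal.sym d)           = sym (eval-cong d)
    eval-cong (Equal.trans d e)       = trans (eval-cong d) (eval-cong e)
    eval-cong (Equal.+-cong d e)      = +-cong (eval-cong d) (eval-cong e)
    eval-cong (Equal.*-cong d e)      = *-cong (eval-cong d) (eval-cong e)
    eval-cong (Equal.-‿cong d)        = -‿cong (eval-cong d)
    eval-cong (Equal.+-assoc t u v)   = +-assoc _ _ _
    eval-cong (Equal.+-comm t u)      = +-comm _ _
    eval-cong (Equal.+-identityˡ t)   = trans (+-congʳ (RingHomomorphism.0#-homo ι)) (+-identityˡ _)
    eval-cong (Equal.-‿inverseˡ t)    = trans (-‿inverseˡ _) (sym (RingHomomorphism.0#-homo ι))
    eval-cong (Equal.*-assoc t u v)   = *-assoc _ _ _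
    eval-cong (Equal.*-comm t u)      = *-comm _ _
    eval-cong (Equal.*-identityˡ t)   = trans (*-congʳ (RingHomomorphism.1#-homo ι)) (*-identityˡ _)
    eval-cong (Equal.distribˡ t u v)  = distribˡ _ _ _
    eval-cong (Equal.con-cong x≈y)    = RingHomomorphism.⟦⟧-cong ι x≈y
    eval-cong (Equal.con-+ x y)       = RingHomomorphism.+-homo ι x y
    eval-cong (Equal.con-* x y)       = RingHomomorphism.*-homo ι x y
    eval-cong (Equal.relation t⊢u)    = resp t⊢u

    induced : AlgHom ⟨ R ∣ _⊢_ ⟩ A
    induced = record
      { hom      = mkHom (Algebra.commutativeRing ⟨ R ∣ _⊢_ ⟩) commutativeRing (eval A ρ)
                     eval-cong (λ _ _ → refl) (λ _ _ → refl) (RingHomomorphism.1#-homo ι)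
      ; commutes = λ _ → refl
      }

  hom-ext : (f h : AlgHom ⟨ R ∣ _⊢_ ⟩ A) → (∀ i → fun f (gen i) ≈ fun h (gen i)) →
            ∀ t → fun f t ≈ fun h t
  hom-ext f h f≈h = go
    where
    module f = AlgHom f
    module h = AlgHom h
    go : ∀ t → f.fun t ≈ h.fun t
    go (con x)  = trans (f.commutes x) (sym (h.commutes x))
    go (gen i)  = f≈h i
    go (t :+ u) = trans (f.+-homo t u) (trans (+-cong (go t) (go u)) (sym (h.+-homo t u)))
    go (t :* u) = trans (f.*-homo t u) (trans (*-cong (go t) (go u)) (sym (h.*-homo t u)))
    go (:- t)   = trans (f.-‿homo t) (trans (-‿cong (go t)) (sym (h.-‿homo t)))

Polynomial : (R : CommutativeRing 0ℓ 0ℓ) (G : Set) → Algebra R 0ℓ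
Polynomial R G = ⟨ R ∣ (λ (_ _ : Term ∣ R ∣ G) → ⊥) ⟩

module _ (R : CommutativeRing a ℓ) where
  open CommutativeRing R
  open Algebra.Properties.Semiring.Sum semiring
    using (sum; sum-cong-≋; ∑-distrib-+; *-distribˡ-sum)
  open SetoidReasoning setoid

  private
    _⊛_ : (ℕ → ∣ R ∣) → (ℕ → ∣ R ∣) → ℕ → ∣ R ∣
    (x ⊛ y) n = sum {suc n} (λ i → x (toℕ i) * y (n ∸ toℕ i))

    one : ℕ → ∣ R ∣
    one zero    = 1#
    one (suc _) = 0#

    -- (x ⊛ y) (suc n) is definitionally x 0 * y (suc n) + ((x ∘ suc) ⊛ y) n.

    ⊛-cong : ∀ {x x′ y y′} → (∀ n → x n ≈ x′ n) → (∀ n → y n ≈ y′ n) →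
             ∀ n → (x ⊛ y) n ≈ (x′ ⊛ y′) n
    ⊛-cong x≈ y≈ n = sum-cong-≋ {suc n} (λ i → *-cong (x≈ (toℕ i)) (y≈ (n ∸ toℕ i)))

    ⊛-distribˡ : ∀ x y z n → (x ⊛ (λ k → y k + z k)) n ≈ (x ⊛ y) n + (x ⊛ z) n
    ⊛-distribˡ x y z n = trans
      (sum-cong-≋ {suc n} (λ i → distribˡ (x (toℕ i)) (y (n ∸ toℕ i)) (z (n ∸ toℕ i))))
      (∑-distrib-+ {suc n} (λ i → x (toℕ i) * y (n ∸ toℕ i)) (λ i → x (toℕ i) * z (n ∸ toℕ i)))

    ⊛-suc : ∀ x y n → (x ⊛ y) (suc n) ≈ (x ⊛ (y ∘ suc)) n + x (suc n) * y 0
    ⊛-suc x y zero    = begin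
      x 0 * y 1 + (x 1 * y 0 + 0#)    ≈⟨ +-congˡ (+-identityʳ _) ⟩
      x 0 * y 1 + x 1 * y 0           ≈⟨ +-congʳ (+-identityʳ _) ⟨
      (x 0 * y 1 + 0#) + x 1 * y 0    ∎
    ⊛-suc x y (suc n) = begin
      x 0 * y (suc (suc n)) + ((x ∘ suc) ⊛ y) (suc n)
        ≈⟨ +-congˡ (⊛-suc (x ∘ suc) y n) ⟩
      x 0 * y (suc (suc n)) + (((x ∘ suc) ⊛ (y ∘ suc)) n + x (suc (suc n)) * y 0)
        ≈⟨ +-assoc _ _ _ ⟨
      (x ⊛ (y ∘ suc)) (suc n) + x (suc (suc n)) * y 0 ∎

    ⊛-comm : ∀ x y n → (x ⊛ y) n ≈ (y ⊛ x) n
    ⊛-comm x y zero    = +-congʳ (*-comm (x 0) (y 0))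
    ⊛-comm x y (suc n) = begin
      x 0 * y (suc n) + ((x ∘ suc) ⊛ y) n    ≈⟨ +-cong (*-comm _ _) (⊛-comm (x ∘ suc) y n) ⟩
      y (suc n) * x 0 + (y ⊛ (x ∘ suc)) n    ≈⟨ +-comm _ _ ⟩
      (y ⊛ (x ∘ suc)) n + y (suc n) * x 0    ≈⟨ ⊛-suc y x n ⟨
      (y ⊛ x) (suc n)                        ∎

    ⊛-scale : ∀ k x y n → ((λ i → k * x i) ⊛ y) n ≈ k * (x ⊛ y) n
    ⊛-scale k x y n = trans
      (sum-cong-≋ {suc n} (λ i → *-assoc k (x (toℕ i)) (y (n ∸ toℕ i))))
      (sym (*-distribˡ-sum {suc n} k (λ i → x (toℕ i) * y (n ∸ toℕ i))))

    ⊛-distribʳ : ∀ x y z n → ((λ k → y k + z k) ⊛ x) n ≈ (y ⊛ x) n + (z ⊛ x) n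
    ⊛-distribʳ x y z n = trans (⊛-comm (λ k → y k + z k) x n)
      (trans (⊛-distribˡ x y z n) (+-cong (⊛-comm x y n) (⊛-comm x z n)))

    ⊛-assoc : ∀ x y z n → ((x ⊛ y) ⊛ z) n ≈ (x ⊛ (y ⊛ z)) n
    ⊛-assoc x y z zero    = +-congʳ (begin
      (x 0 * y 0 + 0#) * z 0    ≈⟨ *-congʳ (+-identityʳ _) ⟩
      x 0 * y 0 * z 0           ≈⟨ *-assoc _ _ _ ⟩
      x 0 * (y 0 * z 0)         ≈⟨ *-congˡ (+-identityʳ _) ⟨
      x 0 * (y 0 * z 0 + 0#)    ∎)
    ⊛-assoc x y z (suc n) = begin
      (x 0 * y 0 + 0#) * z (suc n) + (((x ⊛ y) ∘ suc) ⊛ z) n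
        ≈⟨ +-cong (trans (*-congʳ (+-identityʳ _)) (*-assoc _ _ _))
                  (⊛-distribʳ z (λ k → x 0 * y (suc k)) ((x ∘ suc) ⊛ y) n) ⟩
      x 0 * (y 0 * z (suc n)) + (((λ k → x 0 * y (suc k)) ⊛ z) n + (((x ∘ suc) ⊛ y) ⊛ z) n)
        ≈⟨ +-congˡ (+-cong (⊛-scale (x 0) (y ∘ suc) z n) (⊛-assoc (x ∘ suc) y z n)) ⟩
      x 0 * (y 0 * z (suc n)) + (x 0 * ((y ∘ suc) ⊛ z) n + ((x ∘ suc) ⊛ (y ⊛ z)) n)
        ≈⟨ +-assoc _ _ _ ⟨
      (x 0 * (y 0 * z (suc n)) + x 0 * ((y ∘ suc) ⊛ z) n) + ((x ∘ suc) ⊛ (y ⊛ z)) n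
        ≈⟨ +-congʳ (distribˡ (x 0) _ _) ⟨
      x 0 * (y ⊛ z) (suc n) + ((x ∘ suc) ⊛ (y ⊛ z)) n ∎

    ⊛-identityˡ : ∀ x n → (one ⊛ x) n ≈ x n
    ⊛-identityˡ x zero    = trans (+-identityʳ _) (*-identityˡ _)
    ⊛-identityˡ x (suc n) = begin
      1# * x (suc n) + ((one ∘ suc) ⊛ x) n           ≈⟨ +-cong (*-identityˡ _) (⊛-cong {one ∘ suc} {λ _ → 0# * 0#} {x} {x} (λ _ → sym (zeroˡ 0#)) (λ _ → refl) n) ⟩
      x (suc n) + ((λ _ → 0# * 0#) ⊛ x) n            ≈⟨ +-congˡ (trans (⊛-scale 0# (λ _ → 0#) x n) (zeroˡ _)) ⟩
      x (suc n) + 0#                                 ≈⟨ +-identityʳ _ ⟩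
      x (suc n)                                      ∎

  _[[π]] : CommutativeRing a ℓ
  _[[π]] = record
    { Carrier = ℕ → ∣ R ∣
    ; _≈_ = λ x y → ∀ n → x n ≈ y n
    ; _+_ = λ x y n → x n + y n
    ; _*_ = _⊛_
    ; -_  = λ x n → - x n
    ; 0#  = λ _ → 0#
    ; 1#  = one
    ; isCommutativeRing = IsCommutativeRingˡ.isCommutativeRing (record
      { isEquivalence = record
        { refl  = λ _ → refl
        ; sym   = λ x≈y n → sym (x≈y n)
        ; trans = λ x≈y y≈z n → trans (x≈y n) (y≈z n)
        }
      ; +-cong        = λ x≈ y≈ n → +-cong (x≈ n) (y≈ n)
      ; +-assoc       = λ x y z n → +-assoc (x n) (y n) (z n)
      ; +-comm        = λ x y n → +-comm (x n) (y n)
      ; +-identityˡ   = λ x n → +-identityˡ (x n)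
      ; -‿cong        = λ x≈ n → -‿cong (x≈ n)
      ; -‿inverseˡ    = λ x n → -‿inverseˡ (x n)
      ; *-cong        = ⊛-cong
      ; *-assoc       = ⊛-assoc
      ; *-comm        = ⊛-comm
      ; *-identityˡ   = ⊛-identityˡ
      ; distribˡ      = ⊛-distribˡ
      })
    }

  constantTerm : _[[π]] ⟶ R
  constantTerm = mkHom _[[π]] R (λ x → x 0) (λ x≈y → x≈y 0)
                   (λ _ _ → refl) (λ _ _ → +-identityʳ _) refl

module _ (R : CommutativeRing a ℓ) (π : ∣ R ∣) where
  open CommutativeRing R
  open Mod R
  open Algebra.Properties.Semiring.Sum semiring using (sum; sum-init-last)
  open Algebra.Properties.Semiring.Exp semiring using (_^_)

  record Completed : Set (a ⊔ ℓ) where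
    field
      at         : ℕ → ∣ R ∣
      compatible : ∀ n → at (suc n) ≡ at n [mod π ^ n ]

  open Completed

  Completion : CommutativeRing (a ⊔ ℓ) (a ⊔ ℓ)
  Completion = record
    { Carrier = Completed
    ; _≈_ = λ x y → ∀ n → at x n ≡ at y n [mod π ^ n ]
    ; _+_ = λ x y → record
      { at = λ n → at x n + at y n ; compatible = λ n → mod-+-cong (compatible x n) (compatible y n) }
    ; _*_ = λ x y → record
      { at = λ n → at x n * at y n ; compatible = λ n → mod-*-cong (compatible x n) (compatible y n) }
    ; -_ = λ x → record { at = λ n → - at x n ; compatible = λ n → mod-neg-cong (compatible x n) }
    ; 0# = record { at = λ _ → 0# ; compatible = λ _ → ≈⇒mod refl }
    ; 1# = record { at = λ _ → 1# ; compatible = λ _ → ≈⇒mod refl }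
    ; isCommutativeRing = IsCommutativeRingˡ.isCommutativeRing (record
      { isEquivalence = record
        { refl  = λ _ → IsEquivalence.refl mod-isEquivalence
        ; sym   = λ x≡y n → IsEquivalence.sym mod-isEquivalence (x≡y n)
        ; trans = λ x≡y y≡z n → IsEquivalence.trans mod-isEquivalence (x≡y n) (y≡z n)
        }
      ; +-cong        = λ x≡ y≡ n → mod-+-cong (x≡ n) (y≡ n)
      ; +-assoc       = λ x y z n → ≈⇒mod (+-assoc (at x n) (at y n) (at z n))
      ; +-comm        = λ x y n → ≈⇒mod (+-comm (at x n) (at y n))
      ; +-identityˡ   = λ x n → ≈⇒mod (+-identityˡ (at x n))
      ; -‿cong        = λ x≡ n → mod-neg-cong (x≡ n)
      ; -‿inverseˡ    = λ x n → ≈⇒mod (-‿inverseˡ (at x n))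
      ; *-cong        = λ x≡ y≡ n → mod-*-cong (x≡ n) (y≡ n)
      ; *-assoc       = λ x y z n → ≈⇒mod (*-assoc (at x n) (at y n) (at z n))
      ; *-comm        = λ x y n → ≈⇒mod (*-comm (at x n) (at y n))
      ; *-identityˡ   = λ x n → ≈⇒mod (*-identityˡ (at x n))
      ; distribˡ      = λ x y z n → ≈⇒mod (distribˡ (at x n) (at y n) (at z n))
      })
    }

  toCompletion : R ⟶ Completion
  toCompletion = mkHom R Completion
    (λ x → record { at = λ _ → x ; compatible = λ _ → ≈⇒mod refl })
    (λ x≈y _ → ≈⇒mod x≈y) (λ _ _ _ → ≈⇒mod refl) (λ _ _ _ → ≈⇒mod refl) (λ _ → ≈⇒mod refl)

  toQuotient : ∀ n → Completion ⟶ R / π ^ n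
  toQuotient n = mkHom Completion (R / π ^ n) (λ x → at x n)
    (λ x≡y → x≡y n) (λ _ _ → ≈⇒mod refl) (λ _ _ → ≈⇒mod refl) (≈⇒mod refl)

  -- series x is ∑ᵢ xᵢ πⁱ: modulo πⁿ only the terms with i < n matter.
  series : (ℕ → Completed) → Completed
  series x = record { at = partial ; compatible = step }
    where
    term : ℕ → ℕ → ∣ R ∣
    term n i = at (x i) n * π ^ i

    partial : ℕ → ∣ R ∣
    partial n = sum {n} (λ i → term n (toℕ i))

    sum-mod : ∀ {f} n {u v : Fin n → ∣ R ∣} → (∀ i → u i ≡ v i [mod f ]) → sum u ≡ sum v [mod f ]
    sum-mod zero    u≡v = ≈⇒mod refl
    sum-mod (suc n) u≡v = mod-+-cong (u≡v fzero) (sum-mod n (u≡v ∘ fsuc))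

    compatible′ : ∀ n i → term (suc n) i ≡ term n i [mod π ^ n ]
    compatible′ n i = mod-*-cong (compatible (x i) n) (≈⇒mod refl)

    last≡0 : ∀ n → term (suc n) (toℕ (fromℕ n)) ≡ 0# [mod π ^ n ]
    last≡0 n rewrite Fin.toℕ-fromℕ n = at (x n) (suc n) ,
      sym (trans (+-congˡ (Algebra.Properties.Ring.-0#≈0# ring)) (+-identityʳ _))

    init≡ : ∀ n (i : Fin n) → term (suc n) (toℕ (inject₁ i)) ≡ term n (toℕ i) [mod π ^ n ]
    init≡ n i rewrite Fin.toℕ-inject₁ i = compatible′ n (toℕ i)

    step : ∀ n → partial (suc n) ≡ partial n [mod π ^ n ]
    step n = begin
      partial (suc n)
        ≈⟨ ≈⇒mod (sum-init-last {n} (λ i → term (suc n) (toℕ i))) ⟩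
      sum {n} (λ i → term (suc n) (toℕ (inject₁ i))) + term (suc n) (toℕ (fromℕ n))
        ≈⟨ mod-+-cong (sum-mod n (init≡ n)) (last≡0 n) ⟩
      partial n + 0#
        ≈⟨ ≈⇒mod (+-identityʳ _) ⟩
      partial n ∎
      where open SetoidReasoning (CommutativeRing.setoid (R / π ^ n))

module _ (R : CommutativeRing 0ℓ 0ℓ) where
  private module R = CommutativeRing R

  asModule : Algebra R c → LeftModule R.ring c c
  asModule A = record
    { Carrierᴹ = Carrier
    ; _≈ᴹ_ = _≈_
    ; _+ᴹ_ = _+_
    ; _*ₗ_ = λ r x → ⟦ ι ⟧ r * x
    ; 0ᴹ = 0#
    ; -ᴹ_ = -_
    ; isLeftModule = record
      { isLeftSemimodule = record
        { +ᴹ-isCommutativeMonoid = +-isCommutativeMonoid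
        ; isPreleftSemimodule = record
          { *ₗ-cong      = λ r≈s x≈y → *-cong (⟦⟧-cong r≈s) x≈y
          ; *ₗ-zeroˡ     = λ x → trans (*-congʳ 0#-homo) (zeroˡ x)
          ; *ₗ-distribʳ  = λ x r s → trans (*-congʳ (+-homo r s)) (distribʳ x _ _)
          ; *ₗ-identityˡ = λ x → trans (*-congʳ 1#-homo) (*-identityˡ x)
          ; *ₗ-assoc     = λ r s x → trans (*-congʳ (*-homo r s)) (*-assoc _ _ x)
          ; *ₗ-zeroʳ     = λ r → zeroʳ _
          ; *ₗ-distribˡ  = λ r x y → distribˡ _ x y
          }
        }
      ; -ᴹ‿cong    = -‿cong
      ; -ᴹ‿inverse = -‿inverse
      }
    }
    where
    open Algebra A
    open RingHomomorphism ι using (⟦⟧-cong; 0#-homo; +-homo; 1#-homo; *-homo)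

  principalIdeal : ∣ R ∣ → LeftModule R.ring 0ℓ 0ℓ
  principalIdeal f = record
    { Carrierᴹ = ∃[ x ] f ∣ x
    ; _≈ᴹ_ = λ x y → proj₁ x ≈ proj₁ y
    ; _+ᴹ_ = λ { (x , q , qf≈x) (y , r , rf≈y) →
               x + y , q + r , trans (distribʳ f q r) (+-cong qf≈x rf≈y) }
    ; _*ₗ_ = λ { r (x , q , qf≈x) → r * x , r * q , trans (*-assoc r q f) (*-congˡ qf≈x) }
    ; 0ᴹ = 0# , 0# , zeroˡ f
    ; -ᴹ_ = λ { (x , q , qf≈x) → - x , - q , trans (sym (-‿distribˡ-* q f)) (-‿cong qf≈x) }
    ; isLeftModule = record
      { isLeftSemimodule = record
        { +ᴹ-isCommutativeMonoid = record
          { isMonoid = record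
            { isSemigroup = record
              { isMagma = record
                { isEquivalence = record { refl = refl ; sym = sym ; trans = trans }
                ; ∙-cong = +-cong
                }
              ; assoc = λ x y z → +-assoc (proj₁ x) (proj₁ y) (proj₁ z)
              }
            ; identity = (λ x → +-identityˡ (proj₁ x)) , (λ x → +-identityʳ (proj₁ x))
            }
          ; comm = λ x y → +-comm (proj₁ x) (proj₁ y)
          }
        ; isPreleftSemimodule = record
          { *ₗ-cong      = *-cong
          ; *ₗ-zeroˡ     = λ x → zeroˡ (proj₁ x)
          ; *ₗ-distribʳ  = λ x → distribʳ (proj₁ x)
          ; *ₗ-identityˡ = λ x → *-identityˡ (proj₁ x)
          ; *ₗ-assoc     = λ r s x → *-assoc r s (proj₁ x)
          ; *ₗ-zeroʳ     = zeroʳ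
          ; *ₗ-distribˡ  = λ r x y → distribˡ r (proj₁ x) (proj₁ y)
          }
        }
      ; -ᴹ‿cong    = -‿cong
      ; -ᴹ‿inverse = (λ x → -‿inverseˡ (proj₁ x)) , (λ x → -‿inverseʳ (proj₁ x))
      }
    }
    where
    open CommutativeRing R
    open Mod R
    open Algebra.Properties.Ring ring using (-‿distribˡ-*)

  module _ (M : LeftModule R.ring b ℓ) (N : LeftModule R.ring c ℓ′) where
    private
      module M = LeftModule M
      module N = LeftModule N

    -- A list of pairs (mᵢ , nᵢ) stands for ∑ᵢ mᵢ ⊗ nᵢ.
    Tensor : Set (b ⊔ c)
    Tensor = List (M.Carrierᴹ × N.Carrierᴹ)

    infix 4 _≈⊗_

    data _≈⊗_ : Tensor → Tensor → Set (b ⊔ ℓ ⊔ c ⊔ ℓ′) where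
      ≈⊗-refl  : ∀ {x} → x ≈⊗ x
      ≈⊗-sym   : ∀ {x y} → x ≈⊗ y → y ≈⊗ x
      ≈⊗-trans : ∀ {x y z} → x ≈⊗ y → y ≈⊗ z → x ≈⊗ z
      ++-cong  : ∀ {x x′ y y′} → x ≈⊗ x′ → y ≈⊗ y′ → x ++ y ≈⊗ x′ ++ y′
      ++-comm  : ∀ x y → x ++ y ≈⊗ y ++ x
      ⊗-cong   : ∀ {m m′ n n′} → m M.≈ᴹ m′ → n N.≈ᴹ n′ → [ m , n ] ≈⊗ [ m′ , n′ ]
      ⊗-zeroˡ  : ∀ n → [ M.0ᴹ , n ] ≈⊗ []
      ⊗-+ˡ     : ∀ m m′ n → [ m M.+ᴹ m′ , n ] ≈⊗ (m , n) ∷ (m′ , n) ∷ []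
      ⊗-+ʳ     : ∀ m n n′ → [ m , n N.+ᴹ n′ ] ≈⊗ (m , n) ∷ (m , n′) ∷ []
      ⊗-middle : ∀ r m n → [ r M.*ₗ m , n ] ≈⊗ [ m , r N.*ₗ n ]

-- The C-algebra B ⊗ C, for R-algebras B and C.
module _ {R : CommutativeRing 0ℓ 0ℓ} (B : Algebra R b) (C : Algebra R c) where
  private
    module B = Algebra B
    module C = Algebra C
    T = Tensor R (asModule R B) (asModule R C)
    _≈_ = _≈⊗_ R (asModule R B) (asModule R C)

    infix 4 _≈_

    _·_ : B.Carrier × C.Carrier → B.Carrier × C.Carrier → B.Carrier × C.Carrier
    (b , c) · (b′ , c′) = b B.* b′ , c C.* c′

    _⊛_ : T → T → T
    []       ⊛ ys = []
    (x ∷ xs) ⊛ ys = map (x ·_) ys ++ (xs ⊛ ys)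

    neg : T → T
    neg = map (λ { (b , c) → B.- b , c })

    ≡⇒≈ : ∀ {xs ys} → xs ≡ ys → xs ≈ ys
    ≡⇒≈ ≡.refl = ≈⊗-refl

    ++-congˡ : ∀ xs {ys zs} → ys ≈ zs → xs ++ ys ≈ xs ++ zs
    ++-congˡ xs = ++-cong (≈⊗-refl {x = xs})

    ++-congʳ : ∀ {xs ys} zs → xs ≈ ys → xs ++ zs ≈ ys ++ zs
    ++-congʳ zs d = ++-cong d (≈⊗-refl {x = zs})

    map-· : ∀ x {ys zs} → ys ≈ zs → map (x ·_) ys ≈ map (x ·_) zs
    map-· x ≈⊗-refl        = ≈⊗-refl
    map-· x (≈⊗-sym d)     = ≈⊗-sym (map-· x d)
    map-· x (≈⊗-trans d e) = ≈⊗-trans (map-· x d) (map-· x e)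
    map-· x (++-cong {xs} {xs′} {ys} {ys′} d e) = ≈⊗-trans
      (≡⇒≈ (List.map-++ (x ·_) xs ys))
      (≈⊗-trans (++-cong (map-· x d) (map-· x e)) (≡⇒≈ (≡.sym (List.map-++ (x ·_) xs′ ys′))))
    map-· x (++-comm xs ys) = ≈⊗-trans
      (≡⇒≈ (List.map-++ (x ·_) xs ys))
      (≈⊗-trans (++-comm (map (x ·_) xs) (map (x ·_) ys)) (≡⇒≈ (≡.sym (List.map-++ (x ·_) ys xs))))
    map-· (b , c) (⊗-cong d e)     = ⊗-cong (B.*-congˡ d) (C.*-congˡ e)
    map-· (b , c) (⊗-zeroˡ n)      = ≈⊗-trans (⊗-cong (B.zeroʳ b) C.refl) (⊗-zeroˡ _)
    map-· (b , c) (⊗-+ˡ m m′ n)    = ≈⊗-trans (⊗-cong (B.distribˡ b m m′) C.refl) (⊗-+ˡ _ _ _)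
    map-· (b , c) (⊗-+ʳ m n n′)    = ≈⊗-trans (⊗-cong B.refl (C.distribˡ c n n′)) (⊗-+ʳ _ _ _)
    map-· (b , c) (⊗-middle r m n) = ≈⊗-trans (⊗-cong (x∙yz≈y∙xz B.*-commutativeSemigroup b _ m) C.refl)
      (≈⊗-trans (⊗-middle r _ _) (⊗-cong B.refl (x∙yz≈y∙xz C.*-commutativeSemigroup _ c n)))
      where open Algebra.Properties.CommutativeSemigroup using (x∙yz≈y∙xz)

    ·-comm : ∀ x y → [ x · y ] ≈ [ y · x ]
    ·-comm (b , c) (b′ , c′) = ⊗-cong (B.*-comm b b′) (C.*-comm c c′)

    ∷-cong : ∀ {x y xs ys} → [ x ] ≈ [ y ] → xs ≈ ys → x ∷ xs ≈ y ∷ ys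
    ∷-cong = ++-cong

    swap-++ : ∀ xs ys zs → xs ++ (ys ++ zs) ≈ ys ++ (xs ++ zs)
    swap-++ xs ys zs = ≈⊗-trans (≡⇒≈ (≡.sym (List.++-assoc xs ys zs)))
      (≈⊗-trans (++-congʳ zs (++-comm xs ys)) (≡⇒≈ (List.++-assoc ys xs zs)))

    ⊛-zeroʳ : ∀ xs → xs ⊛ [] ≡ []
    ⊛-zeroʳ []       = ≡.refl
    ⊛-zeroʳ (x ∷ xs) = ⊛-zeroʳ xs

    ⊛-∷ʳ : ∀ xs y ys → xs ⊛ (y ∷ ys) ≈ map (y ·_) xs ++ (xs ⊛ ys)
    ⊛-∷ʳ []       y ys = ≈⊗-refl
    ⊛-∷ʳ (x ∷ xs) y ys = ∷-cong (·-comm x y) (≈⊗-trans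
      (++-congˡ (map (x ·_) ys) (⊛-∷ʳ xs y ys))
      (swap-++ (map (x ·_) ys) (map (y ·_) xs) (xs ⊛ ys)))

    ⊛-comm : ∀ xs ys → xs ⊛ ys ≈ ys ⊛ xs
    ⊛-comm []       ys = ≡⇒≈ (≡.sym (⊛-zeroʳ ys))
    ⊛-comm (x ∷ xs) ys = ≈⊗-trans (++-congˡ (map (x ·_) ys) (⊛-comm xs ys)) (≈⊗-sym (⊛-∷ʳ ys x xs))

    ⊛-congˡ : ∀ xs {ys zs} → ys ≈ zs → xs ⊛ ys ≈ xs ⊛ zs
    ⊛-congˡ []       d = ≈⊗-refl
    ⊛-congˡ (x ∷ xs) d = ++-cong (map-· x d) (⊛-congˡ xs d)

    ⊛-cong : ∀ {xs xs′ ys ys′} → xs ≈ xs′ → ys ≈ ys′ → xs ⊛ ys ≈ xs′ ⊛ ys′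
    ⊛-cong {xs} {xs′} {ys} {ys′} d e = ≈⊗-trans (⊛-congˡ xs e)
      (≈⊗-trans (⊛-comm xs ys′) (≈⊗-trans (⊛-congˡ ys′ d) (⊛-comm ys′ xs′)))

    ⊛-++ʳ : ∀ xs ys zs → (ys ++ zs) ⊛ xs ≡ (ys ⊛ xs) ++ (zs ⊛ xs)
    ⊛-++ʳ xs []       zs = ≡.refl
    ⊛-++ʳ xs (y ∷ ys) zs = ≡.trans (≡.cong (map (y ·_) xs ++_) (⊛-++ʳ xs ys zs))
      (≡.sym (List.++-assoc (map (y ·_) xs) (ys ⊛ xs) (zs ⊛ xs)))

    ⊛-distribˡ : ∀ xs ys zs → xs ⊛ (ys ++ zs) ≈ (xs ⊛ ys) ++ (xs ⊛ zs)
    ⊛-distribˡ xs ys zs = ≈⊗-trans (⊛-comm xs (ys ++ zs))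
      (≈⊗-trans (≡⇒≈ (⊛-++ʳ xs ys zs)) (++-cong (⊛-comm ys xs) (⊛-comm zs xs)))

    map-·-assoc : ∀ x y zs → map ((x · y) ·_) zs ≈ map (x ·_) (map (y ·_) zs)
    map-·-assoc x y []       = ≈⊗-refl
    map-·-assoc x y (z ∷ zs) = ∷-cong (⊗-cong (B.*-assoc _ _ _) (C.*-assoc _ _ _)) (map-·-assoc x y zs)

    map-·-⊛ : ∀ x ys zs → map (x ·_) ys ⊛ zs ≈ map (x ·_) (ys ⊛ zs)
    map-·-⊛ x []       zs = ≈⊗-refl
    map-·-⊛ x (y ∷ ys) zs = ≈⊗-trans (++-cong (map-·-assoc x y zs) (map-·-⊛ x ys zs))
      (≡⇒≈ (≡.sym (List.map-++ (x ·_) (map (y ·_) zs) (ys ⊛ zs))))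

    ⊛-assoc : ∀ xs ys zs → (xs ⊛ ys) ⊛ zs ≈ xs ⊛ (ys ⊛ zs)
    ⊛-assoc []       ys zs = ≈⊗-refl
    ⊛-assoc (x ∷ xs) ys zs = ≈⊗-trans (≡⇒≈ (⊛-++ʳ zs (map (x ·_) ys) (xs ⊛ ys)))
      (++-cong (map-·-⊛ x ys zs) (⊛-assoc xs ys zs))

    ⊛-identityˡ : ∀ xs → [ B.1# , C.1# ] ⊛ xs ≈ xs
    ⊛-identityˡ xs = ≈⊗-trans (≡⇒≈ (List.++-identityʳ _)) (go xs)
      where
      go : ∀ xs → map ((B.1# , C.1#) ·_) xs ≈ xs
      go []       = ≈⊗-refl
      go (x ∷ xs) = ∷-cong (⊗-cong (B.*-identityˡ _) (C.*-identityˡ _)) (go xs)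

    -- neg is multiplication by -1 ⊗ 1.
    neg≈ : ∀ xs → neg xs ≈ map ((B.- B.1# , C.1#) ·_) xs
    neg≈ []       = ≈⊗-refl
    neg≈ (x ∷ xs) = ∷-cong (⊗-cong (B.sym (-1*x≈-x _)) (C.sym (C.*-identityˡ _))) (neg≈ xs)
      where open Algebra.Properties.Ring B.ring using (-1*x≈-x)

    neg-cong : ∀ {xs ys} → xs ≈ ys → neg xs ≈ neg ys
    neg-cong {xs} {ys} d = ≈⊗-trans (neg≈ xs) (≈⊗-trans (map-· _ d) (≈⊗-sym (neg≈ ys)))

    neg-inverseˡ : ∀ xs → neg xs ++ xs ≈ []
    neg-inverseˡ []             = ≈⊗-refl
    neg-inverseˡ ((b , c) ∷ xs) = ≈⊗-trans (∷-cong ≈⊗-refl (swap-++ (neg xs) [ b , c ] xs))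
      (++-cong cancel (neg-inverseˡ xs))
      where
      cancel : (B.- b , c) ∷ (b , c) ∷ [] ≈ []
      cancel = ≈⊗-trans (≈⊗-sym (⊗-+ˡ _ _ c)) (≈⊗-trans (⊗-cong (B.-‿inverseˡ b) C.refl) (⊗-zeroˡ c))

  infixl 7 _⊗_

  _⊗_ : Algebra C.commutativeRing (b ⊔ c)
  _⊗_ = record
    { commutativeRing = ring
    ; ι = mkHom C.commutativeRing ring (λ c → [ B.1# , c ]) (⊗-cong B.refl) (⊗-+ʳ B.1#)
            (λ c c′ → ⊗-cong (B.sym (B.*-identityˡ B.1#)) C.refl) ≈⊗-refl
    }
    where
    ring : CommutativeRing (b ⊔ c) (b ⊔ c)
    ring = record
      { Carrier = T
      ; _≈_ = _≈_
      ; _+_ = _++_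
      ; _*_ = _⊛_
      ; -_  = neg
      ; 0#  = []
      ; 1#  = [ B.1# , C.1# ]
      ; isCommutativeRing = IsCommutativeRingˡ.isCommutativeRing (record
        { isEquivalence = record { refl = ≈⊗-refl ; sym = ≈⊗-sym ; trans = ≈⊗-trans }
        ; +-cong        = ++-cong
        ; +-assoc       = λ xs ys zs → ≡⇒≈ (List.++-assoc xs ys zs)
        ; +-comm        = ++-comm
        ; +-identityˡ   = λ _ → ≈⊗-refl
        ; -‿cong        = neg-cong
        ; -‿inverseˡ    = neg-inverseˡ
        ; *-cong        = λ {xs} {xs′} {ys} {ys′} → ⊛-cong {xs} {xs′} {ys} {ys′}
        ; *-assoc       = ⊛-assoc
        ; *-comm        = ⊛-comm
        ; *-identityˡ   = ⊛-identityˡ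
        ; distribˡ      = ⊛-distribˡ
        })
      }

module _ {R : CommutativeRing 0ℓ 0ℓ} (C : Algebra R 0ℓ) where
  private
    module C = Algebra C

    module OnHoms {B B′ : Algebra R b} (f : AlgHom B B′) where
      module B  = Algebra B
      module B′ = Algebra B′
      module f  = AlgHom f

      infix 4 _≈_ _≈′_
      _≈_  = Algebra._≈_ (B ⊗ C)
      _≈′_ = Algebra._≈_ (B′ ⊗ C)

      pair : B.Carrier × C.Carrier → B′.Carrier × C.Carrier
      pair (b , c) = f.fun b , c

      ≡⇒≈′ : ∀ {xs ys} → xs ≡ ys → xs ≈′ ys
      ≡⇒≈′ ≡.refl = ≈⊗-refl

      pair-cong : ∀ {xs ys} → xs ≈ ys → map pair xs ≈′ map pair ys
      pair-cong ≈⊗-refl        = ≈⊗-refl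
      pair-cong (≈⊗-sym d)     = ≈⊗-sym (pair-cong d)
      pair-cong (≈⊗-trans d e) = ≈⊗-trans (pair-cong d) (pair-cong e)
      pair-cong (++-cong {xs} {xs′} {ys} {ys′} d e) = ≈⊗-trans (≡⇒≈′ (List.map-++ pair xs ys))
        (≈⊗-trans (++-cong (pair-cong d) (pair-cong e)) (≡⇒≈′ (≡.sym (List.map-++ pair xs′ ys′))))
      pair-cong (++-comm xs ys) = ≈⊗-trans (≡⇒≈′ (List.map-++ pair xs ys))
        (≈⊗-trans (++-comm (map pair xs) (map pair ys)) (≡⇒≈′ (≡.sym (List.map-++ pair ys xs))))
      pair-cong (⊗-cong d e)     = ⊗-cong (f.cong d) e
      pair-cong (⊗-zeroˡ n)      = ≈⊗-trans (⊗-cong f.0#-homo C.refl) (⊗-zeroˡ n)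
      pair-cong (⊗-+ˡ m m′ n)    = ≈⊗-trans (⊗-cong (f.+-homo m m′) C.refl) (⊗-+ˡ _ _ n)
      pair-cong (⊗-+ʳ m n n′)    = ⊗-+ʳ (f.fun m) n n′
      pair-cong (⊗-middle r m n) = ≈⊗-trans
        (⊗-cong (B′.trans (f.*-homo _ m) (B′.*-congʳ (f.commutes r))) C.refl)
        (⊗-middle r (f.fun m) n)

      _⊛_  = Algebra._*_ (B ⊗ C)
      _⊛′_ = Algebra._*_ (B′ ⊗ C)

      pair-· : ∀ x ys → map pair ([ x ] ⊛ ys) ≈′ [ pair x ] ⊛′ map pair ys
      pair-· x []       = ≈⊗-refl
      pair-· x (y ∷ ys) = ++-cong (⊗-cong (f.*-homo _ _) C.refl) (pair-· x ys)

      pair-⊛ : ∀ xs ys → map pair (xs ⊛ ys) ≈′ map pair xs ⊛′ map pair ys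
      pair-⊛ []       ys = ≈⊗-refl
      pair-⊛ (x ∷ xs) ys = ≈⊗-trans
        (≡⇒≈′ (≡.cong (map pair) (unfold (map _ ys) (xs ⊛ ys))))
        (≈⊗-trans (≡⇒≈′ (List.map-++ pair ([ x ] ⊛ ys) (xs ⊛ ys)))
        (≈⊗-trans (++-cong (pair-· x ys) (pair-⊛ xs ys))
                  (≡⇒≈′ (≡.sym (unfold (map _ (map pair ys)) (map pair xs ⊛′ map pair ys))))))
        where
        unfold : {A : Set a} (us vs : List A) → us ++ vs ≡ (us ++ []) ++ vs
        unfold us vs = ≡.cong (_++ vs) (≡.sym (List.++-identityʳ us))

      tensorHom : AlgHom (B ⊗ C) (B′ ⊗ C)
      tensorHom = record
        { hom = mkHom (Algebra.commutativeRing (B ⊗ C)) (Algebra.commutativeRing (B′ ⊗ C)) (map pair)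
            pair-cong (λ xs ys → ≡⇒≈′ (List.map-++ pair xs ys)) pair-⊛ (⊗-cong f.1#-homo C.refl)
        ; commutes = λ c → ⊗-cong f.1#-homo C.refl
        }

  baseChange : Functor (Alg R b) (Alg C.commutativeRing b)
  baseChange = record
    { F₀       = _⊗ C
    ; F₁       = OnHoms.tensorHom
    ; F-resp-≈ = λ {B} {B′} {f} {g} → resp B B′ f g
    ; F-id     = λ {B} xs → ≡⇒≈ B (List.map-id xs)
    ; F-∘      = λ {B} {B′} {B″} xs → ≡⇒≈ B″ (List.map-∘ xs)
    }
    where
    ≡⇒≈ : (B : Algebra R b) → ∀ {xs ys} → xs ≡ ys → Algebra._≈_ (B ⊗ C) xs ys
    ≡⇒≈ B ≡.refl = ≈⊗-refl

    resp : (B B′ : Algebra R b) (f g : AlgHom B B′) → (∀ x → Algebra._≈_ B′ (fun f x) (fun g x)) →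
           ∀ xs → Algebra._≈_ (B′ ⊗ C) (fun (OnHoms.tensorHom f) xs) (fun (OnHoms.tensorHom g) xs)
    resp B B′ f g f≈g []             = ≈⊗-refl
    resp B B′ f g f≈g ((b , c) ∷ xs) = ++-cong (⊗-cong (f≈g b) C.refl) (resp B B′ f g f≈g xs)

quotientLift : (R : CommutativeRing a ℓ) (S : CommutativeRing b ℓ′) (φ : R ⟶ S) {f : ∣ R ∣} →
               CommutativeRing._≈_ S (⟦ φ ⟧ f) (CommutativeRing.0# S) → R / f ⟶ S
quotientLift R S φ {f} φf≈0 = mkHom (R / f) S ⟦ φ ⟧ (kills⇒resp-mod R S φ φf≈0)
                            (RingHomomorphism.+-homo φ) (RingHomomorphism.*-homo φ) (RingHomomorphism.1#-homo φ)

module Lazard (p : ℕ) where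

  module _ (R : CommutativeRing 0ℓ 0ℓ) where
    private module R = CommutativeRing R

    infixr 8 _:^_

    _:^_ : {G : Set g} → Term ∣ R ∣ G → ℕ → Term ∣ R ∣ G
    t :^ zero  = con R.1#
    t :^ suc n = t :* t :^ n

    eval-:^ : (A : Algebra R c) {G : Set g} (ρ : G → Algebra.Carrier A) →
              ∀ t n → Algebra._≈_ A (eval A ρ (t :^ n)) (pow (Algebra.commutativeRing A) (eval A ρ t) n)
    eval-:^ A ρ t zero    = RingHomomorphism.1#-homo (Algebra.ι A)
    eval-:^ A ρ t (suc n) = Algebra.*-congˡ A (eval-:^ A ρ t n)

    -- gen (i , n) stands for the pⁿ-th root of the variable i.
    data Roots (G : Set) : Rel (Term ∣ R ∣ (G × ℕ)) 0ℓ where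
      root : ∀ i n → Roots G (gen (i , suc n) :^ p) (gen (i , n))

    _[_^1/p^∞] : Set → Algebra R 0ℓ
    _[_^1/p^∞] G = ⟨ R ∣ Roots G ⟩

    -- The colimit of R → R → R → … along x ↦ xᵖ: gen (n , x) is the image of x
    -- in the nth copy, that is, the pⁿ-th root of x.
    data Frobenius : Rel (Term ∣ R ∣ (ℕ × ∣ R ∣)) 0ℓ where
      root-cong : ∀ n {x y} → x R.≈ y → Frobenius (gen (n , x)) (gen (n , y))
      root-+    : ∀ n x y → Frobenius (gen (n , x R.+ y)) (gen (n , x) :+ gen (n , y))
      root-*    : ∀ n x y → Frobenius (gen (n , x R.* y)) (gen (n , x) :* gen (n , y))
      root-1    : ∀ n → Frobenius (gen (n , R.1#)) (con R.1#)
      root-base : ∀ x → Frobenius (gen (0 , x)) (con x)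
      frobenius : ∀ n x → Frobenius (gen (suc n , pow R x p)) (gen (n , x))

    _^pf : Algebra R 0ℓ
    _^pf = ⟨ R ∣ Frobenius ⟩

    root-pow : ∀ n x k → Equal R Frobenius (pow (Algebra.commutativeRing _^pf) (gen (n , x)) k)
                                           (gen (n , pow R x k))
    root-pow n x zero    = Equal.sym (Equal.relation (root-1 n))
    root-pow n x (suc k) = Equal.trans (Equal.*-cong Equal.refl (root-pow n x k))
                                       (Equal.sym (Equal.relation (root-* n x (pow R x k))))

  -- The index i : ℕ of a variable ω stands for the index i + 1 ≥ 1.  ℒ₀ is the
  -- residue ring of ℒ, often denoted by an underlined ℒ.

  𝔽 : CommutativeRing 0ℓ 0ℓ
  𝔽 = ℤ-ring / (+ p)

  𝔽[ω] ℒ₀ : CommutativeRing 0ℓ 0ℓ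
  𝔽[ω] = Algebra.commutativeRing (Polynomial 𝔽 ℕ)
  ℒ₀   = Algebra.commutativeRing (𝔽[ω] ^pf)

  ℤ[ω] : CommutativeRing 0ℓ 0ℓ
  ℤ[ω] = Algebra.commutativeRing (ℤ-ring [ ℕ ^1/p^∞])

  p-∑ωπ : ∣ ℤ[ω] [[π]] ∣
  p-∑ωπ zero    = con (+ p)
  p-∑ωπ (suc i) = :- gen (i , 0)

  ℒ : CommutativeRing 0ℓ 0ℓ
  ℒ = ℤ[ω] [[π]] / p-∑ωπ

  π : ∣ ℒ ∣
  π 1 = con (+ 1)
  π _ = con (+ 0)

  -- ω^[ i , n ] and ω₀^[ i , n ] are the pⁿ-th roots of ωᵢ in ℒ and in ℒ₀.

  ω^[_,_] : ℕ → ℕ → ∣ ℒ ∣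
  ω^[ i , n ] zero    = gen (i , n)
  ω^[ i , n ] (suc _) = con (+ 0)

  ω₀^[_,_] : ℕ → ℕ → ∣ ℒ₀ ∣
  ω₀^[ i , n ] = gen (n , gen i)

  ℤ→𝔽[ω] : ℤ-ring ⟶ 𝔽[ω]
  ℤ→𝔽[ω] = compose 𝔽[ω] (Algebra.ι (Polynomial 𝔽 ℕ)) (quotientMap ℤ-ring (+ p))

  ℒ₀-over-ℤ : Algebra ℤ-ring 0ℓ
  ℒ₀-over-ℤ = restrictScalars ℤ→𝔽[ω] (𝔽[ω] ^pf)

  mod-p : AlgHom (ℤ-ring [ ℕ ^1/p^∞]) ℒ₀-over-ℤ
  mod-p = induced ℤ-ring (Roots ℤ-ring ℕ) ℒ₀-over-ℤ (λ { (i , n) → ω₀^[ i , n ] }) resp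
    where
    resp : ∀ {t u} → Roots ℤ-ring ℕ t u →
           CommutativeRing._≈_ ℒ₀ (eval ℒ₀-over-ℤ (λ { (i , n) → ω₀^[ i , n ] }) t)
                                  (eval ℒ₀-over-ℤ (λ { (i , n) → ω₀^[ i , n ] }) u)
    resp (root i n) = Equal.trans (eval-:^ ℤ-ring ℒ₀-over-ℤ _ (gen (i , suc n)) p)
      (Equal.trans (root-pow 𝔽[ω] (suc n) (gen i) p) (Equal.relation (frobenius n (gen i))))

  p≈0 : CommutativeRing._≈_ 𝔽 (+ p) (+ 0)
  p≈0 = + 1 , ≡.trans (ℤ.*-identityˡ (+ p)) (≡.sym (ℤ.+-identityʳ (+ p)))
    where open Mod ℤ-ring using (_,_)

  residue : ℒ ⟶ ℒ₀
  residue = quotientLift (ℤ[ω] [[π]]) ℒ₀ (compose ℒ₀ (AlgHom.hom mod-p) (constantTerm ℤ[ω]))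
              (Equal.con-cong (Equal.con-cong p≈0))

  ℒ₀-over-ℒ : Algebra ℒ 0ℓ
  ℒ₀-over-ℒ = record { commutativeRing = ℒ₀ ; ι = residue }

  record IsMultiplicativeSection (R S : CommutativeRing 0ℓ 0ℓ) (red : R ⟶ S) (τ : ∣ S ∣ → ∣ R ∣) : Set where
    private
      module R = CommutativeRing R
      module S = CommutativeRing S
    field
      cong    : ∀ {x y} → x S.≈ y → τ x R.≈ τ y
      *-homo  : ∀ x y → τ (x S.* y) R.≈ τ x R.* τ y
      section : ∀ x → ⟦ red ⟧ (τ x) S.≈ x

  record Teichmüller (R S : CommutativeRing 0ℓ 0ℓ) (red : R ⟶ S) : Set where
    field
      τ           : ∣ S ∣ → ∣ R ∣
      isSection   : IsMultiplicativeSection R S red τ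
      unique      : ∀ {τ′} → IsMultiplicativeSection R S red τ′ →
                    ∀ x → CommutativeRing._≈_ R (τ′ x) (τ x)

  -- r i is the (unique, when R is perfect) pⁱ-th root of x i.
  IsRoots : (R : CommutativeRing a ℓ) → (ℕ → ∣ R ∣) → (ℕ → ∣ R ∣) → Set ℓ
  IsRoots R x r = ∀ i → CommutativeRing._≈_ R (pow R (r i) (p ℕ.^ i)) (x i)

  -- x = ∑ᵢ [ aᵢ^(p⁻ⁱ) ] πⁱ, as a π-adically convergent series.
  IsExpansion : (∣ ℒ₀ ∣ → ∣ ℒ ∣) → ∣ ℒ ∣ → (ℕ → ∣ ℒ₀ ∣) → Set
  IsExpansion τ x a =
    ∃[ r ] IsRoots ℒ₀ a r ×
           (∀ n → x ≡ sum {n} (λ i → τ (r (toℕ i)) * pow ℒ π (toℕ i)) [mod pow ℒ π n ])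
    where
    open CommutativeRing ℒ
    open Mod ℒ
    open Algebra.Properties.Semiring.Sum semiring using (sum)

  -- inj₁ i and inj₂ i index the variables Xᵢ and Yᵢ.

  𝒫 : Algebra ℒ 0ℓ
  𝒫 = ℒ [ ℕ ⊎ ℕ ^1/p^∞]

  𝒫₀ : Algebra ℒ₀ 0ℓ
  𝒫₀ = ℒ₀ [ ℕ ⊎ ℕ ^1/p^∞]

  𝓡 : CommutativeRing 0ℓ 0ℓ
  𝓡 = Completion (Algebra.commutativeRing 𝒫) (con π)

  𝒫₀-over-ℒ : Algebra ℒ 0ℓ
  𝒫₀-over-ℒ = restrictScalars residue 𝒫₀

  mod-π : AlgHom 𝒫 𝒫₀-over-ℒ
  mod-π = induced ℒ (Roots ℒ (ℕ ⊎ ℕ)) 𝒫₀-over-ℒ gen resp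
    where
    resp : ∀ {t u} → Roots ℒ (ℕ ⊎ ℕ) t u →
           Algebra._≈_ 𝒫₀ (eval 𝒫₀-over-ℒ gen t) (eval 𝒫₀-over-ℒ gen u)
    resp (root i n) = Equal.trans (eval-:^ ℒ 𝒫₀-over-ℒ gen (gen (i , suc n)) p)
      (Equal.trans (Equal.sym (pow≈:^ (gen (i , suc n)) p)) (Equal.relation (root i n)))
      where
      pow≈:^ : ∀ t k → Algebra._≈_ 𝒫₀ (_:^_ ℒ₀ t k) (pow (Algebra.commutativeRing 𝒫₀) t k)
      pow≈:^ t zero    = Equal.refl
      pow≈:^ t (suc k) = Equal.*-cong Equal.refl (pow≈:^ t k)

  residue𝓡 : 𝓡 ⟶ Algebra.commutativeRing 𝒫₀
  residue𝓡 = compose (Algebra.commutativeRing 𝒫₀)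
    (quotientLift (Algebra.commutativeRing 𝒫) (Algebra.commutativeRing 𝒫₀) (AlgHom.hom mod-π) π¹≈0)
    (toQuotient (Algebra.commutativeRing 𝒫) (con π) 1)
    where
    open Algebra 𝒫₀
    π¹≈0 : fun mod-π (pow (Algebra.commutativeRing 𝒫) (con π) 1) ≈ 0#
    π¹≈0 = trans (*-congʳ (Equal.con-cong (CommutativeRing.refl ℒ₀))) (zeroˡ _)

  data Op : Set where
    add mul : Op

  ⟪_⟫ : Op → (R : CommutativeRing a ℓ) → ∣ R ∣ → ∣ R ∣ → ∣ R ∣
  ⟪ add ⟫ R = CommutativeRing._+_ R
  ⟪ mul ⟫ R = CommutativeRing._*_ R

  module _ (τ : Algebra.Carrier 𝒫₀ → ∣ 𝓡 ∣) where
    private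
      module 𝓡 = CommutativeRing 𝓡
      𝒫-ring = Algebra.commutativeRing 𝒫
      ∑ = series 𝒫-ring (con π)
      X^ Y^ : ℕ → ∣ 𝓡 ∣
      X^ i = ⟦ toCompletion 𝒫-ring (con π) ⟧ (gen (inj₁ i , i))
      Y^ i = ⟦ toCompletion 𝒫-ring (con π) ⟧ (gen (inj₂ i , i))

    -- ∑ Xᵢ^(p⁻ⁱ) πⁱ ⋆ ∑ Yᵢ^(p⁻ⁱ) πⁱ = ∑ [ qᵢ^(p⁻ⁱ) ] πⁱ in 𝓡.
    IsArithmetic : Op → (ℕ → Algebra.Carrier 𝒫₀) → Set
    IsArithmetic ⋆ q =
      ∃[ r ] IsRoots (Algebra.commutativeRing 𝒫₀) q r ×
             ⟪ ⋆ ⟫ 𝓡 (∑ X^) (∑ Y^) 𝓡.≈ ∑ (λ i → τ (r i))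

  Vars : ℕ → Set
  Vars n = Fin (suc n) ⊎ Fin (suc n)

  evalXY : (A : Algebra ℒ₀ c) → (ℕ → Algebra.Carrier A) → (ℕ → Algebra.Carrier A) →
           ∀ {n} → Term ∣ ℒ₀ ∣ (Vars n) → Algebra.Carrier A
  evalXY A x y = eval A [ x ∘ toℕ , y ∘ toℕ ]′

  inclusion : ∀ {n} → Algebra.Carrier (Polynomial ℒ₀ (Vars n)) → Algebra.Carrier 𝒫₀
  inclusion = evalXY 𝒫₀ (λ i → gen (inj₁ i , 0)) (λ i → gen (inj₂ i , 0))

  -- The data the constructions of Δ and W start from.  Each item is characterised
  -- by the equation defining it together with its uniqueness, so LazardData has at
  -- most one inhabitant up to pointwise equality.
  record LazardData : Set where
    field
      teichmüller   : Teichmüller ℒ ℒ₀ residue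
      teichmüller𝓡  : Teichmüller 𝓡 (Algebra.commutativeRing 𝒫₀) residue𝓡

    open Teichmüller teichmüller public using () renaming (τ to [_]ℒ)
    open Teichmüller teichmüller𝓡 public using () renaming (τ to [_]𝓡)

    field
      coord         : ∣ ℒ ∣ → ℕ → ∣ ℒ₀ ∣
      expansion     : ∀ x → IsExpansion [_]ℒ x (coord x)
      coord-unique  : ∀ x a → IsExpansion [_]ℒ x a →
                      ∀ n → CommutativeRing._≈_ ℒ₀ (a n) (coord x n)

      Q             : Op → ∀ n → Algebra.Carrier (Polynomial ℒ₀ (Vars n))
      Q-arithmetic  : ∀ ⋆ → IsArithmetic [_]𝓡 ⋆ (λ n → inclusion (Q ⋆ n))
      Q-unique      : ∀ ⋆ q → IsArithmetic [_]𝓡 ⋆ q →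
                      ∀ n → Algebra._≈_ 𝒫₀ (q n) (inclusion (Q ⋆ n))

  module _ (𝒟 : LazardData) where
    open LazardData 𝒟

    module _ (A : Algebra ℒ c) where
      private module A = Algebra A

      -- gen (n , x) is d^[n] x.
      data JetRelation : Rel (Term ∣ ℒ₀ ∣ (ℕ × A.Carrier)) c where
        d-cong  : ∀ n {x y} → x A.≈ y → JetRelation (gen (n , x)) (gen (n , y))
        d-op    : ∀ ⋆ n x y → JetRelation
                    (gen (n , ⟪ ⋆ ⟫ A.commutativeRing x y))
                    (Q ⋆ n >>= [ (λ i → gen (toℕ i , x)) , (λ i → gen (toℕ i , y)) ]′)
        d-const : ∀ n x → JetRelation (gen (n , ⟦ A.ι ⟧ x)) (con (coord x n))

    op-homo : {A B : Algebra ℒ c} (φ : AlgHom A B) → ∀ ⋆ x y →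
              Algebra._≈_ B (fun φ (⟪ ⋆ ⟫ (Algebra.commutativeRing A) x y))
                            (⟪ ⋆ ⟫ (Algebra.commutativeRing B) (fun φ x) (fun φ y))
    op-homo φ add = AlgHom.+-homo φ
    op-homo φ mul = AlgHom.*-homo φ

    Δ₀ : Algebra ℒ c → Algebra ℒ₀ c
    Δ₀ A = ⟨ ℒ₀ ∣ JetRelation A ⟩

    Δ₁ : {A B : Algebra ℒ c} → AlgHom A B → AlgHom (Δ₀ A) (Δ₀ B)
    Δ₁ {A = A} {B} φ = induced ℒ₀ (JetRelation A) (Δ₀ B) ρ resp
      where
      open Algebra (Δ₀ B)
      ρ : ℕ × Algebra.Carrier A → Carrier
      ρ (n , x) = gen (n , fun φ x)

      eval≡>>= : {G : Set} (σ : G → Carrier) (t : Term ∣ ℒ₀ ∣ G) → eval (Δ₀ B) σ t ≈ (t >>= σ)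
      eval≡>>= σ (con x)  = refl
      eval≡>>= σ (gen i)  = refl
      eval≡>>= σ (t :+ u) = +-cong (eval≡>>= σ t) (eval≡>>= σ u)
      eval≡>>= σ (t :* u) = *-cong (eval≡>>= σ t) (eval≡>>= σ u)
      eval≡>>= σ (:- t)   = -‿cong (eval≡>>= σ t)

      resp : ∀ {t u} → JetRelation A t u → eval (Δ₀ B) ρ t ≈ eval (Δ₀ B) ρ u
      resp (d-cong n x≈y)  = Equal.relation (d-cong n (AlgHom.cong φ x≈y))
      resp (d-const n x)   = trans (Equal.relation (d-cong n (AlgHom.commutes φ x)))
                                   (Equal.relation (d-const n x))
      resp (d-op ⋆ n x y)  =
        trans (Equal.relation (d-cong n (op-homo φ ⋆ x y)))
        (trans (Equal.relation (d-op ⋆ n (fun φ x) (fun φ y)))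
        (trans (sym (eval≡>>= _ (Q ⋆ n)))
        (trans (eval-cong-ρ (Δ₀ B) (λ { (inj₁ i) → refl ; (inj₂ i) → refl }) (Q ⋆ n))
               (sym (eval->>= (Δ₀ B) ρ _ (Q ⋆ n))))))

    Δ : Functor (Alg ℒ c) (Alg ℒ₀ c)
    Δ = record
      { F₀       = Δ₀
      ; F₁       = Δ₁
      ; F-resp-≈ = λ {A} {B} {φ} {ψ} φ≈ψ → hom-ext ℒ₀ (JetRelation A) (Δ₀ B) (Δ₁ φ) (Δ₁ ψ)
                     (λ { (n , x) → Equal.relation (d-cong n (φ≈ψ x)) })
      ; F-id     = λ {A} → hom-ext ℒ₀ (JetRelation A) (Δ₀ A) (Δ₁ (Category.idᶜ (Alg ℒ _)))
                     (Category.idᶜ (Alg ℒ₀ _)) (λ _ → Equal.refl)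
      ; F-∘      = λ {A} {B} {C} {φ} {ψ} → hom-ext ℒ₀ (JetRelation A) (Δ₀ C)
                     (Δ₁ (Category._∘ᶜ_ (Alg ℒ _) φ ψ)) (Category._∘ᶜ_ (Alg ℒ₀ _) (Δ₁ φ) (Δ₁ ψ))
                     (λ _ → Equal.refl)
      }

    module _ (k : Algebra ℒ₀ c) where
      private module k = Algebra k

      infix 4 _≈ᵂ_
      _≈ᵂ_ : Rel (ℕ → k.Carrier) c
      α ≈ᵂ β = ∀ n → α n k.≈ β n

      opᵂ : Op → (ℕ → k.Carrier) → (ℕ → k.Carrier) → ℕ → k.Carrier
      opᵂ ⋆ α β n = evalXY k α β (Q ⋆ n)

      -- (x , 0 , 0 , …)
      first : k.Carrier → ℕ → k.Carrier
      first x zero    = x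
      first x (suc _) = k.0#

      second : k.Carrier → ℕ → k.Carrier
      second x zero    = k.0#
      second x (suc n) = first x n

    -- The ℒ-algebra structures on the sets k^ℕ, naturally in k.  The structure map
    -- is pinned down by its values at π and at the roots of the ωᵢ, since multiples
    -- of πⁿ in W(k) vanish in the first n coordinates.
    record WittStructure c : Set (lsuc c) where
      field
        negᵂ : (k : Algebra ℒ₀ c) → (ℕ → Algebra.Carrier k) → ℕ → Algebra.Carrier k
        isCommutativeRing : ∀ k → IsCommutativeRing (_≈ᵂ_ k) (opᵂ k add) (opᵂ k mul) (negᵂ k)
                                    (first k (Algebra.0# k)) (first k (Algebra.1# k))

      ringᵂ : Algebra ℒ₀ c → CommutativeRing c c
      ringᵂ k = record { isCommutativeRing = isCommutativeRing k }

      field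
        ιᵂ : ∀ k → ℒ ⟶ ringᵂ k
        ι-ω : ∀ k i n → _≈ᵂ_ k (⟦ ιᵂ k ⟧ ω^[ i , n ]) (first k (⟦ Algebra.ι k ⟧ ω₀^[ i , n ]))
        ι-π : ∀ k → _≈ᵂ_ k (⟦ ιᵂ k ⟧ π) (second k (Algebra.1# k))
        ι-natural : ∀ {k k′ : Algebra ℒ₀ c} (f : AlgHom k k′) x →
                    _≈ᵂ_ k′ (fun f ∘ ⟦ ιᵂ k ⟧ x) (⟦ ιᵂ k′ ⟧ x)

      W₀ : Algebra ℒ₀ c → Algebra ℒ c
      W₀ k = record { commutativeRing = ringᵂ k ; ι = ιᵂ k }

      W₁ : ∀ {k k′} → AlgHom k k′ → AlgHom (W₀ k) (W₀ k′)
      W₁ {k} {k′} f = record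
        { hom = mkHom (ringᵂ k) (ringᵂ k′) (fun f ∘_) (λ α≈β n → AlgHom.cong f (α≈β n))
                  (op-homoᵂ add) (op-homoᵂ mul) one
        ; commutes = ι-natural f
        }
        where
        open Algebra k′
        op-homoᵂ : ∀ ⋆ α β → _≈ᵂ_ k′ (fun f ∘ opᵂ k ⋆ α β) (opᵂ k′ ⋆ (fun f ∘ α) (fun f ∘ β))
        op-homoᵂ ⋆ α β n = trans (eval-natural f _ (Q ⋆ n))
          (eval-cong-ρ k′ (λ { (inj₁ i) → refl ; (inj₂ i) → refl }) (Q ⋆ n))
        one : _≈ᵂ_ k′ (fun f ∘ first k (Algebra.1# k)) (first k′ 1#)
        one zero    = AlgHom.1#-homo f
        one (suc n) = AlgHom.0#-homo f

      W : Functor (Alg ℒ₀ c) (Alg ℒ c)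
      W = record
        { F₀       = W₀
        ; F₁       = W₁
        ; F-resp-≈ = λ f≈g α n → f≈g (α n)
        ; F-id     = λ {k} α n → Algebra.refl k
        ; F-∘      = λ {_} {_} {k} α n → Algebra.refl k
        }

  record IsCRP (B : Algebra ℒ c) : Set c where
    private module B = Algebra B

    πᴮ : B.Carrier
    πᴮ = ⟦ B.ι ⟧ π

    multiplication : Tensor ℒ (principalIdeal ℒ π) (asModule ℒ B) → B.Carrier
    multiplication = foldr (λ { ((x , _) , b) s → ⟦ B.ι ⟧ x B.* b B.+ s }) B.0#

    field
      complete      : Bijective B._≈_ (CommutativeRing._≈_ (Completion B.commutativeRing πᴮ))
                   ⟦ toCompletion B.commutativeRing πᴮ ⟧
      perfect       : IsPerfect p (B.commutativeRing / πᴮ)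
      πℒ⊗-injective : Injective (_≈⊗_ ℒ (principalIdeal ℒ π) (asModule ℒ B)) B._≈_ multiplication

  CRP : ∀ c → Category (lsuc c) c c
  CRP c = FullSubcategory (Alg ℒ c) IsCRP

  IsPerfectAlgebra : Algebra ℒ₀ c → Set c
  IsPerfectAlgebra k = IsPerfect p (Algebra.commutativeRing k)

  PerfAlg : ∀ c → Category (lsuc c) c c
  PerfAlg c = FullSubcategory (Alg ℒ₀ c) IsPerfectAlgebra

  U : Functor (Alg ℒ c) (Alg ℒ₀ c)
  U = baseChange ℒ₀-over-ℒ

module Submission where

-- For a sequence a in a ring with p ∈ (π) let wₙ(a) = ∑ᵢ≤ₙ aᵢ^(pⁿ⁻ⁱ) πⁱ.  As a ≡ b mod π implies
-- a^(pᵏ) ≡ b^(pᵏ) mod πᵏ⁺¹, the class of wₙ(a) mod πⁿ⁺¹ depends only on a mod π; and if π is regular,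
-- then wₙ(a) mod πⁿ⁺¹ and the aᵢ mod π with i < n determine aₙ mod π.  The Qₙ are found one after
-- another from the requirement that wₙ map sums and products in W to sums and products; at level n,
-- the coefficients of the Qᵢ are replaced by their pⁿ-th roots.  Identities in W(k), such as the ring
-- laws, the homomorphism ℒ → W(k) and π α = (0, α₀ᵖ, α₁ᵖ, …), then hold because both sides have the
-- same ghost components wₙ over ℒ[X] → ℒ₀[X], where π is regular.  If B is complete and π-torsion
-- free with perfect residue ring, choose lifts aᵢ,ₙ of the pⁿ-th roots of αᵢ; the wₙ(aᵢ,ₙ)ᵢ converge
-- to ∑ [αᵢ^(p⁻ⁱ)] πⁱ, and α ↦ lim wₙ is the isomorphism W(B/π) ≅ B that serves as counit.

open import Defs
open import Algebra.Bundles using (CommutativeRing; RawRing)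
open import Algebra.Definitions.RawMagma using (module _∣ʳ_)
open import Algebra.Module.Bundles using (LeftModule)
open import Algebra.Morphism.Bundles using (module RingHomomorphism)
import Algebra.Properties.CommutativeSemigroup
import Algebra.Properties.CommutativeSemiring.Binomial
import Algebra.Properties.CommutativeSemiring.Exp
import Algebra.Properties.Ring
import Algebra.Properties.Semiring.Exp
import Algebra.Properties.Semiring.Mult
import Algebra.Properties.Semiring.Sum
import Algebra.Solver.Ring
open import Algebra.Solver.Ring.AlmostCommutativeRing using (fromCommutativeRing; _-Raw-AlmostCommutative⟶_)
open import Algebra.Structures using (IsCommutativeRing)
open import Data.Bool.Base using (if_then_else_)
open import Data.Fin.Base using (Fin; toℕ; fromℕ; inject₁) renaming (zero to fzero; suc to fsuc)
import Data.Fin.Properties as Fin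
open import Data.Integer.Base using (+_; -[1+_])
import Data.Integer.Base as ℤ
import Data.Integer.Properties as ℤ
open import Data.Integer.Properties using () renaming (+-*-commutativeRing to ℤ-ring)
open import Data.List.Base using (List; []; _∷_; _++_; length)
import Data.List.Membership.DecPropositional as DecMembership
open import Data.List.Membership.Propositional.Properties using (∈-∃++)
open import Data.List.Properties using (++-identityʳ)
open import Data.List.Relation.Binary.Permutation.Propositional using (_↭_; prep; swap; ↭-sym; ↭-trans; ↭-refl)
import Data.List.Relation.Binary.Permutation.Propositional as ↭
open import Data.List.Relation.Binary.Permutation.Propositional.Properties using (shift; drop-∷; ∈-resp-↭; ↭-empty-inv)
open import Data.List.Relation.Unary.Any using (here)
open import Data.Maybe.Base using (Maybe; just; nothing)
open import Data.Nat.Base using (ℕ; zero; suc; _∸_; _≤_; _<_; z≤n; s≤s; _!)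
import Data.Nat.Base as ℕ
open import Data.Nat.Combinatorics using (nCn≡1; nCk≡n!/k![n-k]!; k![n∸k]!∣n!) renaming (_C_ to _choose_)
import Data.Nat.DivMod as ℕ
import Data.Nat.Divisibility as ℕ
open import Data.Nat.Primality using (Prime; euclidsLemma; prime⇒nonTrivial; prime⇒nonZero)
import Data.Nat.Properties as ℕ
open import Data.Product.Base using (Σ; Σ-syntax; ∃-syntax; _×_; _,_; proj₁; proj₂)
open import Data.Product.Properties using (≡-dec)
open import Data.Sum.Base using (_⊎_; inj₁; inj₂; [_,_]′)
import Data.Sum.Properties as ⊎
open import Function.Base using (_∘_)
open import Function.Definitions using (Injective; Bijective)
open import Level using (Level; 0ℓ; _⊔_; Setω)
open import Relation.Binary.Core using (Rel)
open import Relation.Binary.Definitions using (DecidableEquality)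
open import Relation.Binary.PropositionalEquality.Core as ≡ using (_≡_; _≢_)
import Relation.Binary.Reasoning.Setoid as SetoidReasoning
open import Relation.Binary.Structures using (IsEquivalence)
open import Relation.Nullary.Decidable using (Dec; yes; no; does)
open import Relation.Nullary.Negation using (contradiction; ¬_)
open Presentation using (Equal; module Equal; ⟨_∣_⟩)

-- Classically the Qₙ have integral coefficients, which Frobenius fixes modulo p. Here they lie in
-- ℒ₀, on which Frobenius acts nontrivially, and this shapes the construction. The component wₙ
-- approximates ∑ [αᵢ^(p⁻ⁱ)] πⁱ when its arguments lift the pⁿ-th roots of the αᵢ. Variables of a
-- polynomial ring have no such roots, but the roots can be renamed as variables, after which only
-- the coefficients still have to be replaced by their roots. So wₙ belongs to `k ⁽ n ⁾`, where
-- scalars act through their pⁿ-th roots, and the step from n + 1 to n is the Frobenius from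
-- `k ⁽ suc n ⁾` to `k ⁽ n ⁾`, which is then linear. In the other direction, evaluation with
-- coefficients raised to their pⁿ-th powers is a linear map from a twisted polynomial ring to any
-- ℒ₀-algebra, perfect or not; it carries identities from the generic case to all k. The residue
-- ring R / π appears as a polynomial ring over ℒ₀, as coordinate 0 of W(k) and as B ⊗ ℒ₀, so the
-- arguments are run for a `Pair` of R with any ring that plays this role.

private
  variable
    a b c c′ ℓ ℓ′ : Level

-- Binomial coefficients modulo a prime.

prime∤! : ∀ {p} → Prime p → ∀ {k} → k < p → ¬ (p ℕ.∣ k !)
prime∤! {p} pp {zero}  k<p p∣1 = contradiction (ℕ.∣1⇒≡1 p∣1) (ℕ.nonTrivial⇒≢1 {{prime⇒nonTrivial pp}})
prime∤! {p} pp {suc k} k<p d with euclidsLemma (suc k) (k !) pp d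
... | inj₁ p∣k+1 = contradiction (ℕ.∣⇒≤ p∣k+1) (ℕ.<⇒≱ k<p)
... | inj₂ p∣k!  = prime∤! pp (ℕ.<-trans (ℕ.n<1+n k) k<p) p∣k!

-- `p` divides `p !`, which is the binomial coefficient times `k !` and `(p ∸ k) !`, and by
-- `prime∤!` it divides neither factorial.
prime∣binomial : ∀ {p} → Prime p → ∀ {k} → 0 < k → k < p → p ℕ.∣ p choose k
prime∣binomial {p} pp {k} 0<k k<p with euclidsLemma (p choose k) (k ! ℕ.* (p ∸ k) !) pp p∣product
  where
  instance _ = k ℕ.!* (p ∸ k) !≢0
  product≡ : (p choose k) ℕ.* (k ! ℕ.* (p ∸ k) !) ≡ p !
  product≡ = ≡.trans (≡.cong (ℕ._* (k ! ℕ.* (p ∸ k) !)) (nCk≡n!/k![n-k]! (ℕ.<⇒≤ k<p)))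
    (ℕ.m/n*n≡m (k![n∸k]!∣n! (ℕ.<⇒≤ k<p)))
  p∣product : p ℕ.∣ (p choose k) ℕ.* (k ! ℕ.* (p ∸ k) !)
  p∣product = ≡.subst (p ℕ.∣_) (≡.sym product≡) (p∣p! p (prime⇒nonZero pp))
    where
    p∣p! : ∀ n → ℕ.NonZero n → n ℕ.∣ n !
    p∣p! (suc n) _ = ℕ.m∣m*n (n !)
... | inj₁ d = d
... | inj₂ d with euclidsLemma (k !) ((p ∸ k) !) pp d
...   | inj₁ e = contradiction e (prime∤! pp k<p)
...   | inj₂ e = contradiction e (prime∤! pp (ℕ.∸-monoʳ-< 0<k (ℕ.<⇒≤ k<p)))

module _ (R : CommutativeRing a ℓ) (S : CommutativeRing b ℓ′) (φ : R ⟶ S) where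
  private
    module R = CommutativeRing R
    module S = CommutativeRing S
  open RingHomomorphism φ

  hom-^ : ∀ x n → ⟦ pow R x n ⟧ S.≈ pow S ⟦ x ⟧ n
  hom-^ x zero    = 1#-homo
  hom-^ x (suc n) = S.trans (*-homo x (pow R x n)) (S.*-congˡ (hom-^ x n))

-- Solving ring equations with integer coefficients.

-- Natural number pairs (m , n) stand for the integer coefficient m - n.
module IntegerCoefficients (R : CommutativeRing a ℓ) where
  open CommutativeRing R
  open Algebra.Properties.Ring ring
  open Algebra.Properties.Semiring.Mult semiring
    renaming (_×_ to _times_)
    using (×-homo-+; ×1-homo-*; ×-congˡ)
  open SetoidReasoning setoid
  import Algebra.Properties.CommutativeSemigroup +-commutativeSemigroup as CS

  coefficients : RawRing 0ℓ 0ℓ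
  coefficients = record
    { Carrier = ℕ × ℕ
    ; _≈_ = _≡_
    ; _+_ = λ { (m , n) (k , l) → m ℕ.+ k , n ℕ.+ l }
    ; _*_ = λ { (m , n) (k , l) → m ℕ.* k ℕ.+ n ℕ.* l , m ℕ.* l ℕ.+ n ℕ.* k }
    ; -_  = λ { (m , n) → n , m }
    ; 0#  = 0 , 0
    ; 1#  = 1 , 0
    }

  private
    ι : ℕ → Carrier
    ι n = n times 1#

    -+- : ∀ x y z w → (x + z) - (y + w) ≈ (x - y) + (z - w)
    -+- x y z w = trans (+-congˡ (sym (-‿+-comm y w))) (CS.interchange x z (- y) (- w))

    -*- : ∀ x y z w → (x * z + y * w) - (x * w + y * z) ≈ (x - y) * (z - w)
    -*- x y z w = begin
      (x * z + y * w) - (x * w + y * z)              ≈⟨ -+- (x * z) (x * w) (y * w) (y * z) ⟩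
      (x * z - x * w) + (y * w - y * z)              ≈⟨ +-cong (sym (x[y-z]≈xy-xz x z w)) (sym (x[y-z]≈xy-xz y w z)) ⟩
      x * (z - w) + y * (w - z)                      ≈⟨ +-congˡ (*-congˡ (neg-swap w z)) ⟩
      x * (z - w) + y * - (z - w)                    ≈⟨ +-congˡ (trans (sym (-‿distribʳ-* y _)) (-‿distribˡ-* y _)) ⟩
      x * (z - w) + - y * (z - w)                    ≈⟨ distribʳ (z - w) x (- y) ⟨
      (x - y) * (z - w)                              ∎
      where
      neg-swap : ∀ u v → u - v ≈ - (v - u)
      neg-swap u v = begin
        u - v        ≈⟨ +-comm u (- v) ⟩
        - v + u      ≈⟨ +-congˡ (-‿involutive u) ⟨
        - v - - u    ≈⟨ -‿+-comm v (- u) ⟩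
        - (v - u)    ∎

  morphism : coefficients -Raw-AlmostCommutative⟶ fromCommutativeRing R
  morphism = record
    { ⟦_⟧    = λ { (m , n) → ι m - ι n }
    ; +-homo = λ { (m , n) (k , l) → trans
        (+-cong (×-homo-+ 1# m k) (-‿cong (×-homo-+ 1# n l))) (-+- _ _ _ _) }
    ; *-homo = λ { (m , n) (k , l) → trans
        (+-cong (hom m k n l) (-‿cong (hom m l n k))) (-*- _ _ _ _) }
    ; -‿homo = λ { (m , n) → trans (+-comm _ _)
        (trans (+-congˡ (sym (-‿involutive _))) (-‿+-comm _ _)) }
    ; 0-homo = trans (+-identityˡ _) -0#≈0#
    ; 1-homo = trans (+-cong (+-identityʳ _) -0#≈0#) (+-identityʳ _)
    }
    where
    hom : ∀ m k n l → ι (m ℕ.* k ℕ.+ n ℕ.* l) ≈ ι m * ι k + ι n * ι l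
    hom m k n l = trans (×-homo-+ 1# (m ℕ.* k) (n ℕ.* l)) (+-cong (×1-homo-* m k) (×1-homo-* n l))

  -- Differences are compared by cross addition, the pairs not being normalised. A failed comparison
  -- yields only `nothing`, because distinct integers may coincide in `R`.
  weaklyDecide : ∀ x y → Maybe (_-Raw-AlmostCommutative⟶_.⟦_⟧ morphism x ≈ _-Raw-AlmostCommutative⟶_.⟦_⟧ morphism y)
  weaklyDecide (m , n) (k , l) with (m ℕ.+ l) ℕ.≟ (k ℕ.+ n)
  ... | no _   = nothing
  ... | yes eq = just (begin
    ι m - ι n                      ≈⟨ +-identityʳ _ ⟨
    (ι m - ι n) + 0#               ≈⟨ +-congˡ (-‿inverseʳ (ι l)) ⟨
    (ι m - ι n) + (ι l - ι l)      ≈⟨ -+- _ _ _ _ ⟨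
    (ι m + ι l) - (ι n + ι l)      ≈⟨ +-cong (trans (sym (×-homo-+ 1# m l)) (trans (×-congˡ eq) (×-homo-+ 1# k n)))
                                             (-‿cong (+-comm _ _)) ⟩
    (ι k + ι n) - (ι l + ι n)      ≈⟨ -+- _ _ _ _ ⟩
    (ι k - ι l) + (ι n - ι n)      ≈⟨ +-congˡ (-‿inverseʳ (ι n)) ⟩
    (ι k - ι l) + 0#               ≈⟨ +-identityʳ _ ⟩
    ι k - ι l                      ∎)

module Solver {a ℓ} (R : CommutativeRing a ℓ) =
  Algebra.Solver.Ring (IntegerCoefficients.coefficients R) (fromCommutativeRing R)
    (IntegerCoefficients.morphism R) (IntegerCoefficients.weaklyDecide R)

-- Congruences, Frobenius and ghost components.

module RingTheory {a ℓ} (R : CommutativeRing a ℓ) where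
  open CommutativeRing R
  open Mod R
  open Algebra.Properties.Ring ring using (-0#≈0#)
  open Algebra.Properties.Semiring.Exp semiring
  open Algebra.Properties.CommutativeSemiring.Exp commutativeSemiring using (^-distrib-*)
  open Algebra.Properties.Semiring.Mult semiring
    renaming (_×_ to _times_)
    using (×-congʳ; ×-assocˡ; ×-homo-1; ×-comm-*; ×-assoc-*)
  open Algebra.Properties.Semiring.Sum semiring using (sum; sum-cong-≋; sum-init-last)
  open Solver R using (solve; _:=_; con) renaming (_:+_ to _⊕_; _:*_ to _⊛_; _:-_ to _⊝_; :-_ to ⊝_)

  x-y≈0⇒x≈y : ∀ {x y} → x - y ≈ 0# → x ≈ y
  x-y≈0⇒x≈y {x} {y} e = trans (solve 2 (λ x y → x := (x ⊝ y) ⊕ y) refl x y)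
    (trans (+-congʳ e) (+-identityˡ y))

  x≈y⇒x-y≈0 : ∀ {x y} → x ≈ y → x - y ≈ 0#
  x≈y⇒x-y≈0 {x} {y} e = trans (+-congʳ e) (-‿inverseʳ y)

  IsRegular : Carrier → Set _
  IsRegular d = ∀ x → d * x ≈ 0# → x ≈ 0#

  regular-cancel : ∀ {d} → IsRegular d → ∀ {x y} → d * x ≈ d * y → x ≈ y
  regular-cancel {d} reg {x} {y} e = x-y≈0⇒x≈y (reg (x - y)
    (trans (solve 3 (λ d x y → d ⊛ (x ⊝ y) := d ⊛ x ⊝ d ⊛ y) refl d x y) (x≈y⇒x-y≈0 e)))

  mod-refl : ∀ {f x} → x ≡ x [mod f ]
  mod-refl = ≈⇒mod refl

  mod-sym : ∀ {f x y} → x ≡ y [mod f ] → y ≡ x [mod f ]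
  mod-sym = IsEquivalence.sym mod-isEquivalence

  mod-trans : ∀ {f x y z} → x ≡ y [mod f ] → y ≡ z [mod f ] → x ≡ z [mod f ]
  mod-trans = IsEquivalence.trans mod-isEquivalence

  mod-respˡ : ∀ {f x y z} → x ≈ y → y ≡ z [mod f ] → x ≡ z [mod f ]
  mod-respˡ e = mod-trans (≈⇒mod e)

  mod-respʳ : ∀ {f x y z} → x ≡ y [mod f ] → y ≈ z → x ≡ z [mod f ]
  mod-respʳ d e = mod-trans d (≈⇒mod e)

  mod-divisor : ∀ {f g x y} → f ≈ g → x ≡ y [mod f ] → x ≡ y [mod g ]
  mod-divisor f≈g (q , e) = q , trans (*-congˡ (sym f≈g)) e

  mod-factorˡ : ∀ {f g x y} → x ≡ y [mod f * g ] → x ≡ y [mod g ]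
  mod-factorˡ {f} {g} (q , e) = q * f , trans (*-assoc q f g) e

  mod-scale : ∀ {f x y} z → x ≡ y [mod f ] → z * x ≡ z * y [mod z * f ]
  mod-scale {f} {x} {y} z (q , e) = q , (begin
    q * (z * f)      ≈⟨ solve 3 (λ q z f → q ⊛ (z ⊛ f) := z ⊛ (q ⊛ f)) refl q z f ⟩
    z * (q * f)      ≈⟨ *-congˡ e ⟩
    z * (x - y)      ≈⟨ solve 3 (λ z x y → z ⊛ (x ⊝ y) := z ⊛ x ⊝ z ⊛ y) refl z x y ⟩
    z * x - z * y    ∎)
    where open SetoidReasoning setoid

  mod-unscale : ∀ {f x y z} → IsRegular z → z * x ≡ z * y [mod z * f ] → x ≡ y [mod f ]
  mod-unscale {f} {x} {y} {z} reg (q , e) = q , regular-cancel reg (begin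
    z * (q * f)      ≈⟨ solve 3 (λ q z f → z ⊛ (q ⊛ f) := q ⊛ (z ⊛ f)) refl q z f ⟩
    q * (z * f)      ≈⟨ e ⟩
    z * x - z * y    ≈⟨ solve 3 (λ z x y → z ⊛ x ⊝ z ⊛ y := z ⊛ (x ⊝ y)) refl z x y ⟩
    z * (x - y)      ∎)
    where open SetoidReasoning setoid

  +-cancelˡ-mod : ∀ {f x x′ y y′} → x ≡ x′ [mod f ] → x + y ≡ x′ + y′ [mod f ] → y ≡ y′ [mod f ]
  +-cancelˡ-mod {f} {x} {x′} {y} {y′} d e = mod-respˡ (solve 2 (λ x y → y := ⊝ x ⊕ (x ⊕ y)) refl x y)
    (mod-respʳ (mod-+-cong (mod-neg-cong d) e) (solve 2 (λ x y → ⊝ x ⊕ (x ⊕ y) := y) refl x′ y′))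

  divides : ∀ {f x y} q → q * f ≈ x - y → x ≡ y [mod f ]
  divides q e = q , e

  quotient : ∀ {f x y} → x ≡ y [mod f ] → Carrier
  quotient (q , _) = q

  quotient-eq : ∀ {f x y} (d : x ≡ y [mod f ]) → quotient d * f ≈ x - y
  quotient-eq (_ , e) = e

  mod-witness : ∀ {f x y} (d : x ≡ y [mod f ]) → x ≈ y + quotient d * f
  mod-witness {f} {x} {y} (q , e) = trans (solve 2 (λ x y → x := y ⊕ (x ⊝ y)) refl x y) (+-congˡ (sym e))

  mod-^ : ∀ {f x y} n → x ≡ y [mod f ] → x ^ n ≡ y ^ n [mod f ]
  mod-^ zero    d = mod-refl
  mod-^ (suc n) d = mod-*-cong d (mod-^ n d)

  mod-≤ : ∀ π m n {x y} → m ≤ n → x ≡ y [mod π ^ n ] → x ≡ y [mod π ^ m ]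
  mod-≤ π m n m≤n d = mod-factorˡ {π ^ (n ∸ m)} (mod-divisor
    (trans (^-congʳ π (≡.sym (ℕ.m∸n+n≡m m≤n))) (^-homo-* π (n ∸ m) m)) d)

  mod-zero : ∀ {π x y} → x ≡ y [mod π ^ 0 ]
  mod-zero {x = x} {y} = x - y , *-identityʳ _

  mod⇒mod¹ : ∀ {π x y} → x ≡ y [mod π ] → x ≡ y [mod π ^ 1 ]
  mod⇒mod¹ {π} = mod-divisor (sym (*-identityʳ π))

  mod¹⇒mod : ∀ {π x y} → x ≡ y [mod π ^ 1 ] → x ≡ y [mod π ]
  mod¹⇒mod {π} = mod-divisor (*-identityʳ π)

  mod^⇒mod : ∀ π n {x y} → x ≡ y [mod π ^ suc n ] → x ≡ y [mod π ]
  mod^⇒mod π n d = mod¹⇒mod (mod-≤ π 1 (suc n) (s≤s z≤n) d)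

  one-^ : ∀ n → 1# ^ n ≈ 1#
  one-^ zero    = refl
  one-^ (suc n) = trans (*-identityˡ _) (one-^ n)

  -- (y + d)ⁿ⁺¹ = yⁿ⁺¹ + d ((n + 1) yⁿ + d e).
  taylor : ∀ y d n → Σ Carrier λ e → (y + d) ^ suc n ≈ y ^ suc n + d * ((suc n times 1#) * y ^ n + d * e)
  taylor y d zero = 0# , (begin
    (y + d) * 1#                                   ≈⟨ *-identityʳ _ ⟩
    y + d                                          ≈⟨ +-cong (*-identityʳ y) (trans (*-congˡ (trans (+-congˡ (zeroʳ d)) (trans (+-identityʳ _) (trans (*-identityʳ _) (+-identityʳ _))))) (*-identityʳ d)) ⟨
    y * 1# + d * ((1# + 0#) * 1# + d * 0#)         ∎)
    where open SetoidReasoning setoid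
  taylor y d (suc n) = let e , eq = taylor y d n in
    (suc n times 1#) * y ^ n + (y + d) * e , (begin
    (y + d) * (y + d) ^ suc n
      ≈⟨ *-congˡ eq ⟩
    (y + d) * (y ^ suc n + d * ((suc n times 1#) * y ^ n + d * e))
      ≈⟨ solve 5 (λ y d k z e → (y ⊕ d) ⊛ (y ⊛ z ⊕ d ⊛ (k ⊛ z ⊕ d ⊛ e)) :=
                   y ⊛ (y ⊛ z) ⊕ d ⊛ ((con (1 , 0) ⊕ k) ⊛ (y ⊛ z) ⊕ d ⊛ (k ⊛ z ⊕ (y ⊕ d) ⊛ e))) refl
               y d (suc n times 1#) (y ^ n) e ⟩
    y ^ suc (suc n) + d * (((1 times 1# - 0 times 1#) + suc n times 1#) * y ^ suc n + d * ((suc n times 1#) * y ^ n + (y + d) * e))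
      ≈⟨ +-congˡ (*-congˡ (+-congʳ (*-congʳ (+-congʳ (trans (+-congˡ -0#≈0#) (trans (+-identityʳ _) (+-identityʳ _))))))) ⟩
    y ^ suc (suc n) + d * ((suc (suc n) times 1#) * y ^ suc n + d * ((suc n times 1#) * y ^ n + (y + d) * e)) ∎)
    where open SetoidReasoning setoid

  -- wₙ(a) = ∑ᵢ≤ₙ aᵢ^(pⁿ⁻ⁱ) πⁱ
  ghost : ℕ → Carrier → ℕ → (ℕ → Carrier) → Carrier
  ghost p π zero    a = a 0
  ghost p π (suc n) a = a 0 ^ (p ℕ.^ suc n) + π * ghost p π n (a ∘ suc)

  module _ {p : ℕ} (pp : Prime p) where

    frobenius-+ : p times 1# ≈ 0# → ∀ x y → (x + y) ^ p ≈ x ^ p + y ^ p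
    frobenius-+ p≈0 x y = go p ≡.refl
      where
      open SetoidReasoning setoid
      open Algebra.Properties.CommutativeSemiring.Binomial commutativeSemiring
        using (binomialTerm; theorem)

      times-p : ∀ {n} z → p ℕ.∣ n → n times z ≈ 0#
      times-p z (ℕ.divides q ≡.refl) = begin
        (q ℕ.* p) times z         ≈⟨ ×-assocˡ z q p ⟨
        q times (p times z)       ≈⟨ ×-congʳ q (trans (×-congʳ p (sym (*-identityˡ z))) (trans (sym (×-assoc-* p 1# z)) (trans (*-congʳ p≈0) (zeroˡ z)))) ⟩
        q times 0#                ≈⟨ times-0 q ⟩
        0#                        ∎
        where
        times-0 : ∀ q → q times 0# ≈ 0#
        times-0 zero    = refl
        times-0 (suc q) = trans (+-identityˡ _) (times-0 q)

      sum-0 : ∀ n (f : Fin n → Carrier) → (∀ i → f i ≈ 0#) → sum f ≈ 0#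
      sum-0 zero    f f≈0 = refl
      sum-0 (suc n) f f≈0 = trans (+-cong (f≈0 fzero) (sum-0 n (f ∘ fsuc) (f≈0 ∘ fsuc))) (+-identityˡ 0#)

      last≈ : ∀ q → q ≡ p → (q choose toℕ (fromℕ q)) times (x ^ toℕ (fromℕ q) * y ^ (q ∸ toℕ (fromℕ q))) ≈ x ^ p
      last≈ q ≡.refl rewrite Fin.toℕ-fromℕ q | nCn≡1 q | ℕ.n∸n≡0 q = trans (×-homo-1 _) (*-identityʳ _)

      -- The exponent is a separate `q` so that it can be matched as `suc m` while `pp` still speaks
      -- of `p`.
      go : ∀ q → q ≡ p → (x + y) ^ q ≈ x ^ q + y ^ q
      go zero    ≡.refl with () ← prime⇒nonZero pp
      go (suc m) ≡.refl = begin
        (x + y) ^ suc m                                               ≈⟨ theorem (suc m) x y ⟩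
        term fzero + sum {suc m} (term ∘ fsuc)                        ≈⟨ +-cong (trans (×-homo-1 _) (*-identityˡ _)) (sum-init-last {m} (term ∘ fsuc)) ⟩
        y ^ suc m + (sum {m} (λ i → term (fsuc (inject₁ i))) + term (fromℕ (suc m))) ≈⟨ +-congˡ (+-cong (sum-0 m _ middle) (last≈ (suc m) ≡.refl)) ⟩
        y ^ suc m + (0# + x ^ suc m)                                  ≈⟨ trans (+-congˡ (+-identityˡ _)) (+-comm _ _) ⟩
        x ^ suc m + y ^ suc m                                         ∎
        where
        term = binomialTerm x y (suc m)
        middle : ∀ i → term (fsuc (inject₁ i)) ≈ 0#
        middle i = times-p _ (prime∣binomial pp (s≤s z≤n)
          (s≤s (≡.subst (ℕ._< m) (≡.sym (Fin.toℕ-inject₁ i)) (Fin.toℕ<n i))))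

    module Ghost {π u : Carrier} (p≈uπ : p times 1# ≈ u * π) where

      -- For x = y + d with d = q πⁿ⁺¹, `taylor` gives xᵖ - yᵖ = d (p yᵖ⁻¹ + d e). Both summands in
      -- the bracket are multiples of π, the first because p = u π, so one factor π is gained.
      mod-^p : ∀ n {x y} → x ≡ y [mod π ^ suc n ] → x ^ p ≡ y ^ p [mod π ^ suc (suc n) ]
      mod-^p n {x} {y} d@(q , _) = go p ≡.refl
        where
        open SetoidReasoning setoid
        go : ∀ k → k ≡ p → x ^ k ≡ y ^ k [mod π ^ suc (suc n) ]
        go zero ≡.refl with () ← prime⇒nonZero pp
        go (suc m) ≡.refl = step (taylor y (q * π ^ suc n) m)
          where
          step : (Σ Carrier λ e → (y + q * π ^ suc n) ^ suc m ≈ y ^ suc m + q * π ^ suc n * ((suc m times 1#) * y ^ m + q * π ^ suc n * e)) → x ^ suc m ≡ y ^ suc m [mod π ^ suc (suc n) ]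
          step (e , eq) = _,_ (q * (u * y ^ m + q * π ^ n * e)) (begin
            q * (u * y ^ m + q * π ^ n * e) * (π * (π * π ^ n))
              ≈⟨ solve 6 (λ q u z e π w → q ⊛ (u ⊛ z ⊕ q ⊛ w ⊛ e) ⊛ (π ⊛ (π ⊛ w)) :=
                     q ⊛ (π ⊛ w) ⊛ (u ⊛ π ⊛ z ⊕ q ⊛ (π ⊛ w) ⊛ e)) refl q u (y ^ m) e π (π ^ n) ⟩
            q * (π * π ^ n) * (u * π * y ^ m + q * (π * π ^ n) * e)
              ≈⟨ *-congˡ (+-congʳ (*-congʳ p≈uπ)) ⟨
            q * π ^ suc n * ((suc m times 1#) * y ^ m + q * π ^ suc n * e)
              ≈⟨ solve 2 (λ a b → a := (b ⊕ a) ⊝ b) refl _ (y ^ suc m) ⟩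
            (y ^ suc m + q * π ^ suc n * ((suc m times 1#) * y ^ m + q * π ^ suc n * e)) - y ^ suc m
              ≈⟨ +-congʳ eq ⟨
            (y + q * π ^ suc n) ^ suc m - y ^ suc m
              ≈⟨ +-congʳ (^-congˡ (suc m) (mod-witness d)) ⟨
            x ^ suc m - y ^ suc m ∎)

      mod-^p^ : ∀ n k {x y} → x ≡ y [mod π ^ suc n ] → x ^ (p ℕ.^ k) ≡ y ^ (p ℕ.^ k) [mod π ^ suc (k ℕ.+ n) ]
      mod-^p^ n zero    d = mod-respˡ (*-identityʳ _) (mod-respʳ d (sym (*-identityʳ _)))
      mod-^p^ n (suc k) {x} {y} d =
        mod-respˡ (^-congʳ x (ℕ.*-comm p (p ℕ.^ k))) (mod-respˡ (sym (^-assocʳ x (p ℕ.^ k) p))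
        (mod-respʳ (mod-^p (k ℕ.+ n) (mod-^p^ n k d)) (trans (^-assocʳ y (p ℕ.^ k) p) (^-congʳ y (ℕ.*-comm (p ℕ.^ k) p)))))

      private
        w : ℕ → (ℕ → Carrier) → Carrier
        w = ghost p π

      w-cong : ∀ n {a b} → (∀ i → i ≤ n → a i ≈ b i) → w n a ≈ w n b
      w-cong zero    a≈b = a≈b 0 z≤n
      w-cong (suc n) a≈b = +-cong (^-congˡ (p ℕ.^ suc n) (a≈b 0 z≤n))
        (*-congˡ (w-cong n (λ i i≤n → a≈b (suc i) (s≤s i≤n))))

      -- The i-th summand gains i factors of π from πⁱ and n - i from the exponent pⁿ⁻ⁱ, by
      -- `mod-^p^`; together this is n for every i.
      w-mod : ∀ k n {a b} → (∀ i → i ≤ n → a i ≡ b i [mod π ^ suc k ]) → w n a ≡ w n b [mod π ^ suc (n ℕ.+ k) ]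
      w-mod k zero    a≡b = a≡b 0 z≤n
      w-mod k (suc n) a≡b = mod-+-cong (mod-^p^ k (suc n) (a≡b 0 z≤n))
        (mod-scale π (w-mod k n (λ i i≤n → a≡b (suc i) (s≤s i≤n))))

      w-mod-π : ∀ n {a b} → (∀ i → i ≤ n → a i ≡ b i [mod π ]) → w n a ≡ w n b [mod π ^ suc n ]
      w-mod-π n a≡b = mod-divisor (^-congʳ π (≡.cong suc (ℕ.+-identityʳ n)))
        (w-mod 0 n (λ i i≤n → mod⇒mod¹ (a≡b i i≤n)))

      -- `ghost` recurses on the first coordinate. Isolating the last one shows that it enters
      -- linearly, and that modulo πⁿ⁺¹ only wₙ of the p-th powers remains of wₙ₊₁; the construction
      -- of the Qₙ rests on this.
      w-last : ∀ n a → w (suc n) a ≈ w n (λ i → a i ^ p) + π ^ suc n * a (suc n)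
      w-last zero    a = +-cong (^-congʳ (a 0) (ℕ.*-identityʳ p)) (*-congʳ (sym (*-identityʳ π)))
      w-last (suc n) a = begin
        a 0 ^ (p ℕ.* p ℕ.^ suc n) + π * w (suc n) (a ∘ suc)
          ≈⟨ +-cong (sym (^-assocʳ (a 0) p (p ℕ.^ suc n))) (*-congˡ (w-last n (a ∘ suc))) ⟩
        (a 0 ^ p) ^ (p ℕ.^ suc n) + π * (w n (λ i → a (suc i) ^ p) + π ^ suc n * a (suc (suc n)))
          ≈⟨ solve 5 (λ x π y z t → x ⊕ π ⊛ (y ⊕ z ⊛ t) := (x ⊕ π ⊛ y) ⊕ (π ⊛ z) ⊛ t) refl _ π _ (π ^ suc n) _ ⟩
        ((a 0 ^ p) ^ (p ℕ.^ suc n) + π * w n (λ i → a (suc i) ^ p)) + π ^ suc (suc n) * a (suc (suc n)) ∎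
        where open SetoidReasoning setoid

      w-init : ∀ n a → w (suc n) a ≡ w n (λ i → a i ^ p) [mod π ^ suc n ]
      w-init n a = mod-trans (≈⇒mod (w-last n a)) (_,_ (a (suc n)) (begin
        a (suc n) * π ^ suc n                                     ≈⟨ solve 3 (λ x y z → x ⊛ y := (z ⊕ y ⊛ x) ⊝ z) refl (a (suc n)) (π ^ suc n) (w n (λ i → a i ^ p)) ⟩
        (w n (λ i → a i ^ p) + π ^ suc n * a (suc n)) - w n (λ i → a i ^ p) ∎))
        where open SetoidReasoning setoid

      regular-^ : IsRegular π → ∀ n → IsRegular (π ^ n)
      regular-^ reg zero    x e = trans (sym (*-identityˡ x)) e
      regular-^ reg (suc n) x e = regular-^ reg n x (reg _ (trans (sym (*-assoc _ _ _)) e))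

      -- The last coordinate is determined modulo π by the ghost component and the earlier coordinates.
      w-determines : IsRegular π → ∀ n {a b} → (∀ i → i < n → a i ≡ b i [mod π ]) →
                     w n a ≡ w n b [mod π ^ suc n ] → a n ≡ b n [mod π ]
      w-determines reg zero    a≡b e = mod¹⇒mod e
      w-determines reg (suc n) {a} {b} a≡b e = mod-unscale (regular-^ reg (suc n))
        (mod-divisor (*-comm π (π ^ suc n))
        -- The p-th powers of entries congruent mod π agree mod π², so the contributions of the
        -- earlier coordinates agree mod πⁿ⁺². What remains is πⁿ⁺¹ times the last coordinates,
        -- modulo πⁿ⁺¹ π.
        (+-cancelˡ-mod (mod-divisor (^-congʳ π (≡.cong suc (ℕ.+-comm n 1)))
                          (w-mod 1 n (λ i i≤n → mod-^p 0 (mod⇒mod¹ (a≡b i (s≤s i≤n))))))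
        (mod-respˡ (sym (w-last n a)) (mod-respʳ e (w-last n b)))))

module _ (R : CommutativeRing a ℓ) (S : CommutativeRing b ℓ′) (φ : R ⟶ S) where
  private module S = CommutativeRing S
  open RingHomomorphism φ

  hom-mod : ∀ {f x y} → Mod._≡_[mod_] R x y f → Mod._≡_[mod_] S ⟦ x ⟧ ⟦ y ⟧ ⟦ f ⟧
  hom-mod {f} {x} {y} d = RingTheory.divides S ⟦ RingTheory.quotient R d ⟧
    (S.trans (S.sym (*-homo _ f)) (S.trans (⟦⟧-cong (RingTheory.quotient-eq R d)) (S.trans (+-homo x _) (S.+-congˡ (-‿homo y)))))

  hom-ghost : ∀ p π n a → ⟦ RingTheory.ghost R p π n a ⟧ S.≈ RingTheory.ghost S p ⟦ π ⟧ n (⟦_⟧ ∘ a)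
  hom-ghost p π zero    a = S.refl
  hom-ghost p π (suc n) a = S.trans (+-homo _ _) (S.+-cong (hom-^ R S φ (a 0) (p ℕ.^ suc n))
    (S.trans (*-homo _ _) (S.*-congˡ (hom-ghost p π n (a ∘ suc)))))

-- Regular elements of polynomial rings

module DecidablePermutation {G : Set} (_≟_ : DecidableEquality G) where
  open DecMembership _≟_ using (_∈?_)

  infix 4 _↭?_
  _↭?_ : (xs ys : List G) → Dec (xs ↭ ys)
  []       ↭? []       = yes ↭-refl
  []       ↭? (y ∷ ys) = no λ e → contradiction (↭-empty-inv (↭-sym e)) λ ()
  (x ∷ xs) ↭? ys with x ∈? ys
  ... | no x∉ys = no λ e → x∉ys (∈-resp-↭ e (here ≡.refl))
  ... | yes x∈ys with as , bs , ≡.refl ← ∈-∃++ x∈ys with xs ↭? (as ++ bs)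
  ...   | yes e = yes (↭-trans (prep x e) (↭-sym (shift x as bs)))
  ...   | no ¬e = no λ e → ¬e (drop-∷ (↭-trans e (shift x as bs)))

-- A polynomial acts on the functions List G → A invariant under permutations,
-- the variable g shifting the argument by g; evaluating at [] gives the A-linear
-- extension of such a function from monomials to polynomials, and thereby coefficients.
module PolynomialCoefficients (A : CommutativeRing 0ℓ 0ℓ) {G : Set} (_≟_ : DecidableEquality G) where
  open CommutativeRing A
  open Algebra.Properties.Ring ring using (-‿distribʳ-*; -‿+-comm; -0#≈0#)
  open Algebra.Properties.CommutativeSemigroup using (interchange; x∙yz≈y∙xz)
  open DecidablePermutation _≟_
  private
    module P = Algebra (Polynomial A G)
    T = Term Carrier G

  act : T → (List G → Carrier) → List G → Carrier
  act (con c)  f l = c * f l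
  act (gen g)  f l = f (g ∷ l)
  act (t :+ u) f l = act t f l + act u f l
  act (t :* u) f l = act t (act u f) l
  act (:- t)   f l = - act t f l

  Invariant : (List G → Carrier) → Set
  Invariant f = ∀ {l m} → l ↭ m → f l ≈ f m

  act-invariant : ∀ t {f} → Invariant f → Invariant (act t f)
  act-invariant (con c)  inv e = *-congˡ (inv e)
  act-invariant (gen g)  inv e = inv (prep g e)
  act-invariant (t :+ u) inv e = +-cong (act-invariant t inv e) (act-invariant u inv e)
  act-invariant (t :* u) inv e = act-invariant t (act-invariant u inv) e
  act-invariant (:- t)   inv e = -‿cong (act-invariant t inv e)

  act-cong : ∀ t {f h} → (∀ l → f l ≈ h l) → ∀ l → act t f l ≈ act t h l
  act-cong (con c)  f≈h l = *-congˡ (f≈h l)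
  act-cong (gen g)  f≈h l = f≈h (g ∷ l)
  act-cong (t :+ u) f≈h l = +-cong (act-cong t f≈h l) (act-cong u f≈h l)
  act-cong (t :* u) f≈h l = act-cong t (act-cong u f≈h) l
  act-cong (:- t)   f≈h l = -‿cong (act-cong t f≈h l)

  act-+ : ∀ t f h l → act t (λ m → f m + h m) l ≈ act t f l + act t h l
  act-+ (con c)  f h l = distribˡ c _ _
  act-+ (gen g)  f h l = refl
  act-+ (t :+ u) f h l = trans (+-cong (act-+ t f h l) (act-+ u f h l)) (interchange +-commutativeSemigroup _ _ _ _)
  act-+ (t :* u) f h l = trans (act-cong t (act-+ u f h) l) (act-+ t _ _ l)
  act-+ (:- t)   f h l = trans (-‿cong (act-+ t f h l)) (sym (-‿+-comm _ _))

  act-scale : ∀ t c f l → act t (λ m → c * f m) l ≈ c * act t f l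
  act-scale (con d)  c f l = x∙yz≈y∙xz *-commutativeSemigroup d c _
  act-scale (gen g)  c f l = refl
  act-scale (t :+ u) c f l = trans (+-cong (act-scale t c f l) (act-scale u c f l)) (sym (distribˡ c _ _))
  act-scale (t :* u) c f l = trans (act-cong t (act-scale u c f) l) (act-scale t c _ l)
  act-scale (:- t)   c f l = trans (-‿cong (act-scale t c f l)) (-‿distribʳ-* c _)

  act-neg : ∀ t f l → act t (λ m → - f m) l ≈ - act t f l
  act-neg (con c)  f l = sym (-‿distribʳ-* c _)
  act-neg (gen g)  f l = refl
  act-neg (t :+ u) f l = trans (+-cong (act-neg t f l) (act-neg u f l)) (-‿+-comm _ _)
  act-neg (t :* u) f l = trans (act-cong t (act-neg u f) l) (act-neg t _ l)
  act-neg (:- t)   f l = -‿cong (act-neg t f l)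

  -- For a variable `h` the two sides differ only in the order of `g` and `h`, which is where
  -- invariance enters.
  act-shift : ∀ t {f} → Invariant f → ∀ g l → act t (λ m → f (g ∷ m)) l ≈ act t f (g ∷ l)
  act-shift (con c)  inv g l = refl
  act-shift (gen h)  inv g l = inv (swap g h ↭-refl)
  act-shift (t :+ u) inv g l = +-cong (act-shift t inv g l) (act-shift u inv g l)
  act-shift (t :* u) inv g l = trans (act-cong t (act-shift u inv g) l) (act-shift t (act-invariant u inv) g l)
  act-shift (:- t)   inv g l = -‿cong (act-shift t inv g l)

  -- Commutativity is the one ring law that the action violates on functions that are not invariant;
  -- this is why `act-resp` is restricted to invariant ones.
  act-comm : ∀ t u {f} → Invariant f → ∀ l → act t (act u f) l ≈ act u (act t f) l
  act-comm (con c)    u inv l = sym (act-scale u c _ l)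
  act-comm (gen g)    u inv l = sym (act-shift u inv g l)
  act-comm (t₁ :+ t₂) u inv l = trans (+-cong (act-comm t₁ u inv l) (act-comm t₂ u inv l)) (sym (act-+ u _ _ l))
  act-comm (t₁ :* t₂) u inv l = trans (act-cong t₁ (act-comm t₂ u inv) l) (act-comm t₁ u (act-invariant t₂ inv) l)
  act-comm (:- t)     u inv l = trans (-‿cong (act-comm t u inv l)) (sym (act-neg u _ l))

  act-resp : ∀ {t u} → t P.≈ u → ∀ {f} → Invariant f → ∀ l → act t f l ≈ act u f l
  act-resp Equal.refl              inv l = refl
  act-resp (Equal.sym d)           inv l = sym (act-resp d inv l)
  act-resp (Equal.trans d e)       inv l = trans (act-resp d inv l) (act-resp e inv l)
  act-resp (Equal.+-cong d e)      inv l = +-cong (act-resp d inv l) (act-resp e inv l)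
  act-resp (Equal.*-cong {t} {t′} {u} {u′} d e) inv l =
    trans (act-resp d (act-invariant u inv) l) (act-cong t′ (act-resp e inv) l)
  act-resp (Equal.-‿cong d)        inv l = -‿cong (act-resp d inv l)
  act-resp (Equal.+-assoc t u v)   inv l = +-assoc _ _ _
  act-resp (Equal.+-comm t u)      inv l = +-comm _ _
  act-resp (Equal.+-identityˡ t)   inv l = trans (+-congʳ (zeroˡ _)) (+-identityˡ _)
  act-resp (Equal.-‿inverseˡ t)    inv l = trans (-‿inverseˡ _) (sym (zeroˡ _))
  act-resp (Equal.*-assoc t u v)   inv l = refl
  act-resp (Equal.*-comm t u)      inv l = act-comm t u inv l
  act-resp (Equal.*-identityˡ t)   inv l = *-identityˡ _
  act-resp (Equal.distribˡ t u v)  inv l = act-+ t _ _ l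
  act-resp (Equal.con-cong x≈y)    inv l = *-congʳ x≈y
  act-resp (Equal.con-+ x y)       inv l = distribʳ _ x y
  act-resp (Equal.con-* x y)       inv l = *-assoc x y _

  monomial : List G → T
  monomial []      = con 1#
  monomial (g ∷ l) = gen g :* monomial l

  Monomials : Set
  Monomials = List (Carrier × List G)

  ∑ : Monomials → T
  ∑ []             = con 0#
  ∑ ((c , l) ∷ xs) = con c :* monomial l :+ ∑ xs

  monomial-++ : ∀ l m → monomial (l ++ m) P.≈ monomial l :* monomial m
  monomial-++ []      m = P.sym (P.*-identityˡ _)
  monomial-++ (g ∷ l) m = P.trans (P.*-congˡ (monomial-++ l m)) (P.sym (P.*-assoc _ _ _))

  monomial-↭ : ∀ {l m} → l ↭ m → monomial l P.≈ monomial m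
  monomial-↭ ↭.refl         = P.refl
  monomial-↭ (prep g e)     = P.*-congˡ (monomial-↭ e)
  monomial-↭ (swap g h e)   = P.trans (P.*-congˡ (P.*-congˡ (monomial-↭ e))) (x∙yz≈y∙xz P.*-commutativeSemigroup _ _ _)
  monomial-↭ (↭.trans d e)  = P.trans (monomial-↭ d) (monomial-↭ e)

  ∑-++ : ∀ xs ys → ∑ (xs ++ ys) P.≈ ∑ xs :+ ∑ ys
  ∑-++ []       ys = P.sym (P.+-identityˡ _)
  ∑-++ (x ∷ xs) ys = P.trans (P.+-congˡ (∑-++ xs ys)) (P.sym (P.+-assoc _ _ _))

  scale : Carrier × List G → Monomials → Monomials
  scale (c , l) []             = []
  scale (c , l) ((d , m) ∷ ys) = (c * d , l ++ m) ∷ scale (c , l) ys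

  ∑-scale : ∀ c l ys → ∑ (scale (c , l) ys) P.≈ (con c :* monomial l) :* ∑ ys
  ∑-scale c l []             = P.sym (P.zeroʳ _)
  ∑-scale c l ((d , m) ∷ ys) = P.trans
    (P.+-cong (P.trans (P.*-cong (Equal.con-* c d) (monomial-++ l m)) (interchange P.*-commutativeSemigroup _ _ _ _))
              (∑-scale c l ys))
    (P.sym (P.distribˡ _ _ _))

  product : Monomials → Monomials → Monomials
  product []       ys = []
  product (x ∷ xs) ys = scale x ys ++ product xs ys

  ∑-product : ∀ xs ys → ∑ (product xs ys) P.≈ ∑ xs :* ∑ ys
  ∑-product []             ys = P.sym (P.zeroˡ _)
  ∑-product ((c , l) ∷ xs) ys = P.trans (∑-++ (scale (c , l) ys) (product xs ys))
    (P.trans (P.+-cong (∑-scale c l ys) (∑-product xs ys)) (P.sym (P.distribʳ _ _ _)))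

  expand : T → Monomials
  expand (con c)  = (c , []) ∷ []
  expand (gen g)  = (1# , g ∷ []) ∷ []
  expand (t :+ u) = expand t ++ expand u
  expand (t :* u) = product (expand t) (expand u)
  expand (:- t)   = scale (- 1# , []) (expand t)

  ∑-expand : ∀ t → ∑ (expand t) P.≈ t
  ∑-expand (con c)  = P.trans (P.+-identityʳ _) (P.*-identityʳ _)
  ∑-expand (gen g)  = P.trans (P.+-identityʳ _) (P.trans (P.*-identityˡ _) (P.*-identityʳ _))
  ∑-expand (t :+ u) = P.trans (∑-++ (expand t) (expand u)) (P.+-cong (∑-expand t) (∑-expand u))
  ∑-expand (t :* u) = P.trans (∑-product (expand t) (expand u)) (P.*-cong (∑-expand t) (∑-expand u))
  ∑-expand (:- t)   = P.trans (∑-scale (- 1#) [] (expand t))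
    (P.trans (P.*-cong (P.trans (P.*-identityʳ _) (AlgebraHom.-‿homo 1#)) (∑-expand t)) (-1*x≈-x t))
    where
    open Algebra.Properties.Ring P.ring using (-1*x≈-x)
    module AlgebraHom = RingHomomorphism (Algebra.ι (Polynomial A G))

  linear : (List G → Carrier) → Monomials → Carrier
  linear f []             = 0#
  linear f ((c , l) ∷ xs) = c * f l + linear f xs

  act-monomial : ∀ l {f} → Invariant f → ∀ m → act (monomial l) f m ≈ f (l ++ m)
  act-monomial []      inv m = *-identityˡ _
  act-monomial (g ∷ l) inv m = trans (act-monomial l inv (g ∷ m)) (inv (shift g l m))

  act-∑ : ∀ xs {f} → Invariant f → act (∑ xs) f [] ≈ linear f xs
  act-∑ []             inv = zeroˡ _
  act-∑ ((c , l) ∷ xs) inv = +-cong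
    (*-congˡ (trans (act-monomial l inv []) (inv (↭.↭-reflexive (++-identityʳ l)))))
    (act-∑ xs inv)

  -- Extended linearly, this is the functional that reads off the coefficient of the monomial `m`.
  δ : List G → List G → Carrier
  δ m l = if does (m ↭? l) then 1# else 0#

  δ-yes : ∀ {m l} → m ↭ l → δ m l ≈ 1#
  δ-yes {m} {l} e with m ↭? l
  ... | yes _ = refl
  ... | no ¬e = contradiction e ¬e

  δ-no : ∀ {m l} → ¬ (m ↭ l) → δ m l ≈ 0#
  δ-no {m} {l} ¬e with m ↭? l
  ... | yes e = contradiction e ¬e
  ... | no _  = refl

  δ-invariant : ∀ m → Invariant (δ m)
  δ-invariant m {l} {l′} e with m ↭? l
  ... | yes d = sym (δ-yes (↭-trans d e))
  ... | no ¬d = sym (δ-no (λ d → ¬d (↭-trans d (↭-sym e))))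

  -- All terms of `xs` whose monomial is `l` up to order are gathered into one, so that the
  -- functional `δ l` no longer sees anything in `rest`.
  record Collected (l : List G) (xs : Monomials) : Set where
    field
      coefficient : Carrier
      rest        : Monomials
      ∑-split     : ∑ xs P.≈ con coefficient :* monomial l :+ ∑ rest
      δ-split     : ∀ m → linear (δ m) xs ≈ coefficient * δ m l + linear (δ m) rest
      δ-rest      : linear (δ l) rest ≈ 0#
      shorter     : length rest ≤ length xs

  collect : ∀ l xs → Collected l xs
  collect l [] = record
    { coefficient = 0#
    ; rest        = []
    ; ∑-split     = P.sym (P.trans (P.+-congʳ (P.zeroˡ _)) (P.+-identityʳ _))
    ; δ-split     = λ m → sym (trans (+-congʳ (zeroˡ _)) (+-identityʳ _))
    ; δ-rest      = refl
    ; shorter     = z≤n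
    }
  collect l ((d , k) ∷ xs) with collect l xs | l ↭? k
  ... | c | yes e = record
    { coefficient = d + coefficient
    ; rest        = rest
    ; ∑-split     = P.trans (P.+-cong (P.*-congˡ (P.sym (monomial-↭ e))) ∑-split)
        (P.trans (P.sym (P.+-assoc _ _ _)) (P.+-congʳ (P.trans (P.sym (P.distribʳ _ _ _)) (P.*-congʳ (P.sym (Equal.con-+ d _))))))
    ; δ-split     = λ m → trans (+-cong (*-congˡ (sym (δ-invariant m e))) (δ-split m))
        (trans (sym (+-assoc _ _ _)) (+-congʳ (sym (distribʳ _ _ _))))
    ; δ-rest      = δ-rest
    ; shorter     = ℕ.m≤n⇒m≤1+n shorter
    }
    where open Collected c
  ... | c | no ¬e = record
    { coefficient = coefficient
    ; rest        = (d , k) ∷ rest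
    ; ∑-split     = P.trans (P.+-congˡ ∑-split) (x∙yz≈y∙xz P.+-commutativeSemigroup _ _ _)
    ; δ-split     = λ m → trans (+-congˡ (δ-split m)) (x∙yz≈y∙xz +-commutativeSemigroup _ _ _)
    ; δ-rest      = trans (+-cong (trans (*-congˡ (δ-no ¬e)) (zeroʳ d)) δ-rest) (+-identityˡ _)
    ; shorter     = s≤s shorter
    }
    where open Collected c

  -- Once the terms belonging to the first monomial `l` are gathered, their total coefficient is the
  -- value of `δ l`, hence zero, and the functionals vanish on the rest as well. The rest is shorter
  -- but not a sublist in the structural sense, whence the bound `n`.
  ∑≈0 : ∀ n xs → length xs ≤ n → (∀ m → linear (δ m) xs ≈ 0#) → ∑ xs P.≈ con 0#
  ∑≈0 n       []             _         _ = P.refl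
  ∑≈0 (suc n) ((c , l) ∷ xs) (s≤s len) h = P.trans (P.+-congˡ ∑-split)
    (P.trans (P.sym (P.+-assoc _ _ _))
    (P.trans (P.+-cong
      (P.trans (P.sym (P.distribʳ _ _ _)) (P.trans (P.*-congʳ (P.trans (P.sym (Equal.con-+ c _)) (Equal.con-cong c+s≈0))) (P.zeroˡ _)))
      (∑≈0 n rest (ℕ.≤-trans shorter len) (λ m → trans (sym (all m)) (h m))))
    (P.+-identityˡ _)))
    where
    open Collected (collect l xs)
    regroup : ∀ m → c * δ m l + linear (δ m) xs ≈ (c + coefficient) * δ m l + linear (δ m) rest
    regroup m = trans (+-congˡ (δ-split m)) (trans (sym (+-assoc _ _ _)) (+-congʳ (sym (distribʳ _ _ _))))
    c+s≈0 : c + coefficient ≈ 0#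
    c+s≈0 = trans (sym (*-identityʳ _)) (trans (*-congˡ (sym (δ-yes {l} {l} ↭-refl)))
      (trans (sym (trans (+-congˡ δ-rest) (+-identityʳ _))) (trans (sym (regroup l)) (h l))))
    all : ∀ m → c * δ m l + linear (δ m) xs ≈ linear (δ m) rest
    all m = trans (regroup m) (trans (+-congʳ (trans (*-congʳ c+s≈0) (zeroˡ _))) (+-identityˡ _))

  -- Coefficientwise: `δ m` sends `con d :* t` to `d` times the coefficient of `m` in `t`, so every
  -- coefficient of `t` vanishes.
  con-regular : ∀ {d} → RingTheory.IsRegular A d → RingTheory.IsRegular P.commutativeRing (con d)
  con-regular {d} reg t dt≈0 = P.trans (P.sym (∑-expand t)) (∑≈0 _ (expand t) ℕ.≤-refl λ m →
    let inv = δ-invariant m in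
    trans (sym (act-∑ (expand t) inv)) (trans (act-resp (∑-expand t) inv [])
      (reg _ (trans (act-resp dt≈0 inv []) (zeroˡ _)))))

module RootPowers (p : ℕ) (A : CommutativeRing 0ℓ 0ℓ) (G : Set) where
  open Lazard p using (_[_^1/p^∞]; root; _:^_)
  private
    module P∞ = Algebra (A [ G ^1/p^∞])
    open import Algebra.Properties.Semiring.Exp P∞.semiring using (^-congˡ; ^-assocʳ)

    :^≈pow : ∀ t n → _:^_ A t n P∞.≈ pow P∞.commutativeRing t n
    :^≈pow t zero    = P∞.refl
    :^≈pow t (suc n) = P∞.*-congˡ (:^≈pow t n)

  root-^p : ∀ i n → pow P∞.commutativeRing (gen (i , suc n)) p P∞.≈ gen (i , n)
  root-^p i n = P∞.trans (P∞.sym (:^≈pow (gen (i , suc n)) p)) (Equal.relation (root i n))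

  root-pow : ∀ i n k → pow P∞.commutativeRing (gen (i , k ℕ.+ n)) (p ℕ.^ k) P∞.≈ gen (i , n)
  root-pow i n zero    = P∞.*-identityʳ _
  root-pow i n (suc k) = P∞.trans (P∞.sym (^-assocʳ (gen (i , suc k ℕ.+ n)) p (p ℕ.^ k)))
    (P∞.trans (^-congˡ (p ℕ.^ k) (root-^p i (k ℕ.+ n))) (root-pow i n k))

module RootCoefficients (p : ℕ) (A : CommutativeRing 0ℓ 0ℓ) {G : Set} (_≟_ : DecidableEquality G) where
  open Lazard p using (_[_^1/p^∞]; Roots; root; eval-:^)
  private
    module A = CommutativeRing A
    module P = Algebra (Polynomial A G)
    module P∞ = Algebra (A [ G ^1/p^∞])
  open RootPowers p A G using (root-pow)
  private
    open import Algebra.Properties.Semiring.Exp P.semiring using (^-congʳ; ^-assocʳ)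
    import Algebra.Properties.Semiring.Exp P∞.semiring as P∞^

    -- At level `N` the generator `i` of the polynomial ring stands for the pᴺ-th root of the
    -- variable `i`. The subtraction truncates, so the value is the right one only for roots of
    -- order `n ≤ N`.
    ρ : ℕ → G × ℕ → P.Carrier
    ρ N (i , n) = pow P.commutativeRing (gen i) (p ℕ.^ (N ℕ.∸ n))

    level : ℕ → P∞.Carrier → P.Carrier
    level N = eval (Polynomial A G) (ρ N)

    unlevel : ∀ N → AlgHom (Polynomial A G) (A [ G ^1/p^∞])
    unlevel N = induced A _ (A [ G ^1/p^∞]) (λ i → gen (i , N)) (λ { {t} {u} () })

    -- A derivation of an equality involves finitely many roots.
    Eventually : P∞.Carrier → P∞.Carrier → Set
    Eventually t u = Σ ℕ λ N₀ → ∀ N → N₀ ≤ N → level N t P.≈ level N u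

    both : ∀ {t t′ u u′ v v′} → (∀ N → level N t P.≈ level N t′ → level N u P.≈ level N u′ → level N v P.≈ level N v′) →
           Eventually t t′ → Eventually u u′ → Eventually v v′
    both f (M , d) (N , e) = M ℕ.⊔ N , λ K M⊔N≤K →
      f K (d K (ℕ.m⊔n≤o⇒m≤o M N M⊔N≤K)) (e K (ℕ.m⊔n≤o⇒n≤o M N M⊔N≤K))

    eventually : ∀ {t u} → t P∞.≈ u → Eventually t u
    eventually Equal.refl              = 0 , λ _ _ → P.refl
    eventually (Equal.sym d)           = let N , f = eventually d in N , λ M N≤M → P.sym (f M N≤M)
    eventually (Equal.trans {t} {u} {v} d e) = both {t} {u} {u} {v} {t} {v} (λ _ → P.trans) (eventually d) (eventually e)
    eventually (Equal.+-cong {t} {t′} {u} {u′} d e) =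
      both {t} {t′} {u} {u′} {t :+ u} {t′ :+ u′} (λ _ → P.+-cong) (eventually d) (eventually e)
    eventually (Equal.*-cong {t} {t′} {u} {u′} d e) =
      both {t} {t′} {u} {u′} {t :* u} {t′ :* u′} (λ _ → P.*-cong) (eventually d) (eventually e)
    eventually (Equal.-‿cong d)        = let N , f = eventually d in N , λ M N≤M → P.-‿cong (f M N≤M)
    eventually (Equal.+-assoc t u v)   = 0 , λ N _ → P.+-assoc (level N t) (level N u) (level N v)
    eventually (Equal.+-comm t u)      = 0 , λ N _ → P.+-comm (level N t) (level N u)
    eventually (Equal.+-identityˡ t)   = 0 , λ N _ → P.+-identityˡ (level N t)
    eventually (Equal.-‿inverseˡ t)    = 0 , λ N _ → P.-‿inverseˡ (level N t)
    eventually (Equal.*-assoc t u v)   = 0 , λ N _ → P.*-assoc (level N t) (level N u) (level N v)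
    eventually (Equal.*-comm t u)      = 0 , λ N _ → P.*-comm (level N t) (level N u)
    eventually (Equal.*-identityˡ t)   = 0 , λ N _ → P.*-identityˡ (level N t)
    eventually (Equal.distribˡ t u v)  = 0 , λ N _ → P.distribˡ (level N t) (level N u) (level N v)
    eventually (Equal.con-cong x≈y)    = 0 , λ N _ → Equal.con-cong x≈y
    eventually (Equal.con-+ x y)       = 0 , λ N _ → Equal.con-+ x y
    eventually (Equal.con-* x y)       = 0 , λ N _ → Equal.con-* x y
    -- Below level `suc n` truncation makes both exponents equal to one, and the relation fails.
    eventually (Equal.relation (root i n)) = suc n , λ N n<N →
      P.trans (eval-:^ A (Polynomial A G) (ρ N) (gen (i , suc n)) p)
      (P.trans (^-assocʳ (gen i) (p ℕ.^ (N ℕ.∸ suc n)) p)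
      (^-congʳ (gen i) (≡.trans (ℕ.*-comm (p ℕ.^ (N ℕ.∸ suc n)) p)
        (≡.cong (p ℕ.^_) (≡.sym (ℕ.+-∸-assoc 1 n<N))))))

  private
    bound : P∞.Carrier → ℕ
    bound (con x)       = 0
    bound (gen (i , n)) = n
    bound (t :+ u)      = bound t ℕ.⊔ bound u
    bound (t :* u)      = bound t ℕ.⊔ bound u
    bound (:- t)        = bound t

    unlevel-level : ∀ N t → bound t ≤ N → AlgHom.fun (unlevel N) (level N t) P∞.≈ t
    unlevel-level N (con x)       _   = P∞.refl
    unlevel-level N (gen (i , n)) n≤N = P∞.trans (hom-^ P.commutativeRing P∞.commutativeRing (AlgHom.hom (unlevel N)) (gen i) (p ℕ.^ (N ℕ.∸ n)))
      (P∞.trans (P∞^.^-congˡ (p ℕ.^ (N ℕ.∸ n)) (P∞.reflexive (≡.cong (λ k → gen (i , k)) (≡.sym (ℕ.m∸n+n≡m n≤N)))))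
      (root-pow i n (N ℕ.∸ n)))
    unlevel-level N (t :+ u) b = P∞.+-cong (unlevel-level N t (ℕ.m⊔n≤o⇒m≤o (bound t) (bound u) b))
                                           (unlevel-level N u (ℕ.m⊔n≤o⇒n≤o (bound t) (bound u) b))
    unlevel-level N (t :* u) b = P∞.*-cong (unlevel-level N t (ℕ.m⊔n≤o⇒m≤o (bound t) (bound u) b))
                                           (unlevel-level N u (ℕ.m⊔n≤o⇒n≤o (bound t) (bound u) b))
    unlevel-level N (:- t) b = P∞.-‿cong (unlevel-level N t b)

  -- At a level beyond both the roots in `t` and those in the derivation of d t = 0, the equation
  -- holds between ordinary polynomials, and `unlevel` recovers `t`.
  con-regular : ∀ {d} → RingTheory.IsRegular A d → RingTheory.IsRegular P∞.commutativeRing (con d)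
  con-regular {d} reg t dt≈0 = P∞.trans (P∞.sym (unlevel-level N t (ℕ.m≤n⊔m M (bound t))))
    (AlgHom.cong (unlevel N) {level N t} {con A.0#}
      (PolynomialCoefficients.con-regular A _≟_ reg (level N t) (f N (ℕ.m≤m⊔n M (bound t)))))
    where
    M = proj₁ (eventually dt≈0)
    f = proj₂ (eventually dt≈0)
    N = M ℕ.⊔ bound t

-- The ring ℒ and its residue ring

module _ (R : CommutativeRing a ℓ) (S : CommutativeRing b ℓ′) (φ : R ⟶ S) where
  private
    module R = CommutativeRing R
    module S = CommutativeRing S
  open RingHomomorphism φ
  open Algebra.Properties.Semiring.Mult R.semiring using () renaming (_×_ to _timesᴿ_)
  open Algebra.Properties.Semiring.Mult S.semiring using () renaming (_×_ to _timesˢ_)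

  hom-times : ∀ n x → ⟦ n timesᴿ x ⟧ S.≈ n timesˢ ⟦ x ⟧
  hom-times zero    x = 0#-homo
  hom-times (suc n) x = S.trans (+-homo x (n timesᴿ x)) (S.+-congˡ (hom-times n x))

  hom-times-1 : ∀ n → ⟦ n timesᴿ R.1# ⟧ S.≈ n timesˢ S.1#
  hom-times-1 zero    = 0#-homo
  hom-times-1 (suc n) = S.trans (+-homo R.1# (n timesᴿ R.1#)) (S.+-cong 1#-homo (hom-times-1 n))

module _ (S : CommutativeRing b ℓ′) (φ ψ : ℤ-ring ⟶ S) where
  private
    module S = CommutativeRing S
    module φ = RingHomomorphism φ
    module ψ = RingHomomorphism ψ

  private
    agree-+ : ∀ n → φ.⟦ + n ⟧ S.≈ ψ.⟦ + n ⟧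
    agree-+ zero    = S.trans φ.0#-homo (S.sym ψ.0#-homo)
    agree-+ (suc n) = S.trans (φ.+-homo (+ 1) (+ n)) (S.trans
      (S.+-cong (S.trans φ.1#-homo (S.sym ψ.1#-homo)) (agree-+ n)) (S.sym (ψ.+-homo (+ 1) (+ n))))

  ℤ-initial : ∀ z → φ.⟦ z ⟧ S.≈ ψ.⟦ z ⟧
  ℤ-initial (+ n)    = agree-+ n
  ℤ-initial -[1+ n ] = S.trans (φ.-‿homo (+ suc n)) (S.trans (S.-‿cong (agree-+ (suc n))) (S.sym (ψ.-‿homo (+ suc n))))

ℤ-times : ∀ n → Algebra.Properties.Semiring.Mult._×_ (CommutativeRing.semiring ℤ-ring) n (+ 1) ≡ + n
ℤ-times zero    = ≡.refl
ℤ-times (suc n) = ≡.cong (ℤ._+_ (+ 1)) (ℤ-times n)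

ℤ-regular : ∀ n → ℕ.NonZero n → RingTheory.IsRegular ℤ-ring (+ n)
ℤ-regular (suc n) _ x e = ℤ.*-cancelˡ-≡ (+ suc n) x (+ 0) (≡.trans e (≡.sym (ℤ.*-zeroʳ (+ suc n))))

-- Not definitional: the exponentiation is defined relative to the whole raw ring.
pow-/ : ∀ (R : CommutativeRing a ℓ) f x n → pow (R / f) x n ≡ pow R x n
pow-/ R f x zero    = ≡.refl
pow-/ R f x (suc n) = ≡.cong (CommutativeRing._*_ R x) (pow-/ R f x n)

module Frobenius {p : ℕ} (pp : Prime p) (R : CommutativeRing a ℓ) where
  open CommutativeRing R
  open Algebra.Properties.Semiring.Mult semiring using () renaming (_×_ to _times_)
  open import Algebra.Properties.Semiring.Exp semiring using (^-congˡ)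
  open import Algebra.Properties.CommutativeSemiring.Exp commutativeSemiring using (^-distrib-*)

  frobeniusHom : p times 1# ≈ 0# → R ⟶ R
  frobeniusHom p≈0 = mkHom R R (λ x → pow R x p) (^-congˡ p) (RingTheory.frobenius-+ R pp p≈0)
    (λ x y → ^-distrib-* x y p) (RingTheory.one-^ R p)

module PowerSeries (T : CommutativeRing 0ℓ 0ℓ) where
  private
    module T = CommutativeRing T
    S = T [[π]]
    module S = CommutativeRing S
  open Algebra.Properties.Semiring.Sum T.semiring using (sum; sum-cong-≋)

  X : S.Carrier
  X zero    = T.0#
  X (suc n) = S.1# n

  infixr 5 _◂_
  _◂_ : T.Carrier → S.Carrier → S.Carrier
  (c ◂ x) zero    = c
  (c ◂ x) (suc n) = x n

  const : T.Carrier → S.Carrier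
  const c = c ◂ λ _ → T.0#

  X*-zero : ∀ y → (X S.* y) 0 T.≈ T.0#
  X*-zero y = T.trans (T.+-identityʳ _) (T.zeroˡ _)

  X*-suc : ∀ y n → (X S.* y) (suc n) T.≈ y n
  X*-suc y n = T.trans (T.+-cong (T.zeroˡ _) (S.*-identityˡ y n)) (T.+-identityˡ _)

  X*≈◂ : ∀ y → X S.* y S.≈ T.0# ◂ y
  X*≈◂ y zero    = X*-zero y
  X*≈◂ y (suc n) = X*-suc y n

  head+tail : ∀ x → x S.≈ const (x 0) S.+ X S.* (x ∘ suc)
  head+tail x zero    = T.sym (T.trans (T.+-congˡ (X*-zero (x ∘ suc))) (T.+-identityʳ _))
  head+tail x (suc n) = T.sym (T.trans (T.+-congˡ (X*-suc (x ∘ suc) n)) (T.+-identityˡ _))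

  zero*≈0 : ∀ x y → (∀ n → x n T.≈ T.0#) → x S.* y S.≈ S.0#
  zero*≈0 x y x≈0 = S.trans (S.*-congʳ {y} {x} {S.0#} x≈0) (S.zeroˡ y)

  constHom : T ⟶ S
  constHom = mkHom T S const
    (λ { x≈y zero → x≈y ; x≈y (suc n) → T.refl })
    (λ { x y zero → T.refl ; x y (suc n) → T.sym (T.+-identityˡ _) })
    (λ { x y zero → T.sym (T.+-identityʳ _)
       ; x y (suc n) → T.sym (T.trans (T.+-cong (T.zeroʳ x) (zero*≈0 _ (const y) (λ _ → T.refl) n)) (T.+-identityˡ _)) })
    (λ { zero → T.refl ; (suc n) → T.refl })

  X-regular : RingTheory.IsRegular S X
  X-regular y e n = T.trans (T.sym (X*-suc y n)) (e (suc n))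

  *-truncate : ∀ {x x′} y n → (∀ i → i ≤ n → x i T.≈ x′ i) → (x S.* y) n T.≈ (x′ S.* y) n
  *-truncate {x} {x′} y n e = sum-cong-≋ {suc n} λ i → T.*-congʳ {y (n ∸ toℕ i)} (e (toℕ i) (ℕ.≤-pred (Fin.toℕ<n i)))

  X^*-vanishes : ∀ k y n → n < k → (y S.* pow S X k) n T.≈ T.0#
  X^*-vanishes (suc k) y n n<k = T.trans (S.trans (S.sym (S.*-assoc y X (pow S X k)))
      (S.trans (S.*-congʳ {pow S X k} {y S.* X} {X S.* y} (S.*-comm y X)) (S.*-assoc X y (pow S X k))) n) (go n n<k)
    where
    go : ∀ n → n < suc k → (X S.* (y S.* pow S X k)) n T.≈ T.0#
    go zero    _         = X*-zero (y S.* pow S X k)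
    go (suc n) (s≤s n<k) = T.trans (X*-suc (y S.* pow S X k) n) (X^*-vanishes k y n n<k)

  module _ (g : S.Carrier) (reg : RingTheory.IsRegular T (g 0)) where

    -- Coefficients are cancelled one after another, starting from the lowest, since the constant
    -- term of `g` is regular. The truncated form compares cofactors that are controlled only below
    -- some power of `X`.
    cancel-truncated : ∀ N {x y} → (∀ i → i < N → (x S.* g) i T.≈ (y S.* g) i) → ∀ i → i < N → x i T.≈ y i
    cancel-truncated (suc N) {x} {y} e = go
      where
      open RingTheory T
      head : x 0 T.≈ y 0
      head = regular-cancel reg (T.trans (T.*-comm _ _) (T.trans (T.sym (T.+-identityʳ _))
        (T.trans (e 0 (s≤s z≤n)) (T.trans (T.+-identityʳ _) (T.*-comm _ _)))))
      open Algebra.Properties.Ring T.ring using (+-cancelˡ)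
      go : ∀ i → i < suc N → x i T.≈ y i
      go zero    _         = head
      go (suc i) (s≤s i<N) = cancel-truncated N {x ∘ suc} {y ∘ suc}
        (λ j j<N → +-cancelˡ (x 0 T.* g (suc j)) _ _ (T.trans (e (suc j) (s≤s j<N)) (T.+-congʳ (T.*-congʳ (T.sym head))))) i i<N

    private
      Q = S / g
      module Q = CommutativeRing Q
    open Mod S
    open Solver S using (solve; _:=_) renaming (_:+_ to _⊕_; _:*_ to _⊛_; _:-_ to _⊝_; :-_ to ⊝_)

    -- If X y = q g, then the constant terms give q₀ g₀ = 0, so q₀ = 0 and q = X q′; cancelling X
    -- leaves y = q′ g.
    quotient-X-regular : RingTheory.IsRegular Q X
    quotient-X-regular y (q , qg≈Xy-0) = q ∘ suc , S.trans (RingTheory.regular-cancel S {X} X-regular {(q ∘ suc) S.* g} {y} (S.trans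
        (S.trans (S.sym (S.*-assoc X (q ∘ suc) g)) (S.*-congʳ {g} {X S.* (q ∘ suc)} {q} (S.sym {q} {X S.* (q ∘ suc)} q≈Xq′)))
        (S.trans qg≈Xy-0 (x-0 (X S.* y))))) (S.sym (x-0 y))
      where
      x-0 : ∀ x → x S.- S.0# S.≈ x
      x-0 x = S.trans (S.+-congˡ {x} (Algebra.Properties.Ring.-0#≈0# S.ring)) (S.+-identityʳ x)
      q₀≈0 : q 0 T.≈ T.0#
      q₀≈0 = reg (q 0) (T.trans (T.*-comm _ _) (T.trans (T.sym (T.+-identityʳ _))
        (T.trans (qg≈Xy-0 0) (T.trans (x-0 (X S.* y) 0) (X*-zero y)))))
      q≈Xq′ : q S.≈ X S.* (q ∘ suc)
      q≈Xq′ zero    = T.trans q₀≈0 (T.sym (X*-zero (q ∘ suc)))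
      q≈Xq′ (suc n) = T.sym (X*-suc (q ∘ suc) n)

    -- This says that the ideal (g) is X-adically closed. For each n there is a cofactor rₙ such
    -- that rₙ g agrees with -(x - y) below order n. By cancellation the rₙ stabilise coefficient by
    -- coefficient, and their diagonal `r` satisfies r g = -(x - y).
    quotient-separated : ∀ {x y} → (∀ n → Mod._≡_[mod_] Q x y (pow Q X n)) → x Q.≈ y
    quotient-separated {x} {y} d = S.- r , λ i → T.trans (S.sym (-‿distribˡ-* r g) i)
        (T.trans (T.-‿cong (limit i)) (-‿involutive _))
      where
      open Algebra.Properties.Ring S.ring using (-‿distribˡ-*)
      open Algebra.Properties.Ring T.ring using (-‿involutive)
      rₙ : ℕ → S.Carrier
      rₙ n with _ , (r , _) ← d n = r
      rₙ-eq : ∀ n i → i < n → (rₙ n S.* g) i T.≈ T.- ((x S.- y) i)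
      rₙ-eq n i i<n with s , (r , e) ← d n = T.trans (e i) (T.trans
        (T.+-congʳ (T.trans (S.*-congˡ {s} {pow Q X n} {pow S X n} (S.reflexive (pow-/ S g X n)) i) (X^*-vanishes n s i i<n))) (T.+-identityˡ _))
      r : S.Carrier
      r i = rₙ (suc i) i
      agree : ∀ i j → j ≤ i → r j T.≈ rₙ (suc i) j
      agree i j j≤i = cancel-truncated (suc j) {rₙ (suc j)} {rₙ (suc i)}
        (λ k k≤j → T.trans (rₙ-eq (suc j) k k≤j) (T.sym (rₙ-eq (suc i) k (ℕ.≤-trans k≤j (s≤s j≤i))))) j ℕ.≤-refl
      limit : ∀ i → (r S.* g) i T.≈ T.- ((x S.- y) i)
      limit i = T.trans (*-truncate {r} {rₙ (suc i)} g i (agree i)) (rₙ-eq (suc i) i ℕ.≤-refl)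

    -- The limit is the telescoping series at 0 + ∑ qₙ Xⁿ, where qₙ Xⁿ is the n-th increment modulo
    -- g. The series is summed among the power series over T, before passing to the quotient.
    quotient-limit : (x : Completed Q X) → Σ Q.Carrier λ y → ∀ n → Mod._≡_[mod_] Q y (Completed.at x n) (pow Q X n)
    quotient-limit x = (at 0 S.+ tail 0) , λ n → Mod._,_ {R = Q} (tail n) (Q.sym (Q.trans (Q.+-congʳ {Q.- at n} (partial n))
        (Q.trans (cancel (at n) (pow Q X n Q.* tail n)) (Q.*-comm (pow Q X n) (tail n)))))
      where
      open Completed x
      q : ℕ → S.Carrier
      q n with q , _ ← compatible n = q
      q-eq : ∀ n → q n Q.* pow Q X n Q.≈ at (suc n) Q.- at n
      q-eq n with q , e ← compatible n = e
      -- `tail n` is the sum of q k times X^(k - n) over all k ≥ n.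
      tail : ℕ → S.Carrier
      tail n zero    = q n 0
      tail n (suc i) = q n (suc i) T.+ tail (suc n) i
      tail-eq : ∀ n → tail n S.≈ q n S.+ X S.* tail (suc n)
      tail-eq n zero    = T.sym (T.trans (T.+-congˡ (X*-zero (tail (suc n)))) (T.+-identityʳ _))
      tail-eq n (suc i) = T.+-congˡ (T.sym (X*-suc (tail (suc n)) i))
      cancel : ∀ u v → (u Q.+ v) Q.- u Q.≈ v
      cancel u v = ≈⇒mod (solve 2 (λ u v → (u ⊕ v) ⊝ u := v) S.refl u v)
      partial : ∀ n → at 0 Q.+ tail 0 Q.≈ at n Q.+ pow Q X n Q.* tail n
      partial zero    = Q.+-congˡ {at 0} (Q.sym (Q.*-identityˡ (tail 0)))
      partial (suc n) = begin
        at 0 Q.+ tail 0                                                 ≈⟨ partial n ⟩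
        at n Q.+ pow Q X n Q.* tail n                                   ≈⟨ Q.+-congˡ {at n} (Q.*-congˡ {pow Q X n} (≈⇒mod (tail-eq n))) ⟩
        at n Q.+ pow Q X n Q.* (q n Q.+ X Q.* tail (suc n))             ≈⟨ ≈⇒mod (solve 5 (λ u w q x t → u ⊕ w ⊛ (q ⊕ x ⊛ t) := (u ⊕ q ⊛ w) ⊕ (x ⊛ w) ⊛ t) S.refl (at n) (pow Q X n) (q n) X (tail (suc n))) ⟩
        (at n Q.+ q n Q.* pow Q X n) Q.+ pow Q X (suc n) Q.* tail (suc n) ≈⟨ Q.+-congʳ {pow Q X (suc n) Q.* tail (suc n)} (Q.+-congˡ {at n} (q-eq n)) ⟩
        (at n Q.+ (at (suc n) Q.- at n)) Q.+ pow Q X (suc n) Q.* tail (suc n) ≈⟨ ≈⇒mod (solve 3 (λ u v t → (u ⊕ (v ⊝ u)) ⊕ t := v ⊕ t) S.refl (at n) (at (suc n)) (pow Q X (suc n) S.* tail (suc n))) ⟩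
        at (suc n) Q.+ pow Q X (suc n) Q.* tail (suc n)                 ∎
        where open SetoidReasoning Q.setoid

    module _ {c : T.Carrier} {u : S.Carrier} (const-c : const c Q.≈ u Q.* X) where
      private module constHom = RingHomomorphism constHom

      -- The constant `c` is u X in the quotient, so modulo X a power series matters only through
      -- its constant term modulo `c`. For ℒ this identifies ℒ / π with ℤ[ω] / p.
      mod-X : ∀ {x y} → Mod._≡_[mod_] T (x 0) (y 0) c → Mod._≡_[mod_] Q x y X
      mod-X {x} {y} (q , qc≈) = Mod._,_ {R = Q} (const q S.* u S.+ (x ∘ suc S.- y ∘ suc)) (begin
        (const q Q.* u Q.+ (x ∘ suc Q.- y ∘ suc)) Q.* X
          ≈⟨ ≈⇒mod (solve 5 (λ q u v w x → (q ⊛ u ⊕ (v ⊝ w)) ⊛ x := q ⊛ (u ⊛ x) ⊕ (x ⊛ v ⊝ x ⊛ w)) S.refl (const q) u (x ∘ suc) (y ∘ suc) X) ⟩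
        const q Q.* (u Q.* X) Q.+ (X Q.* (x ∘ suc) Q.- X Q.* (y ∘ suc))
          ≈⟨ Q.+-congʳ {X Q.* (x ∘ suc) Q.- X Q.* (y ∘ suc)} (Q.*-congˡ {const q} const-c) ⟨
        const q Q.* const c Q.+ (X Q.* (x ∘ suc) Q.- X Q.* (y ∘ suc))
          ≈⟨ ≈⇒mod (S.+-congʳ {X S.* (x ∘ suc) S.- X S.* (y ∘ suc)} heads) ⟩
        (const (x 0) Q.- const (y 0)) Q.+ (X Q.* (x ∘ suc) Q.- X Q.* (y ∘ suc))
          ≈⟨ ≈⇒mod (solve 4 (λ a b v w → (a ⊝ b) ⊕ (v ⊝ w) := (a ⊕ v) ⊝ (b ⊕ w)) S.refl (const (x 0)) (const (y 0)) (X S.* (x ∘ suc)) (X S.* (y ∘ suc))) ⟩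
        (const (x 0) Q.+ X Q.* (x ∘ suc)) Q.- (const (y 0) Q.+ X Q.* (y ∘ suc))
          ≈⟨ ≈⇒mod (S.+-cong (head+tail x) (S.-‿cong (head+tail y))) ⟨
        x Q.- y ∎)
        where
        open SetoidReasoning Q.setoid
        heads : const q S.* const c S.≈ const (x 0) S.- const (y 0)
        heads = S.trans (S.sym (constHom.*-homo q c)) (S.trans (constHom.⟦⟧-cong qc≈)
          (S.trans (constHom.+-homo (x 0) (T.- y 0)) (S.+-congˡ {const (x 0)} (constHom.-‿homo (y 0)))))

module LazardBase {p : ℕ} (pp : Prime p) where
  open Lazard p
  private
    module ℒ = CommutativeRing ℒ
    module ℒ₀ = CommutativeRing ℒ₀
    module T = CommutativeRing ℤ[ω]
    module 𝔽[ω] = CommutativeRing 𝔽[ω]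
    S = ℤ[ω] [[π]]
    module S = CommutativeRing S
    T/p = ℤ[ω] / con (+ p)
    module T/p = CommutativeRing T/p
    open Algebra.Properties.Semiring.Mult T.semiring using () renaming (_×_ to _timesᵀ_)
    open Algebra.Properties.Semiring.Mult ℒ.semiring using () renaming (_×_ to _times_)
    open Algebra.Properties.Semiring.Mult ℒ₀.semiring using () renaming (_×_ to _times₀_)
    open Algebra.Properties.Semiring.Mult T/p.semiring using () renaming (_×_ to _timesᵀᵖ_)
    module ω = RingHomomorphism (Algebra.ι (ℤ-ring [ ℕ ^1/p^∞]))

    con-p : ∀ {a ℓ} (R : CommutativeRing a ℓ) (φ : ℤ-ring ⟶ R) →
            CommutativeRing._≈_ R (Algebra.Properties.Semiring.Mult._×_ (CommutativeRing.semiring R) p (CommutativeRing.1# R))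
                                  (RingHomomorphism.⟦_⟧ φ (+ p))
    con-p R φ = R.trans (R.sym (hom-times-1 ℤ-ring R φ p)) (R.reflexive (≡.cong (RingHomomorphism.⟦_⟧ φ) (ℤ-times p)))
      where module R = CommutativeRing R

  regular-p : RingTheory.IsRegular ℤ[ω] (con (+ p))
  regular-p = RootCoefficients.con-regular p ℤ-ring ℕ._≟_ (ℤ-regular p (prime⇒nonZero pp))

  ℒ₀-char-p : p times₀ ℒ₀.1# ℒ₀.≈ ℒ₀.0#
  ℒ₀-char-p = ℒ₀.trans (con-p ℒ₀ (compose ℒ₀ (Algebra.ι (𝔽[ω] ^pf)) ℤ→𝔽[ω])) (Equal.con-cong (Equal.con-cong p≈0))

  rootHom : ℕ → 𝔽[ω] ⟶ ℒ₀
  rootHom n = mkHom 𝔽[ω] ℒ₀ (λ x → gen (n , x)) (λ e → Equal.relation (root-cong n e))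
    (λ x y → Equal.relation (root-+ n x y)) (λ x y → Equal.relation (root-* n x y)) (Equal.relation (root-1 n))

  private
    root-frobenius : ∀ n x → pow ℒ₀ (gen (suc n , x)) p ℒ₀.≈ gen (n , x)
    root-frobenius n x = ℒ₀.trans (root-pow 𝔽[ω] (suc n) x p) (Equal.relation (frobenius n x))

    frobenius₀ : ℒ₀ ⟶ ℒ₀
    frobenius₀ = Frobenius.frobeniusHom pp ℒ₀ ℒ₀-char-p

    -- Root extraction becomes a homomorphism by raising the index `n` of every `gen (n , x)` by
    -- one; a constant is treated as a generator of index 0.
    √-algHom : AlgHom (𝔽[ω] ^pf) (record { commutativeRing = ℒ₀ ; ι = rootHom 1 })
    √-algHom = induced 𝔽[ω] (Frobenius 𝔽[ω]) (record { commutativeRing = ℒ₀ ; ι = rootHom 1 })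
      (λ { (n , x) → gen (suc n , x) })
      λ { (root-cong n e) → Equal.relation (root-cong (suc n) e)
        ; (root-+ n x y)  → Equal.relation (root-+ (suc n) x y)
        ; (root-* n x y)  → Equal.relation (root-* (suc n) x y)
        ; (root-1 n)      → ℒ₀.trans (Equal.relation (root-1 (suc n))) (ℒ₀.sym (Equal.relation (root-1 1)))
        ; (root-base x)   → ℒ₀.refl
        ; (frobenius n x) → Equal.relation (frobenius (suc n) x)
        }
    module √-map = AlgHom √-algHom

  √ : ℒ₀ ⟶ ℒ₀
  √ = √-map.hom

  √-^p : ∀ x → pow ℒ₀ (√-map.fun x) p ℒ₀.≈ x
  √-^p = hom-ext 𝔽[ω] (Frobenius 𝔽[ω]) (𝔽[ω] ^pf)
    (record { hom = compose ℒ₀ frobenius₀ √ ; commutes = λ x →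
      ℒ₀.trans (root-frobenius 0 x) (Equal.relation (root-base x)) })
    (Category.idᶜ (Alg 𝔽[ω] 0ℓ)) λ { (n , x) → root-frobenius n x }

  private
    𝔽→T/p : 𝔽 ⟶ T/p
    𝔽→T/p = quotientLift ℤ-ring T/p (compose T/p (quotientMap ℤ[ω] (con (+ p))) (Algebra.ι (ℤ-ring [ ℕ ^1/p^∞])))
      (_,_ T.1# (T.trans (T.*-identityˡ (con (+ p))) (T.sym (T.trans (T.+-congˡ { con (+ p) } (Algebra.Properties.Ring.-0#≈0# T.ring)) (T.+-identityʳ _)))))
      where open Mod ℤ[ω]

    𝕋 : Algebra 𝔽 0ℓ
    𝕋 = record { commutativeRing = T/p ; ι = 𝔽→T/p }

    evalAt : ℕ → AlgHom (Polynomial 𝔽 ℕ) 𝕋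
    evalAt n = induced 𝔽 _ 𝕋 (λ i → gen (i , n)) (λ { {t} {u} () })

    char-p : p timesᵀᵖ T/p.1# T/p.≈ T/p.0#
    char-p = T/p.trans (con-p T/p (compose T/p (quotientMap ℤ[ω] (con (+ p))) (Algebra.ι (ℤ-ring [ ℕ ^1/p^∞]))))
      (RingHomomorphism.⟦⟧-cong 𝔽→T/p p≈0)

    frobeniusᵀ : T/p ⟶ T/p
    frobeniusᵀ = Frobenius.frobeniusHom pp T/p char-p

    T/p-root : ∀ i n → pow T/p (gen (i , suc n)) p T/p.≈ gen (i , n)
    T/p-root i n = Mod.≈⇒mod ℤ[ω] (T.trans (T.reflexive (pow-/ ℤ[ω] (con (+ p)) (gen (i , suc n)) p)) (RootPowers.root-^p p ℤ-ring ℕ i n))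

    evalAt-frobenius : ∀ n x → pow T/p (AlgHom.fun (evalAt (suc n)) x) p T/p.≈ AlgHom.fun (evalAt n) x
    evalAt-frobenius n = hom-ext 𝔽 _ 𝕋
      (record { hom = compose T/p frobeniusᵀ (AlgHom.hom (evalAt (suc n)))
              ; commutes = λ z → ℤ-initial T/p (compose T/p frobeniusᵀ ℤ→T/p) ℤ→T/p z })
      (evalAt n) (λ i → T/p-root i n)
      where ℤ→T/p = compose T/p 𝔽→T/p (quotientMap ℤ-ring (+ p))

    -- ℒ₀ is a colimit along Frobenius, whereas ℤ[ω] arises by adjoining roots of the variables.
    -- This map is inverse to the one that `mod-p` induces on ℤ[ω] / p; it supplies the lifts of
    -- elements of ℒ₀ and the kernel of `residue`.
    ψ-algHom : AlgHom (𝔽[ω] ^pf) (record { commutativeRing = T/p ; ι = AlgHom.hom (evalAt 0) })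
    ψ-algHom = induced 𝔽[ω] (Frobenius 𝔽[ω])
      (record { commutativeRing = T/p ; ι = AlgHom.hom (evalAt 0) })
      (λ { (n , x) → AlgHom.fun (evalAt n) x })
      λ { (root-cong n {x} {y} e) → AlgHom.cong (evalAt n) {x} {y} e
        ; (root-+ n x y)  → T/p.refl
        ; (root-* n x y)  → T/p.refl
        ; (root-1 n)      → T/p.refl
        ; (root-base x)   → T/p.refl
        ; (frobenius n x) → T/p.trans (hom-^ 𝔽[ω] T/p (AlgHom.hom (evalAt (suc n))) x p) (evalAt-frobenius n x)
        }
    module ψ = AlgHom ψ-algHom

    ψ-mod-p : ∀ t → ψ.fun (AlgHom.fun mod-p t) T/p.≈ t
    ψ-mod-p = hom-ext ℤ-ring (Roots ℤ-ring ℕ) (record { commutativeRing = T/p ; ι = compose T/p (quotientMap ℤ[ω] (con (+ p))) (Algebra.ι (ℤ-ring [ ℕ ^1/p^∞])) })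
      (record { hom = compose T/p ψ.hom (AlgHom.hom mod-p) ; commutes = λ _ → T/p.refl })
      (record { hom = quotientMap ℤ[ω] (con (+ p)) ; commutes = λ _ → T/p.refl })
      (λ _ → T/p.refl)

    mod-p-evalAt : ∀ n x → AlgHom.fun mod-p (AlgHom.fun (evalAt n) x) ℒ₀.≈ gen (n , x)
    mod-p-evalAt n (con z)  = constant n
      where
      constant : ∀ n → con (con z) ℒ₀.≈ gen (n , con z)
      constant zero    = ℒ₀.sym (Equal.relation (root-base (con z)))
      -- Fermat's little theorem: Frobenius on 𝔽[ω] fixes the image of ℤ, since a homomorphism out
      -- of ℤ is unique.
      constant (suc n) = ℒ₀.trans (constant n) (ℒ₀.trans (ℒ₀.sym (Equal.relation (frobenius n (con z))))
        (RingHomomorphism.⟦⟧-cong (rootHom (suc n))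
          (ℤ-initial 𝔽[ω] (compose 𝔽[ω] (Frobenius.frobeniusHom pp 𝔽[ω] (𝔽[ω].trans (con-p 𝔽[ω] ℤ→𝔽[ω]) (Equal.con-cong p≈0))) ℤ→𝔽[ω]) ℤ→𝔽[ω] z)))
    mod-p-evalAt n (gen i)  = ℒ₀.refl
    mod-p-evalAt n (t :+ u) = ℒ₀.trans (ℒ₀.+-cong (mod-p-evalAt n t) (mod-p-evalAt n u)) (ℒ₀.sym (Equal.relation (root-+ n t u)))
    mod-p-evalAt n (t :* u) = ℒ₀.trans (ℒ₀.*-cong (mod-p-evalAt n t) (mod-p-evalAt n u)) (ℒ₀.sym (Equal.relation (root-* n t u)))
    mod-p-evalAt n (:- t)   = ℒ₀.trans (ℒ₀.-‿cong (mod-p-evalAt n t)) (ℒ₀.sym (RingHomomorphism.-‿homo (rootHom n) t))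

    mod-p-ψ : ∀ t → AlgHom.fun mod-p (ψ.fun t) ℒ₀.≈ t
    mod-p-ψ = hom-ext 𝔽[ω] (Frobenius 𝔽[ω]) (𝔽[ω] ^pf)
      (record { hom = compose ℒ₀ (quotientLift ℤ[ω] ℒ₀ (AlgHom.hom mod-p) (Equal.con-cong (Equal.con-cong p≈0))) ψ.hom
              ; commutes = λ x → ℒ₀.trans (mod-p-evalAt 0 x) (Equal.relation (root-base x)) })
      (Category.idᶜ (Alg 𝔽[ω] 0ℓ)) (λ { (n , x) → mod-p-evalAt n x })

    mod-p-kernel : ∀ {x y} → AlgHom.fun mod-p x ℒ₀.≈ AlgHom.fun mod-p y → x T/p.≈ y
    mod-p-kernel {x} {y} e = T/p.trans (T/p.sym (ψ-mod-p x)) (T/p.trans (ψ.cong e) (ψ-mod-p y))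

    open PowerSeries ℤ[ω]

  lift : ℒ₀.Carrier → ℒ.Carrier
  lift x = const (ψ.fun x)

  residue-lift : ∀ x → RingHomomorphism.⟦_⟧ residue (lift x) ℒ₀.≈ x
  residue-lift = mod-p-ψ

  -- The quotient of p by π: the defining relation reads p = π ∑ ωᵢ₊₁ πⁱ with i ≥ 0, and the index
  -- `i` of a variable stands for i + 1.
  u : ℒ.Carrier
  u i = gen (i , 0)

  private
    S-π≈X : π S.≈ X
    S-π≈X zero          = T.refl
    S-π≈X (suc zero)    = T.refl
    S-π≈X (suc (suc n)) = T.refl

    π≈X : π ℒ.≈ X
    π≈X = Mod.≈⇒mod S S-π≈X

    const-p : const (con (+ p)) ℒ.≈ u ℒ.* π
    const-p = Mod._,_ {R = S} S.1# λ n → T.trans (S.*-identityˡ p-∑ωπ n) (go n)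
      where
      u*π : ∀ n → (u S.* π) n T.≈ (T.0# ◂ u) n
      u*π n = T.trans (S.*-comm u π n) (T.trans (S.*-congʳ {u} {π} {X} S-π≈X n) (X*≈◂ u n))
      go : ∀ n → p-∑ωπ n T.≈ (const (con (+ p)) S.- (u S.* π)) n
      go zero    = T.sym (T.trans (T.+-congˡ (T.trans (T.-‿cong (u*π 0)) (Algebra.Properties.Ring.-0#≈0# T.ring))) (T.+-identityʳ _))
      go (suc n) = T.sym (T.trans (T.+-identityˡ _) (T.-‿cong (u*π (suc n))))

  p≈uπ : p times ℒ.1# ℒ.≈ u ℒ.* π
  p≈uπ = ℒ.trans (con-p ℒ (compose ℒ (quotientMap S p-∑ωπ) (compose S constHom (Algebra.ι (ℤ-ring [ ℕ ^1/p^∞]))))) const-p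

  residue-π : RingHomomorphism.⟦_⟧ residue π ℒ₀.≈ ℒ₀.0#
  residue-π = ℒ₀.refl

  residue-kernel : ∀ {x y} → RingHomomorphism.⟦_⟧ residue x ℒ₀.≈ RingHomomorphism.⟦_⟧ residue y → Mod._≡_[mod_] ℒ x y π
  residue-kernel {x} {y} e = RingTheory.mod-divisor ℒ {X} {π} {x} {y} (ℒ.sym π≈X)
    (mod-X p-∑ωπ regular-p {con (+ p)} {u} (ℒ.trans const-p (ℒ.*-congˡ {u} π≈X)) {x} {y} (mod-p-kernel {x 0} {y 0} e))

  ω-^p^ : ∀ i n m → pow ℒ ω^[ i , m ℕ.+ n ] (p ℕ.^ m) ℒ.≈ ω^[ i , n ]
  ω-^p^ i n m = ℒ.trans (ℒ.reflexive (pow-/ S p-∑ωπ ω^[ i , m ℕ.+ n ] (p ℕ.^ m))) (Mod.≈⇒mod S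
    (S.trans (Algebra.Properties.Semiring.Exp.^-congˡ S.semiring (p ℕ.^ m) (ω≈const (m ℕ.+ n)))
    (S.trans (S.sym (hom-^ ℤ[ω] S constHom (gen (i , m ℕ.+ n)) (p ℕ.^ m)))
    (S.trans (RingHomomorphism.⟦⟧-cong constHom (RootPowers.root-pow p ℤ-ring ℕ i n m)) (S.sym (ω≈const n))))))
    where
    ω≈const : ∀ n → ω^[ i , n ] S.≈ const (gen (i , n))
    ω≈const n zero    = T.refl
    ω≈const n (suc j) = T.refl

  π-regular : RingTheory.IsRegular ℒ π
  π-regular y e = quotient-X-regular p-∑ωπ regular-p y (ℒ.trans (ℒ.*-congʳ {y} (ℒ.sym π≈X)) e)

  private
    π^≈X^ : ∀ n → pow ℒ π n ℒ.≈ pow ℒ X n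
    π^≈X^ n = Algebra.Properties.Semiring.Exp.^-congˡ ℒ.semiring n π≈X

  ℒ-separated : ∀ {x y} → (∀ n → Mod._≡_[mod_] ℒ x y (pow ℒ π n)) → x ℒ.≈ y
  ℒ-separated d = quotient-separated p-∑ωπ regular-p λ n → RingTheory.mod-divisor ℒ (π^≈X^ n) (d n)

  ℒ-limit : (x : Completed ℒ π) → Σ ℒ.Carrier λ y → ∀ n → Mod._≡_[mod_] ℒ y (Completed.at x n) (pow ℒ π n)
  ℒ-limit x = let y , h = quotient-limit p-∑ωπ regular-p (record
                    { at = at ; compatible = λ n → RingTheory.mod-divisor ℒ (π^≈X^ n) (compatible n) }) in
    y , λ n → RingTheory.mod-divisor ℒ (ℒ.sym (π^≈X^ n)) (h n)
    where open Completed x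

-- The polynomials Qₙ

open RingHomomorphism using (⟦_⟧)
open AlgHom using (fun)

evaluation : (R : CommutativeRing 0ℓ 0ℓ) {G : Set} (A : Algebra R c) → (G → Algebra.Carrier A) → AlgHom (Polynomial R G) A
evaluation R A ρ = induced R _ A ρ (λ { {t} {u} () })

module ResidueAction {L : CommutativeRing 0ℓ 0ℓ} {π : ∣ L ∣} (C : Algebra L 0ℓ)
  (lift : Algebra.Carrier C → ∣ L ∣) (res-lift : ∀ x → Algebra._≈_ C (⟦ Algebra.ι C ⟧ (lift x)) x)
  (res-kernel : ∀ x y → Algebra._≈_ C (⟦ Algebra.ι C ⟧ x) (⟦ Algebra.ι C ⟧ y) → Mod._≡_[mod_] L x y π)
  (B : Algebra L b) where
  private
    module L = CommutativeRing L
    module L₀ = Algebra C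
    res = Algebra.ι C
    module res = RingHomomorphism res
    B/πB = Algebra.commutativeRing B / ⟦ Algebra.ι B ⟧ π
    module B where
      open Algebra B public
      open RingTheory (Algebra.commutativeRing B) public
      open Mod (Algebra.commutativeRing B) public using (≈⇒mod)
    module ι = RingHomomorphism B.ι
    module B/π = CommutativeRing B/πB

  ι-lift-mod : ∀ {x y} → ⟦ res ⟧ x L₀.≈ ⟦ res ⟧ y → ⟦ B.ι ⟧ x B/π.≈ ⟦ B.ι ⟧ y
  ι-lift-mod e = hom-mod L B.commutativeRing B.ι (res-kernel _ _ e)

  -- L₀ acts on B / π, being L / π.
  residueAction : L₀.commutativeRing ⟶ B/πB
  residueAction = mkHom L₀.commutativeRing B/πB (λ x → ⟦ B.ι ⟧ (lift x))
    (λ e → ι-lift-mod (L₀.trans (res-lift _) (L₀.trans e (L₀.sym (res-lift _)))))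
    (λ x y → B/π.trans (ι-lift-mod (L₀.trans (res-lift _) (L₀.sym (L₀.trans (res.+-homo _ _) (L₀.+-cong (res-lift x) (res-lift y))))))
                       (B.≈⇒mod (ι.+-homo _ _)))
    (λ x y → B/π.trans (ι-lift-mod (L₀.trans (res-lift _) (L₀.sym (L₀.trans (res.*-homo _ _) (L₀.*-cong (res-lift x) (res-lift y))))))
                       (B.≈⇒mod (ι.*-homo _ _)))
    (B/π.trans (ι-lift-mod (L₀.trans (res-lift _) (L₀.sym res.1#-homo))) (B.≈⇒mod ι.1#-homo))

-- What the later arguments use of ℒ: a π-adically complete and separated ring without π-torsion,
-- with p a multiple of π and with perfect residue ring. The root is given as a homomorphism, so
-- that scalars can be restricted along it.
record Base (p : ℕ) : Set₁ where
  field
    L L₀ : CommutativeRing 0ℓ 0ℓ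
  module L  = CommutativeRing L
  module L₀ = CommutativeRing L₀
  open Algebra.Properties.Semiring.Mult L.semiring using () renaming (_×_ to _times_)
  field
    π u          : L.Carrier
    p≈uπ         : p times L.1# L.≈ u L.* π
    res          : L ⟶ L₀
    res-π        : ⟦ res ⟧ π L₀.≈ L₀.0#
    lift         : L₀.Carrier → L.Carrier
    res-lift     : ∀ x → ⟦ res ⟧ (lift x) L₀.≈ x
    res-kernel   : ∀ {x y} → ⟦ res ⟧ x L₀.≈ ⟦ res ⟧ y → Mod._≡_[mod_] L x y π
    √            : L₀ ⟶ L₀
    √-^p         : ∀ x → pow L₀ (⟦ √ ⟧ x) p L₀.≈ x
    π-regular    : RingTheory.IsRegular L π
    separated    : ∀ {x y} → (∀ n → Mod._≡_[mod_] L x y (pow L π n)) → x L.≈ y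
    limit        : (x : Completed L π) → Σ L.Carrier λ y → ∀ n → Mod._≡_[mod_] L y (Completed.at x n) (pow L π n)

  L₀-over-L : Algebra L 0ℓ
  L₀-over-L = record { commutativeRing = L₀ ; ι = res }

module _ {p : ℕ} where
  open Lazard p using (Op; add; mul; ⟪_⟫)

  module _ (R : CommutativeRing a b) where
    open CommutativeRing R

    op-cong : ∀ ⋆ {x x′ y y′} → x ≈ x′ → y ≈ y′ → ⟪ ⋆ ⟫ R x y ≈ ⟪ ⋆ ⟫ R x′ y′
    op-cong add = +-cong
    op-cong mul = *-cong

    op-mod : ∀ ⋆ {f x x′ y y′} → Mod._≡_[mod_] R x x′ f → Mod._≡_[mod_] R y y′ f →
             Mod._≡_[mod_] R (⟪ ⋆ ⟫ R x y) (⟪ ⋆ ⟫ R x′ y′) f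
    op-mod add = Mod.mod-+-cong R
    op-mod mul = Mod.mod-*-cong R

  op-hom : {R : CommutativeRing a b} {S : CommutativeRing c c′} (φ : R ⟶ S) → ∀ ⋆ x y →
           CommutativeRing._≈_ S (⟦ φ ⟧ (⟪ ⋆ ⟫ R x y)) (⟪ ⋆ ⟫ S (⟦ φ ⟧ x) (⟦ φ ⟧ y))
  op-hom φ add = RingHomomorphism.+-homo φ
  op-hom φ mul = RingHomomorphism.*-homo φ

-- Ghost components take sequences indexed by all numbers, but the generic ring at level `n` has
-- variables only up to index `n`; larger indices repeat the last one.
clamp : ∀ n → ℕ → Fin (suc n)
clamp zero    _       = fzero
clamp (suc n) zero    = fzero
clamp (suc n) (suc i) = fsuc (clamp n i)

toℕ-clamp : ∀ {n i} → i ≤ n → toℕ (clamp n i) ≡ i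
toℕ-clamp {zero}  z≤n       = ≡.refl
toℕ-clamp {suc n} z≤n       = ≡.refl
toℕ-clamp {suc n} (s≤s i≤n) = ≡.cong suc (toℕ-clamp i≤n)

clamp-toℕ : ∀ {n} (j : Fin (suc n)) → clamp n (toℕ j) ≡ j
clamp-toℕ {zero}  fzero    = ≡.refl
clamp-toℕ {suc n} fzero    = ≡.refl
clamp-toℕ {suc n} (fsuc j) = ≡.cong fsuc (clamp-toℕ j)

module _ {A : ℕ → Set c} where

  overrideIf : ∀ {i m} → Dec (i ≡ m) → A i → A m → A i
  overrideIf (yes eq) y x = ≡.subst A (≡.sym eq) x
  overrideIf (no _)   y x = y

  override : (∀ i → A i) → ∀ m → A m → ∀ i → A i
  override f m x i = overrideIf (i ℕ.≟ m) (f i) x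

  override-here : ∀ f m x → override f m x m ≡ x
  override-here f m x with m ℕ.≟ m
  ... | yes eq rewrite ℕ.≡-irrelevant eq ≡.refl = ≡.refl
  ... | no ¬eq = contradiction ≡.refl ¬eq

  override-there : ∀ f m x {i} → i ≢ m → override f m x i ≡ f i
  override-there f m x {i} i≢m with i ℕ.≟ m
  ... | yes eq = contradiction eq i≢m
  ... | no _   = ≡.refl

module OverBase {p : ℕ} (pp : Prime p) (base : Base p) where
  open Base base public
  open Lazard p using (Op; add; mul; ⟪_⟫)

  L₀-char-p : Algebra.Properties.Semiring.Mult._×_ L₀.semiring p L₀.1# L₀.≈ L₀.0#
  L₀-char-p = L₀.trans (L₀.sym (hom-times-1 L L₀ res p)) (L₀.trans (RingHomomorphism.⟦⟧-cong res p≈uπ)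
    (L₀.trans (RingHomomorphism.*-homo res u π) (L₀.trans (L₀.*-congˡ res-π) (L₀.zeroʳ _))))

  √^ : ℕ → L₀ ⟶ L₀
  √^ zero    = idʰ L₀
  √^ (suc n) = compose L₀ √ (√^ n)

  frobenius₀ : L₀ ⟶ L₀
  frobenius₀ = Frobenius.frobeniusHom pp L₀ L₀-char-p

  frobenius^ : ℕ → L₀ ⟶ L₀
  frobenius^ zero    = idʰ L₀
  frobenius^ (suc n) = compose L₀ (frobenius^ n) frobenius₀

  frobenius^-√^ : ∀ n x → ⟦ frobenius^ n ⟧ (⟦ √^ n ⟧ x) L₀.≈ x
  frobenius^-√^ zero    x = L₀.refl
  frobenius^-√^ (suc n) x = L₀.trans (RingHomomorphism.⟦⟧-cong (frobenius^ n) (√-^p _)) (frobenius^-√^ n x)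

  √^-frobenius^ : ∀ n x → ⟦ √^ n ⟧ (⟦ frobenius^ n ⟧ x) L₀.≈ x
  √^-frobenius^ zero    x = L₀.refl
  √^-frobenius^ (suc n) x = L₀.trans (RingHomomorphism.⟦⟧-cong √ (√^-frobenius^ n _))
    (L₀.trans (hom-^ L₀ L₀ √ x p) (√-^p x))

  infix 9 _⁽_⁾

  -- k with the elements of L₀ acting through their pⁿ-th roots.
  _⁽_⁾ : Algebra L₀ c → ℕ → Algebra L₀ c
  k ⁽ n ⁾ = restrictScalars (√^ n) k

  module OverL₀ (k : Algebra L₀ c) where
    open Algebra k

    char-p : Algebra.Properties.Semiring.Mult._×_ semiring p 1# ≈ 0#
    char-p = trans (sym (hom-times-1 L₀ commutativeRing ι p))
      (trans (RingHomomorphism.⟦⟧-cong ι L₀-char-p) (RingHomomorphism.0#-homo ι))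

    -- Frobenius is only semilinear; letting the scalars act on the source through their p-th roots
    -- makes it linear.
    frobenius : AlgHom (k ⁽ 1 ⁾) k
    frobenius = record
      { hom      = Frobenius.frobeniusHom pp commutativeRing char-p
      ; commutes = λ x → trans (sym (hom-^ L₀ commutativeRing ι (⟦ √ ⟧ x) p)) (RingHomomorphism.⟦⟧-cong ι (√-^p x))
      }

    frobenius⁽_⁾ : ∀ n → AlgHom (k ⁽ suc n ⁾) (k ⁽ n ⁾)
    frobenius⁽ n ⁾ = record { hom = AlgHom.hom frobenius ; commutes = λ x → AlgHom.commutes frobenius (⟦ √^ n ⟧ x) }

  twist : {k : Algebra L₀ c} {k′ : Algebra L₀ c′} → ∀ n → AlgHom k k′ → AlgHom (k ⁽ n ⁾) (k′ ⁽ n ⁾)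
  twist n f = record { hom = AlgHom.hom f ; commutes = λ x → AlgHom.commutes f (⟦ √^ n ⟧ x) }

  module OverL (R : Algebra L a) where
    open Algebra R public
    open RingTheory commutativeRing public
    open Mod commutativeRing public using (_≡_[mod_]; ≈⇒mod; mod-+-cong; mod-*-cong; mod-neg-cong; mod-isEquivalence)

    πᴿ uᴿ : Carrier
    πᴿ = ⟦ ι ⟧ π
    uᴿ = ⟦ ι ⟧ u

    p≈uπᴿ : Algebra.Properties.Semiring.Mult._×_ semiring p 1# ≈ uᴿ * πᴿ
    p≈uπᴿ = trans (sym (hom-times-1 L commutativeRing ι p))
      (trans (RingHomomorphism.⟦⟧-cong ι p≈uπ) (RingHomomorphism.*-homo ι u π))

    open Ghost pp p≈uπᴿ public

    w : ℕ → (ℕ → Carrier) → Carrier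
    w = ghost p πᴿ

    modulo-π : CommutativeRing a a
    modulo-π = commutativeRing / πᴿ

    open ResidueAction {L = L} {π = π} L₀-over-L lift res-lift (λ x y → res-kernel) R public

    moduloAlgebra : Algebra L₀ a
    moduloAlgebra = record { commutativeRing = modulo-π ; ι = residueAction }

  -- The ring `k` is R / π in some presentation. The function `lifting` is not asked to respect
  -- equality: by `kernel`, any two lifts of equal elements agree modulo π, and ghost components
  -- need no more than that.
  record Pair (R : Algebra L a) (k : Algebra L₀ b) : Set (a ⊔ b) where
    private
      module R = Algebra R
      module k = Algebra k
    field
      red-hom : R.commutativeRing ⟶ k.commutativeRing
    open RingHomomorphism red-hom public renaming (⟦_⟧ to red; ⟦⟧-cong to red-cong; +-homo to red-+; *-homo to red-*; 1#-homo to red-1; 0#-homo to red-0; -‿homo to red-neg)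
    field
      red-ι    : ∀ x → red (⟦ R.ι ⟧ x) k.≈ ⟦ k.ι ⟧ (⟦ res ⟧ x)
      kernel   : ∀ {x y} → red x k.≈ red y → Mod._≡_[mod_] R.commutativeRing x y (⟦ R.ι ⟧ π)
      lifting  : k.Carrier → R.Carrier
      red-lift : ∀ x → red (lifting x) k.≈ x

    red-π : red (⟦ R.ι ⟧ π) k.≈ k.0#
    red-π = k.trans (red-ι π) (k.trans (RingHomomorphism.⟦⟧-cong k.ι res-π) (RingHomomorphism.0#-homo k.ι))

    red-mod : ∀ {x y} → Mod._≡_[mod_] R.commutativeRing x y (⟦ R.ι ⟧ π) → red x k.≈ red y
    red-mod = kills⇒resp-mod R.commutativeRing k.commutativeRing red-hom red-π

  module _ {G : Set} (_⊢_ : Rel (Term L.Carrier G) 0ℓ) (_⊢₀_ : Rel (Term L₀.Carrier G) 0ℓ) where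
    private
      P  = ⟨ L ∣ _⊢_ ⟩
      P₀ = ⟨ L₀ ∣ _⊢₀_ ⟩
      module P  = OverL P
      module P₀ = Algebra P₀
      P₀-over-L : Algebra L 0ℓ
      P₀-over-L = restrictScalars res P₀

    module _ (resp  : ∀ {t u} → t ⊢ u → eval P₀-over-L gen t P₀.≈ eval P₀-over-L gen u)
             (resp₀ : ∀ {t u} → t ⊢₀ u → Algebra._≈_ P.moduloAlgebra (eval P.moduloAlgebra gen t) (eval P.moduloAlgebra gen u)) where
      private
        down : AlgHom P P₀-over-L
        down = induced L _⊢_ P₀-over-L gen resp
        module down = AlgHom down

        up : AlgHom P₀ P.moduloAlgebra
        up = induced L₀ _⊢₀_ P.moduloAlgebra gen resp₀
        module up = AlgHom up

        P/π : Algebra L 0ℓ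
        P/π = record { commutativeRing = P.modulo-π ; ι = compose P.modulo-π (quotientMap P.commutativeRing P.πᴿ) P.ι }
        module P/π = Algebra P/π

        up-down : ∀ t → up.fun (down.fun t) P/π.≈ t
        up-down = hom-ext L _⊢_ P/π
          (record { hom = compose P.modulo-π (up.hom) (down.hom) ; commutes = λ x → P.ι-lift-mod (res-lift (⟦ res ⟧ x)) })
          (record { hom = quotientMap P.commutativeRing P.πᴿ ; commutes = λ _ → P/π.refl })
          (λ _ → P/π.refl)

        down-π : down.fun P.πᴿ P₀.≈ P₀.0#
        down-π = Equal.con-cong res-π

        down-up : ∀ t → down.fun (up.fun t) P₀.≈ t
        down-up = hom-ext L₀ _⊢₀_ P₀
          (record { hom = compose P₀.commutativeRing (quotientLift P.commutativeRing P₀.commutativeRing (down.hom) down-π) (up.hom)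
                  ; commutes = λ x → Equal.con-cong (res-lift x) })
          (Category.idᶜ (Alg L₀ 0ℓ)) (λ _ → P₀.refl)

      -- On common generators, P / π and P₀ map to each other as soon as the relations of each hold
      -- in the other, and both composites fix the generators and the scalars.
      presentedPair : Pair P P₀
      presentedPair = record
        { red-hom  = AlgHom.hom down
        ; red-ι    = λ _ → P₀.refl
        ; kernel   = λ {x} {y} e → P/π.trans (P/π.sym (up-down x)) (P/π.trans (up.cong e) (up-down y))
        ; lifting  = up.fun
        ; red-lift = down-up
        }

  polynomialPair : (G : Set) → Pair (Polynomial L G) (Polynomial L₀ G)
  polynomialPair G = presentedPair _ _ (λ { {t} {u} () }) (λ { {t} {u} () })

  Vars : ℕ → Set
  Vars n = Fin (suc n) ⊎ Fin (suc n)

  Polynomials : Set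
  Polynomials = ∀ i → Term L₀.Carrier (Vars i)

  module _ (k : Algebra L₀ c) (Q : Polynomials) where
    private module k = Algebra k

    apply : (ℕ → k.Carrier) → (ℕ → k.Carrier) → ℕ → k.Carrier
    apply α β i = eval k [ α ∘ toℕ , β ∘ toℕ ]′ (Q i)

    apply-cong : ∀ {α α′ β β′} i → (∀ j → j ≤ i → α j k.≈ α′ j) → (∀ j → j ≤ i → β j k.≈ β′ j) →
                 apply α β i k.≈ apply α′ β′ i
    apply-cong i α≈ β≈ = eval-cong-ρ k (λ { (inj₁ j) → α≈ (toℕ j) (ℕ.≤-pred (Fin.toℕ<n j))
                                          ; (inj₂ j) → β≈ (toℕ j) (ℕ.≤-pred (Fin.toℕ<n j)) }) (Q i)

  apply-natural : {k : Algebra L₀ c} {k′ : Algebra L₀ c′} (f : AlgHom k k′) (Q : Polynomials) → ∀ α β i →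
                  Algebra._≈_ k′ (fun f (apply k Q α β i)) (apply k′ Q (fun f ∘ α) (fun f ∘ β) i)
  apply-natural {k = k} {k′} f Q α β i = Algebra.trans k′ (eval-natural f _ (Q i))
    (eval-cong-ρ k′ (λ { (inj₁ j) → Algebra.refl k′ ; (inj₂ j) → Algebra.refl k′ }) (Q i))

  module _ (⋆ : Op) where

    private
      module Generic (n : ℕ) where
        R : Algebra L 0ℓ
        R = Polynomial L (Vars n)
        k : Algebra L₀ 0ℓ
        k = Polynomial L₀ (Vars n)
        module R = OverL R
        module k = Algebra k
        open Pair (polynomialPair (Vars n)) public
        X Y : ℕ → R.Carrier
        X i = gen (inj₁ (clamp n i))
        Y i = gen (inj₂ (clamp n i))

    -- s lifts the Qᵢ, i ≤ n, with coefficients replaced by their pⁿ-th roots.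
    GenericSolution : ℕ → Polynomials → Set
    GenericSolution n Q =
      let open Generic n in
      Σ (ℕ → R.Carrier) λ s → (∀ i → i ≤ n → red (s i) k.≈ apply (k ⁽ n ⁾) Q (red ∘ X) (red ∘ Y) i) ×
                              R.w n s R.≈ ⟪ ⋆ ⟫ R.commutativeRing (R.w n X) (R.w n Y)

    module _ {R : Algebra L a} {k : Algebra L₀ b} (P : Pair R k) where
      private
        module R = OverL R
        module k = Algebra k
      open Pair P

      -- Evaluating the generic solution at `x` and `y` yields a sequence `t` that satisfies the
      -- ghost equation exactly. As `s` and `t` have the same reductions up to index `n`, their n-th
      -- ghost components agree mod πⁿ⁺¹.
      specialise : ∀ {n Q} → GenericSolution n Q → ∀ x y s →
                   (∀ i → i ≤ n → red (s i) k.≈ apply (k ⁽ n ⁾) Q (red ∘ x) (red ∘ y) i) →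
                   R.w n s R.≡ ⟪ ⋆ ⟫ R.commutativeRing (R.w n x) (R.w n y) [mod pow R.commutativeRing R.πᴿ (suc n) ]
      specialise {n} {Q} (sᵍ , sᵍ-red , sᵍ-ghost) x y s s-red =
        R.mod-trans (R.w-mod-π n s≡t) (R.≈⇒mod t-ghost)
        where
        module g = Generic n
        values : Vars n → R.Carrier
        values = [ x ∘ toℕ , y ∘ toℕ ]′
        e : AlgHom g.R R
        e = induced L _ R values (λ { {t} {u} () })
        module e = AlgHom e
        e₀ : AlgHom g.k k
        e₀ = induced L₀ _ k (red ∘ values) (λ { {t} {u} () })
        module e₀ = AlgHom e₀
        red-e : ∀ t → red (e.fun t) k.≈ e₀.fun (g.red t)
        red-e = hom-ext L _ (restrictScalars res k)
          (record { hom = compose k.commutativeRing red-hom (e.hom) ; commutes = red-ι })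
          (record { hom = compose k.commutativeRing (e₀.hom) g.red-hom ; commutes = λ _ → k.refl })
          (λ _ → k.refl)
        t : ℕ → R.Carrier
        t i = e.fun (sᵍ i)
        X-value : ∀ i → i ≤ n → e.fun (g.X i) R.≈ x i
        X-value i i≤n = R.reflexive (≡.cong x (toℕ-clamp i≤n))
        Y-value : ∀ i → i ≤ n → e.fun (g.Y i) R.≈ y i
        Y-value i i≤n = R.reflexive (≡.cong y (toℕ-clamp i≤n))
        t-red : ∀ i → i ≤ n → red (t i) k.≈ apply (k ⁽ n ⁾) Q (red ∘ x) (red ∘ y) i
        t-red i i≤n = k.trans (red-e (sᵍ i)) (k.trans (e₀.cong (sᵍ-red i i≤n))
          (k.trans (apply-natural {k = g.k ⁽ n ⁾} {k′ = k ⁽ n ⁾} (twist {k = g.k} {k′ = k} n e₀) Q (g.red ∘ g.X) (g.red ∘ g.Y) i)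
          (apply-cong (k ⁽ n ⁾) Q i (λ j j≤i → k.trans (k.sym (red-e (g.X j))) (red-cong (X-value j (ℕ.≤-trans j≤i i≤n))))
                                    (λ j j≤i → k.trans (k.sym (red-e (g.Y j))) (red-cong (Y-value j (ℕ.≤-trans j≤i i≤n)))))))
        s≡t : ∀ i → i ≤ n → s i R.≡ t i [mod R.πᴿ ]
        s≡t i i≤n = kernel (k.trans (s-red i i≤n) (k.sym (t-red i i≤n)))
        t-ghost : R.w n t R.≈ ⟪ ⋆ ⟫ R.commutativeRing (R.w n x) (R.w n y)
        t-ghost = R.trans (R.sym (hom-ghost g.R.commutativeRing R.commutativeRing (e.hom) p g.R.πᴿ n sᵍ))
          (R.trans (e.cong sᵍ-ghost)
          (R.trans (op-hom {R = g.R.commutativeRing} {S = R.commutativeRing} (e.hom) ⋆ (g.R.w n g.X) (g.R.w n g.Y))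
          (op-cong R.commutativeRing ⋆
            (R.trans (hom-ghost g.R.commutativeRing R.commutativeRing (e.hom) p g.R.πᴿ n g.X) (R.w-cong n X-value))
            (R.trans (hom-ghost g.R.commutativeRing R.commutativeRing (e.hom) p g.R.πᴿ n g.Y) (R.w-cong n Y-value)))))

    private
      open Algebra.Properties.Semiring.Exp using (^-congˡ)

      -- Undoes the passage to pⁿ-th roots of the coefficients. The reduced digit found at level n
      -- is a polynomial whose coefficients are already the roots, and this turns it into Qₙ itself.
      frobeniusCoefficients : {G : Set} → ℕ → Term L₀.Carrier G → Term L₀.Carrier G
      frobeniusCoefficients n (con x)  = con (⟦ frobenius^ n ⟧ x)
      frobeniusCoefficients n (gen i)  = gen i
      frobeniusCoefficients n (t :+ u) = frobeniusCoefficients n t :+ frobeniusCoefficients n u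
      frobeniusCoefficients n (t :* u) = frobeniusCoefficients n t :* frobeniusCoefficients n u
      frobeniusCoefficients n (:- t)   = :- frobeniusCoefficients n t

      module Step {R : Algebra L 0ℓ} {k : Algebra L₀ 0ℓ} (P : Pair R k) (X Y : ℕ → Algebra.Carrier R)
                  (n : ℕ) (Q : Polynomials) (sol : GenericSolution n Q) where
        private
          module R = OverL R
          module k = Algebra k
        open Pair P

        root : ℕ → R.Carrier
        root i = lifting (apply (k ⁽ suc n ⁾) Q (red ∘ X) (red ∘ Y) i)

        root^p-red : ∀ i → i ≤ n → red (pow R.commutativeRing (root i) p) k.≈
          apply (k ⁽ n ⁾) Q (λ j → red (pow R.commutativeRing (X j) p)) (λ j → red (pow R.commutativeRing (Y j) p)) i
        root^p-red i i≤n = k.trans (hom-^ R.commutativeRing k.commutativeRing red-hom (root i) p)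
          (k.trans (^-congˡ k.semiring p (red-lift _))
          (k.trans (apply-natural {k = k ⁽ suc n ⁾} {k′ = k ⁽ n ⁾} (OverL₀.frobenius⁽_⁾ k n) Q (red ∘ X) (red ∘ Y) i)
          (apply-cong (k ⁽ n ⁾) Q i
            (λ j _ → k.sym (hom-^ R.commutativeRing k.commutativeRing red-hom (X j) p))
            (λ j _ → k.sym (hom-^ R.commutativeRing k.commutativeRing red-hom (Y j) p)))))

        target : R.Carrier
        target = ⟪ ⋆ ⟫ R.commutativeRing (R.w (suc n) X) (R.w (suc n) Y)

        earlier : R.Carrier
        earlier = R.w n (λ i → pow R.commutativeRing (root i) p)

        abstract
         -- The analogue of Dwork's congruence. By `w-init` the target is determined mod πⁿ⁺¹ by the
         -- p-th powers of the variables at level n. There the given solution applies to the p-th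
         -- powers of the `root i`, because Frobenius turns pⁿ⁺¹-th roots of coefficients into pⁿ-th
         -- roots. By `w-last` the quotient of the difference by πⁿ⁺¹ is exactly the coordinate
         -- still missing.
         target≡earlier : target R.≡ earlier [mod pow R.commutativeRing R.πᴿ (suc n) ]
         target≡earlier = R.mod-trans (op-mod R.commutativeRing ⋆ (R.w-init n X) (R.w-init n Y))
          (R.mod-sym (specialise P {n} {Q} sol (λ j → pow R.commutativeRing (X j) p) (λ j → pow R.commutativeRing (Y j) p)
            (λ j → pow R.commutativeRing (root j) p) root^p-red))

        digit : R.Carrier
        digit = R.quotient target≡earlier

        module _ (next : Term L₀.Carrier (Vars (suc n)))
                 (next-apply : eval (k ⁽ suc n ⁾) [ red ∘ X ∘ toℕ , red ∘ Y ∘ toℕ ]′ next k.≈ red digit) where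

          s : ℕ → R.Carrier
          s = override root (suc n) digit

          s-red : ∀ i → i ≤ suc n → red (s i) k.≈ apply (k ⁽ suc n ⁾) (override Q (suc n) next) (red ∘ X) (red ∘ Y) i
          s-red i i≤n with i ℕ.≟ suc n
          ... | yes ≡.refl = k.sym next-apply
          ... | no _       = red-lift _

          s-ghost : R.w (suc n) s R.≈ target
          s-ghost = R.trans (R.w-last n s) (R.trans
            (R.+-cong (R.w-cong n (λ i i≤n → ^-congˡ R.semiring p (R.reflexive (override-there root (suc n) digit (ℕ.<⇒≢ (s≤s i≤n))))))
                      (R.*-congˡ (R.reflexive (override-here root (suc n) digit))))
            (R.sym (R.trans (R.mod-witness target≡earlier) (R.+-congˡ (R.*-comm _ _)))))

      module _ (n : ℕ) (Q : Polynomials) (sol : GenericSolution n Q) where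
        open Generic (suc n)
        private module step = Step (polynomialPair (Vars (suc n))) X Y n Q sol

        apply-frobeniusCoefficients : ∀ t → eval (k ⁽ suc n ⁾) [ red ∘ X ∘ toℕ , red ∘ Y ∘ toℕ ]′ (frobeniusCoefficients (suc n) t) k.≈ t
        apply-frobeniusCoefficients (con x)        = Equal.con-cong (√^-frobenius^ (suc n) x)
        apply-frobeniusCoefficients (gen (inj₁ j)) = k.reflexive (≡.cong (λ i → gen (inj₁ i)) (clamp-toℕ j))
        apply-frobeniusCoefficients (gen (inj₂ j)) = k.reflexive (≡.cong (λ i → gen (inj₂ i)) (clamp-toℕ j))
        apply-frobeniusCoefficients (t :+ u)       = k.+-cong (apply-frobeniusCoefficients t) (apply-frobeniusCoefficients u)
        apply-frobeniusCoefficients (t :* u)       = k.*-cong (apply-frobeniusCoefficients t) (apply-frobeniusCoefficients u)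
        apply-frobeniusCoefficients (:- t)         = k.-‿cong (apply-frobeniusCoefficients t)

        abstract
          next : Term L₀.Carrier (Vars (suc n))
          next = frobeniusCoefficients (suc n) (red step.digit)

          next-apply : eval (k ⁽ suc n ⁾) [ red ∘ X ∘ toℕ , red ∘ Y ∘ toℕ ]′ next k.≈ red step.digit
          next-apply = apply-frobeniusCoefficients (red step.digit)

          step : GenericSolution (suc n) (override Q (suc n) next)
          step = step.s next next-apply , step.s-red next next-apply , step.s-ghost next next-apply

      -- Stage `n` settles the polynomials up to index `n`; later stages override only larger
      -- indices, so the diagonal `Q` agrees with every stage where that stage is final.
      solutions : ∀ n → Σ Polynomials (GenericSolution n)
      solutions zero = Q₀ , (λ _ → ⟪ ⋆ ⟫ R.commutativeRing (X 0) (Y 0)) , red₀ , R.refl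
        where
        open Generic 0
        Q₀ : Polynomials
        Q₀ zero    = ⟪ ⋆ ⟫ (Algebra.commutativeRing (Polynomial L₀ (Vars 0))) (gen (inj₁ fzero)) (gen (inj₂ fzero))
        -- A placeholder, overridden at a later stage.
        Q₀ (suc n) = con L₀.0#
        red₀ : ∀ i → i ≤ 0 → red (⟪ ⋆ ⟫ R.commutativeRing (X 0) (Y 0)) k.≈ apply (k ⁽ 0 ⁾) Q₀ (red ∘ X) (red ∘ Y) i
        red₀ zero z≤n = go ⋆
          where
          go : ∀ ⋆ → red (⟪ ⋆ ⟫ R.commutativeRing (X 0) (Y 0)) k.≈ eval (k ⁽ 0 ⁾) [ red ∘ X ∘ toℕ , red ∘ Y ∘ toℕ ]′
                (⟪ ⋆ ⟫ (Algebra.commutativeRing (Polynomial L₀ (Vars 0))) (gen (inj₁ fzero)) (gen (inj₂ fzero)))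
          go add = k.refl
          go mul = k.refl
      solutions (suc n) = let Q , sol = solutions n in override Q (suc n) (next n Q sol) , step n Q sol

    Q : Polynomials
    Q n = proj₁ (solutions n) n

    private
      stable : ∀ n i → i ≤ n → proj₁ (solutions n) i ≡ Q i
      stable zero    zero z≤n = ≡.refl
      stable (suc n) i    i≤n with ℕ.m≤n⇒m<n∨m≡n i≤n
      ... | inj₁ (s≤s i≤n) = ≡.trans (override-there (proj₁ (solutions n)) (suc n) _ (ℕ.<⇒≢ (s≤s i≤n))) (stable n i i≤n)
      ... | inj₂ ≡.refl    = ≡.refl

    Q-generic : ∀ n → GenericSolution n Q
    Q-generic n = let Qₙ , s , s-red , s-ghost = solutions n in
      s , (λ i i≤n → k.trans (s-red i i≤n)
            (k.reflexive (≡.cong (eval (k ⁽ n ⁾) [ red ∘ X ∘ toℕ , red ∘ Y ∘ toℕ ]′) (stable n i i≤n)))) , s-ghost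
      where open Generic n

  opᵂ : (k : Algebra L₀ c) → Op → (ℕ → Algebra.Carrier k) → (ℕ → Algebra.Carrier k) → ℕ → Algebra.Carrier k
  opᵂ k ⋆ = apply k (Q ⋆)

  module _ {R : Algebra L a} {k : Algebra L₀ b} (P : Pair R k) where
    private module R = OverL R
    open Pair P

    opᵂ-ghost : ∀ ⋆ n x y s → (∀ i → i ≤ n → Algebra._≈_ k (red (s i)) (opᵂ (k ⁽ n ⁾) ⋆ (red ∘ x) (red ∘ y) i)) →
      R.w n s R.≡ ⟪ ⋆ ⟫ R.commutativeRing (R.w n x) (R.w n y) [mod pow R.commutativeRing R.πᴿ (suc n) ]
    opᵂ-ghost ⋆ n x y s s-red = specialise ⋆ P {n} {Q ⋆} (Q-generic ⋆ n) x y s s-red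

-- Perfect residue rings

module Perfect {p : ℕ} (pp : Prime p) (base : Base p) where
  open OverBase pp base
  open Lazard p using (Op; add; mul; ⟪_⟫)

  record HasRoots (k : Algebra L₀ b) : Set b where
    private module k = Algebra k
    field
      root      : k.Carrier → k.Carrier
      root-cong : ∀ {x y} → x k.≈ y → root x k.≈ root y
      root-^p   : ∀ x → pow k.commutativeRing (root x) p k.≈ x
      ^p-root   : ∀ x → root (pow k.commutativeRing x p) k.≈ x

    open Algebra.Properties.Semiring.Exp k.semiring using (^-congˡ; ^-congʳ; ^-assocʳ)
    open OverL₀ k using (frobenius)
    private module frobenius = AlgHom frobenius

    ^p-injective : ∀ {x y} → pow k.commutativeRing x p k.≈ pow k.commutativeRing y p → x k.≈ y
    ^p-injective {x} {y} e = k.trans (k.sym (^p-root x)) (k.trans (root-cong e) (^p-root y))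

    rootAlgHom : AlgHom k (k ⁽ 1 ⁾)
    rootAlgHom = record
      { hom = mkHom k.commutativeRing k.commutativeRing root root-cong
          (λ x y → ^p-injective (k.trans (root-^p _) (k.sym (k.trans (frobenius.+-homo _ _) (k.+-cong (root-^p x) (root-^p y))))))
          (λ x y → ^p-injective (k.trans (root-^p _) (k.sym (k.trans (frobenius.*-homo _ _) (k.*-cong (root-^p x) (root-^p y))))))
          (^p-injective (k.trans (root-^p _) (k.sym frobenius.1#-homo)))
      ; commutes = λ x → ^p-injective (k.trans (root-^p _) (k.sym (frobenius.commutes x)))
      }
    module rootAlgHom = AlgHom rootAlgHom

    root^ : ℕ → k.Carrier → k.Carrier
    root^ zero    x = x
    root^ (suc n) x = root (root^ n x)

    root^-cong : ∀ n {x y} → x k.≈ y → root^ n x k.≈ root^ n y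
    root^-cong zero    e = e
    root^-cong (suc n) e = root-cong (root^-cong n e)

    root^-suc : ∀ n x → root^ (suc n) x k.≈ root^ n (root x)
    root^-suc zero    x = k.refl
    root^-suc (suc n) x = root-cong (root^-suc n x)

    root^-AlgHom : ∀ n → AlgHom k (k ⁽ n ⁾)
    root^-AlgHom zero    = record { hom = idʰ k.commutativeRing ; commutes = λ _ → k.refl }
    root^-AlgHom (suc n) = record
      { hom      = compose k.commutativeRing rootAlgHom.hom (AlgHom.hom (root^-AlgHom n))
      ; commutes = λ x → k.trans (root-cong (AlgHom.commutes (root^-AlgHom n) x)) (rootAlgHom.commutes (⟦ √^ n ⟧ x))
      }

    fun-root^ : ∀ n x → fun (root^-AlgHom n) x k.≈ root^ n x
    fun-root^ zero    x = k.refl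
    fun-root^ (suc n) x = root-cong (fun-root^ n x)

    root^-p^ : ∀ n x → pow k.commutativeRing (root^ n x) (p ℕ.^ n) k.≈ x
    root^-p^ zero    x = k.*-identityʳ x
    root^-p^ (suc n) x = k.trans (k.sym (^-assocʳ _ p (p ℕ.^ n)))
      (k.trans (^-congˡ (p ℕ.^ n) (root-^p (root^ n x))) (root^-p^ n x))

    p^-root^ : ∀ n x → root^ n (pow k.commutativeRing x (p ℕ.^ n)) k.≈ x
    p^-root^ zero    x = k.*-identityʳ x
    p^-root^ (suc n) x = k.trans (root^-suc n _) (k.trans (root^-cong n (k.trans
      (root-cong (k.trans (^-congʳ x (ℕ.*-comm p (p ℕ.^ n))) (k.sym (^-assocʳ x (p ℕ.^ n) p)))) (^p-root _))) (p^-root^ n x))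

    root^-ι : ∀ n x → root^ n (⟦ k.ι ⟧ x) k.≈ ⟦ k.ι ⟧ (⟦ √^ n ⟧ x)
    root^-ι n x = k.trans (k.sym (fun-root^ n _)) (AlgHom.commutes (root^-AlgHom n) x)

  module PerfectPair {R : Algebra L a} {k : Algebra L₀ b} (P : Pair R k) (hasRoots : HasRoots k) where
    private
      module R = OverL R
      module k = Algebra k
    open Pair P
    open HasRoots hasRoots
    open Algebra.Properties.Semiring.Exp k.semiring using (^-congˡ)
    open Algebra.Properties.Semiring.Sum R.semiring using (sum; sum-cong-≋; *-distribˡ-sum)
    private
      π^ : ℕ → R.Carrier
      π^ = pow R.commutativeRing R.πᴿ
      _^_ = pow R.commutativeRing
      ϖ = R.πᴿ

    -- An approximation of ∑ [αᵢ^(p⁻ⁱ)] πⁱ modulo πⁿ⁺¹.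
    ŵ : ℕ → (ℕ → k.Carrier) → R.Carrier
    ŵ n α = R.w n (λ i → lifting (root^ n (α i)))

    -- An approximation of [x] modulo πⁿ⁺¹.
    τ̂ : ℕ → k.Carrier → R.Carrier
    τ̂ n x = lifting (root^ n x) ^ (p ℕ.^ n)

    abstract
      w≡ŵ : ∀ n α s → (∀ i → i ≤ n → red (s i) k.≈ root^ n (α i)) → R.w n s R.≡ ŵ n α [mod π^ (suc n) ]
      w≡ŵ n α s e = R.w-mod-π n λ i i≤n → kernel (k.trans (e i i≤n) (k.sym (red-lift _)))

      ŵ-cong : ∀ n {α β} → (∀ i → i ≤ n → α i k.≈ β i) → ŵ n α R.≡ ŵ n β [mod π^ (suc n) ]
      ŵ-cong n {α} {β} e = w≡ŵ n β _ λ i i≤n → k.trans (red-lift _) (root^-cong n (e i i≤n))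

      -- The pⁿ-th root is a homomorphism of algebras from `k` to `k ⁽ n ⁾`. Hence the roots of the
      -- coordinates of the result are Q, with rooted coefficients, at the roots of α and β, which
      -- is what `opᵂ-ghost` asks for.
      ŵ-op : ∀ ⋆ n α β → ŵ n (opᵂ k ⋆ α β) R.≡ ⟪ ⋆ ⟫ R.commutativeRing (ŵ n α) (ŵ n β) [mod π^ (suc n) ]
      ŵ-op ⋆ n α β = opᵂ-ghost P ⋆ n (λ i → lifting (root^ n (α i))) (λ i → lifting (root^ n (β i))) (λ i → lifting (root^ n (opᵂ k ⋆ α β i))) λ i i≤n → k.trans (red-lift _) (k.trans (k.sym (fun-root^ n _))
        (k.trans (apply-natural {k = k} {k′ = k ⁽ n ⁾} (root^-AlgHom n) (Q ⋆) α β i)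
        (apply-cong (k ⁽ n ⁾) (Q ⋆) i (λ j _ → k.trans (fun-root^ n (α j)) (k.sym (red-lift _)))
                                      (λ j _ → k.trans (fun-root^ n (β j)) (k.sym (red-lift _))))))

      ŵ-compatible : ∀ n α → ŵ (suc n) α R.≡ ŵ n α [mod π^ (suc n) ]
      ŵ-compatible n α = R.mod-trans (R.w-init n _) (w≡ŵ n α _ λ i i≤n →
        k.trans (hom-^ R.commutativeRing k.commutativeRing red-hom _ p) (k.trans (^-congˡ p (red-lift _)) (root-^p _)))

      τ̂-mod : ∀ n {x y} → red x k.≈ root^ n y → x ^ (p ℕ.^ n) R.≡ τ̂ n y [mod π^ (suc n) ]
      τ̂-mod n {x} {y} e = R.mod-divisor (Algebra.Properties.Semiring.Exp.^-congʳ R.semiring ϖ (≡.cong suc (ℕ.+-identityʳ n)))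
        (R.mod-^p^ 0 n (R.mod⇒mod¹ (kernel (k.trans e (k.sym (red-lift _))))))

      τ̂-cong : ∀ n {x y} → x k.≈ y → τ̂ n x R.≡ τ̂ n y [mod π^ (suc n) ]
      τ̂-cong n e = τ̂-mod n (k.trans (red-lift _) (root^-cong n e))

      τ̂-* : ∀ n x y → τ̂ n (x k.* y) R.≡ τ̂ n x R.* τ̂ n y [mod π^ (suc n) ]
      τ̂-* n x y = R.mod-trans (R.mod-sym (τ̂-mod n (k.trans (red-* _ _) (k.trans (k.*-cong (red-lift _) (red-lift _))
          (k.trans (k.*-cong (k.sym (fun-root^ n x)) (k.sym (fun-root^ n y)))
          (k.trans (k.sym (AlgHom.*-homo (root^-AlgHom n) x y)) (fun-root^ n _)))))))
        (R.≈⇒mod (Algebra.Properties.CommutativeSemiring.Exp.^-distrib-* R.commutativeSemiring _ _ (p ℕ.^ n)))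

      τ̂-compatible : ∀ n x → τ̂ (suc n) x R.≡ τ̂ n x [mod π^ (suc n) ]
      τ̂-compatible n x = R.mod-trans (R.≈⇒mod (R.sym (Algebra.Properties.Semiring.Exp.^-assocʳ R.semiring (lifting (root^ (suc n) x)) p (p ℕ.^ n))))
        (τ̂-mod n (k.trans (hom-^ R.commutativeRing k.commutativeRing red-hom _ p) (k.trans (^-congˡ p (red-lift _)) (root-^p _))))

      red-τ̂ : ∀ n x → red (τ̂ n x) k.≈ x
      red-τ̂ n x = k.trans (hom-^ R.commutativeRing k.commutativeRing red-hom _ (p ℕ.^ n))
        (k.trans (^-congˡ (p ℕ.^ n) (red-lift _)) (root^-p^ n x))

      -- In the limit: Θ α = [α₀] + π Θ (α₁^(1/p), α₂^(1/p), ...). Moving coordinate i + 1 to place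
      -- i lowers the order of the root taken there by one, and the extra root compensates for this.
      ŵ-suc : ∀ n α → ŵ (suc n) α R.≡ τ̂ (suc n) (α 0) R.+ ϖ R.* ŵ n (root ∘ α ∘ suc) [mod π^ (suc (suc n)) ]
      ŵ-suc n α = R.mod-+-cong R.mod-refl (R.mod-scale ϖ (w≡ŵ n (root ∘ α ∘ suc) _
        λ i i≤n → k.trans (red-lift _) (root^-suc n _)))

      -- The coordinates of index 0 are read off modulo π. By `ŵ-suc` they can be removed and π
      -- cancelled; the p-th power then undoes the root in the tails.
      ŵ-injective : R.IsRegular ϖ → ∀ i {α β} → (∀ n → ŵ n α R.≡ ŵ n β [mod π^ (suc n) ]) → α i k.≈ β i
      ŵ-injective reg zero    {α} {β} e = k.trans (k.sym (red-lift (α 0))) (k.trans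
        (red-mod (R.mod¹⇒mod (e 0))) (red-lift (β 0)))
      ŵ-injective reg (suc i) {α} {β} e = k.trans (k.sym (root-^p _)) (k.trans (^-congˡ p
          (ŵ-injective reg i {root ∘ α ∘ suc} {root ∘ β ∘ suc} tails)) (root-^p _))
        where
        heads : α 0 k.≈ β 0
        heads = ŵ-injective reg 0 {α} {β} e
        tails : ∀ n → ŵ n (root ∘ α ∘ suc) R.≡ ŵ n (root ∘ β ∘ suc) [mod π^ (suc n) ]
        tails n = R.mod-unscale reg (R.+-cancelˡ-mod (τ̂-cong (suc n) heads)
          (R.mod-trans (R.mod-sym (ŵ-suc n α)) (R.mod-trans (e (suc n)) (ŵ-suc n β))))

      -- The element `y i` plays the role of [αᵢ^(p⁻ⁱ)]. It is compared with `τ̂ m` only for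
      -- `m ≤ N`, so that a component of an element of the completion, known to bounded precision,
      -- may take its place.
      sum≡ŵ : ∀ N n → n ≤ N → (y : ℕ → R.Carrier) (α : ℕ → k.Carrier) →
        (∀ i m → i ≤ n → m ≤ N → y i R.≡ τ̂ m (root^ i (α i)) [mod π^ (suc m) ]) →
        sum {suc n} (λ i → y (toℕ i) R.* π^ (toℕ i)) R.≡ ŵ n α [mod π^ (suc n) ]
      sum≡ŵ N zero    0≤N y α e = R.mod-trans (R.≈⇒mod (R.trans (R.+-identityʳ _) (R.*-identityʳ _)))
        (R.mod-trans (e 0 0 z≤n z≤n) (R.≈⇒mod (R.*-identityʳ _)))
      sum≡ŵ N (suc n) n≤N y α e = R.mod-trans (R.mod-+-cong
          (R.mod-trans (R.≈⇒mod (R.*-identityʳ _)) (e 0 (suc n) z≤n n≤N))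
          (R.mod-trans (R.≈⇒mod factor) (R.mod-scale ϖ (sum≡ŵ N n (ℕ.<⇒≤ n≤N) (y ∘ suc) (root ∘ α ∘ suc)
            λ i m i≤n m≤N → R.mod-trans (e (suc i) m (s≤s i≤n) m≤N) (τ̂-cong m (root^-suc i _))))))
        (R.mod-sym (ŵ-suc n α))
        where
        open Solver R.commutativeRing using (solve; _:=_) renaming (_:*_ to _⊛_)
        factor : sum {suc n} (λ i → y (suc (toℕ i)) R.* (ϖ R.* π^ (toℕ i))) R.≈ ϖ R.* sum {suc n} (λ i → y (suc (toℕ i)) R.* π^ (toℕ i))
        factor = R.trans (sum-cong-≋ {suc n} λ i → solve 3 (λ x y z → x ⊛ (y ⊛ z) := y ⊛ (x ⊛ z)) R.refl (y (suc (toℕ i))) ϖ (π^ (toℕ i)))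
          (R.sym (*-distribˡ-sum {suc n} ϖ (λ i → y (suc (toℕ i)) R.* π^ (toℕ i))))

      τ̂-≤ : ∀ m N → m ≤ N → ∀ x → τ̂ N x R.≡ τ̂ m x [mod π^ (suc m) ]
      τ̂-≤ m zero    z≤n x = R.mod-refl
      τ̂-≤ m (suc N) m≤N x with ℕ.m≤n⇒m<n∨m≡n m≤N
      ... | inj₁ (s≤s m≤N) = R.mod-trans (R.mod-≤ ϖ (suc m) (suc N) (s≤s m≤N) (τ̂-compatible N x)) (τ̂-≤ m N m≤N x)
      ... | inj₂ ≡.refl    = R.mod-refl

    τ-completed : k.Carrier → Completed R.commutativeRing ϖ
    τ-completed x = record { at = λ n → τ̂ n x ; compatible = λ n → R.mod-≤ ϖ n (suc n) (ℕ.n≤1+n n) (τ̂-compatible n x) }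

    abstract
      -- A multiplicative section satisfies s x = (s x^(p⁻ⁿ))^(pⁿ).
      section-unique : ∀ n (s : k.Carrier → R.Carrier) → (∀ x → red (s x) k.≈ x) →
        (∀ x → s x R.≡ s (root x) ^ p [mod π^ (suc n) ]) → ∀ x → s x R.≡ τ̂ n x [mod π^ (suc n) ]
      section-unique n s s-red s-root x = R.mod-trans (iterate n x) (τ̂-mod n (s-red _))
        where
        iterate : ∀ m x → s x R.≡ s (root^ m x) ^ (p ℕ.^ m) [mod π^ (suc n) ]
        iterate zero    x = R.≈⇒mod (R.sym (R.*-identityʳ _))
        iterate (suc m) x = R.mod-trans (iterate m x) (R.mod-trans
          (R.mod-^ (p ℕ.^ m) (s-root (root^ m x)))
          (R.≈⇒mod (Algebra.Properties.Semiring.Exp.^-assocʳ R.semiring _ p (p ℕ.^ m))))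

    module Complete
      (separated : ∀ {x y} → (∀ n → x R.≡ y [mod π^ n ]) → x R.≈ y)
      (limit     : (x : Completed R.commutativeRing ϖ) → Σ R.Carrier λ y → ∀ n → y R.≡ Completed.at x n [mod π^ n ])
      where

      abstract
        separated-suc : ∀ {x y} → (∀ n → x R.≡ y [mod π^ (suc n) ]) → x R.≈ y
        separated-suc e = separated λ { zero → R.mod-zero {ϖ} ; (suc n) → e n }

      abstract
        τ : k.Carrier → R.Carrier
        τ x = proj₁ (limit (τ-completed x))

        τ≡τ̂ : ∀ n x → τ x R.≡ τ̂ n x [mod π^ (suc n) ]
        τ≡τ̂ n x = R.mod-trans (proj₂ (limit (τ-completed x)) (suc n)) (τ̂-compatible n x)

        τ-cong : ∀ {x y} → x k.≈ y → τ x R.≈ τ y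
        τ-cong {x} {y} e = separated-suc λ n → R.mod-trans (τ≡τ̂ n x) (R.mod-trans (τ̂-cong n e) (R.mod-sym (τ≡τ̂ n y)))

        τ-* : ∀ x y → τ (x k.* y) R.≈ τ x R.* τ y
        τ-* x y = separated-suc λ n → R.mod-trans (τ≡τ̂ n _) (R.mod-trans (τ̂-* n x y)
          (R.mod-*-cong (R.mod-sym (τ≡τ̂ n x)) (R.mod-sym (τ≡τ̂ n y))))

        red-τ : ∀ x → red (τ x) k.≈ x
        red-τ x = k.trans (red-mod (R.mod¹⇒mod (τ≡τ̂ 0 x))) (red-τ̂ 0 x)

        digit : ∀ x → x R.≡ τ (red x) [mod ϖ ]
        digit x = kernel (k.sym (red-τ (red x)))

      -- From x = [x₀] + y π the remaining coordinates are those of `y`, raised to the p-th power to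
      -- undo the root in `ŵ-suc`.
      coordinates : R.Carrier → ℕ → k.Carrier
      coordinates x zero    = red x
      coordinates x (suc n) = pow k.commutativeRing (coordinates (R.quotient (digit x)) n) p

      abstract
        ŵ-coordinates : ∀ n x → ŵ n (coordinates x) R.≡ x [mod π^ (suc n) ]
        ŵ-coordinates zero    x = R.mod⇒mod¹ (kernel (red-lift _))
        ŵ-coordinates (suc n) x = R.mod-trans (ŵ-suc n (coordinates x)) (R.mod-trans
          (R.mod-+-cong (R.mod-sym (τ≡τ̂ (suc n) (red x)))
            (R.mod-scale ϖ (R.mod-trans (ŵ-cong n (λ i _ → ^p-root _)) (ŵ-coordinates n (R.quotient (digit x))))))
          (R.≈⇒mod (R.trans (R.+-congˡ (R.*-comm ϖ _)) (R.sym (R.mod-witness (digit x))))))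

      Θ-completed : (ℕ → k.Carrier) → Completed R.commutativeRing ϖ
      Θ-completed α = record { at = approximation ; compatible = compatible }
        where
        approximation : ℕ → R.Carrier
        -- `ŵ n` is correct modulo πⁿ⁺¹, whence the shift by one; modulo π⁰ any value will do.
        approximation zero    = R.0#
        approximation (suc n) = ŵ n α
        abstract
          compatible : ∀ n → approximation (suc n) R.≡ approximation n [mod π^ n ]
          compatible zero    = R.mod-zero {ϖ}
          compatible (suc n) = ŵ-compatible n α

      abstract
        Θ : (ℕ → k.Carrier) → R.Carrier
        Θ α = proj₁ (limit (Θ-completed α))

        Θ≡ŵ : ∀ n α → Θ α R.≡ ŵ n α [mod π^ (suc n) ]
        Θ≡ŵ n α = proj₂ (limit (Θ-completed α)) (suc n)

        Θ-unique : ∀ α x → (∀ n → x R.≡ ŵ n α [mod π^ (suc n) ]) → x R.≈ Θ α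
        Θ-unique α x e = separated-suc λ n → R.mod-trans (e n) (R.mod-sym (Θ≡ŵ n α))

        Θ-cong : ∀ {α β} → (∀ i → α i k.≈ β i) → Θ α R.≈ Θ β
        Θ-cong {α} {β} e = Θ-unique β (Θ α) λ n → R.mod-trans (Θ≡ŵ n α) (ŵ-cong n (λ i _ → e i))

        Θ-op : ∀ ⋆ α β → Θ (opᵂ k ⋆ α β) R.≈ ⟪ ⋆ ⟫ R.commutativeRing (Θ α) (Θ β)
        Θ-op ⋆ α β = R.sym (Θ-unique _ _ λ n → R.mod-trans (op-mod R.commutativeRing ⋆ (Θ≡ŵ n α) (Θ≡ŵ n β)) (R.mod-sym (ŵ-op ⋆ n α β)))

        Θ-coordinates : ∀ x → Θ (coordinates x) R.≈ x
        Θ-coordinates x = R.sym (Θ-unique _ x λ n → R.mod-sym (ŵ-coordinates n x))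

        red-Θ : ∀ α → red (Θ α) k.≈ α 0
        red-Θ α = k.trans (red-mod (R.mod¹⇒mod (Θ≡ŵ 0 α))) (red-lift _)

        Θ-injective : R.IsRegular ϖ → ∀ {α β} → Θ α R.≈ Θ β → ∀ i → α i k.≈ β i
        Θ-injective reg {α} {β} e i = ŵ-injective reg i {α} {β} λ n →
          R.mod-trans (R.mod-sym (Θ≡ŵ n α)) (R.mod-trans (R.≈⇒mod e) (Θ≡ŵ n β))

-- Identities between Witt vectors

module _ {A : Set a} (z : A) where

  infixr 5 _◃_
  _◃_ : A → (ℕ → A) → ℕ → A
  (x ◃ α) zero    = x
  (x ◃ α) (suc n) = α n

  firstOnly : A → ℕ → A
  firstOnly x = x ◃ λ _ → z

module Witt {p : ℕ} (pp : Prime p) (base : Base p) where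
  open OverBase pp base public
  open Perfect pp base public
  open Lazard p using (Op; add; mul; ⟪_⟫)

  module _ (R : Algebra L a) where
    open OverL R
    open Algebra.Properties.Semiring.Exp semiring using (_^_; ^-congʳ)

    zero-^p^ : ∀ n → 0# ^ (p ℕ.^ n) ≈ 0#
    zero-^p^ n = go (p ℕ.^ n) (ℕ.m^n≢0 p n {{prime⇒nonZero pp}})
      where
      go : ∀ m → ℕ.NonZero m → 0# ^ m ≈ 0#
      go (suc m) _ = zeroˡ _

    w-zero : ∀ n → w n (λ _ → 0#) ≈ 0#
    w-zero zero    = refl
    w-zero (suc n) = trans (+-cong (zero-^p^ (suc n)) (trans (*-congˡ (w-zero n)) (zeroʳ _))) (+-identityˡ 0#)

    w-first : ∀ n x → w n (firstOnly 0# x) ≈ x ^ (p ℕ.^ n)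
    w-first zero    x = sym (*-identityʳ x)
    w-first (suc n) x = trans (+-congˡ (trans (*-congˡ (w-zero n)) (zeroʳ _))) (+-identityʳ _)

    w-◃ : ∀ n x β → w n (_◃_ 0# x β) ≈ w n (firstOnly 0# x) + w n (_◃_ 0# 0# β)
    w-◃ zero    x β = sym (+-identityʳ x)
    w-◃ (suc n) x β = sym (+-cong (w-first (suc n) x) (trans (+-congʳ (zero-^p^ (suc n))) (+-identityˡ _)))

    -- The left side is π wₙ₋₁(βᵖ), and wₙ₋₁(βᵖ) agrees with wₙ(β) mod πⁿ by `w-init`. This is
    -- Verschiebung after Frobenius seen on ghost components, and the source of `π-shift`.
    w-shift : ∀ n β → w n (_◃_ 0# 0# (λ i → β i ^ p)) ≡ πᴿ * w n β [mod pow commutativeRing πᴿ (suc n) ]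
    w-shift zero    β = mod-sym (divides (β 0) (trans (*-congˡ (*-identityʳ _)) (trans (*-comm _ _) (sym (x-0 _)))))
      where
      x-0 : ∀ x → x - 0# ≈ x
      x-0 x = trans (+-congˡ (Algebra.Properties.Ring.-0#≈0# ring)) (+-identityʳ x)
    w-shift (suc n) β = mod-trans (≈⇒mod (trans (+-congʳ (zero-^p^ (suc n))) (+-identityˡ _)))
      (mod-scale πᴿ (mod-sym (w-init n β)))

  self : Algebra L 0ℓ
  self = record { commutativeRing = L ; ι = idʰ L }

  self₀ : Algebra L₀ 0ℓ
  self₀ = record { commutativeRing = L₀ ; ι = idʰ L₀ }

  basePair : Pair self self₀
  basePair = record
    { red-hom  = res
    ; red-ι    = λ _ → L₀.refl
    ; kernel   = res-kernel
    ; lifting  = lift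
    ; red-lift = res-lift
    }

  baseRoots : HasRoots self₀
  baseRoots = record
    { root      = ⟦ √ ⟧
    ; root-cong = RingHomomorphism.⟦⟧-cong √
    ; root-^p   = √-^p
    ; ^p-root   = λ x → L₀.trans (hom-^ L₀ L₀ √ x p) (√-^p x)
    }

  private
    module LL = OverL self
    module PL = PerfectPair basePair baseRoots
    module CL = PL.Complete separated limit
    module RL = HasRoots baseRoots

  coord : L.Carrier → ℕ → L₀.Carrier
  coord = CL.coordinates

  root^≡√^ : ∀ n x → RL.root^ n x ≡ ⟦ √^ n ⟧ x
  root^≡√^ zero    x = ≡.refl
  root^≡√^ (suc n) x = ≡.cong ⟦ √ ⟧ (root^≡√^ n x)

  abstract
    coord-unique : ∀ x (α : ℕ → L₀.Carrier) → (∀ n → PL.ŵ n α LL.≡ x [mod pow L π (suc n) ]) → ∀ i → α i L₀.≈ coord x i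
    coord-unique x α e i = PL.ŵ-injective π-regular i {α} {coord x} λ n → LL.mod-trans (e n) (LL.mod-sym (CL.ŵ-coordinates n x))

    coord-determined : ∀ x (α : ℕ → L₀.Carrier) (s : ℕ → ℕ → L.Carrier) →
      (∀ n i → i ≤ n → ⟦ res ⟧ (s n i) L₀.≈ RL.root^ n (α i)) →
      (∀ n → LL.w n (s n) LL.≡ x [mod pow L π (suc n) ]) → ∀ i → α i L₀.≈ coord x i
    coord-determined x α s s-res s-ghost = coord-unique x α λ n →
      LL.mod-trans (LL.mod-sym (PL.w≡ŵ n α (s n) (s-res n))) (s-ghost n)

    root^-0 : ∀ n → L₀.0# L₀.≈ RL.root^ n L₀.0#
    root^-0 n = L₀.sym (L₀.trans (L₀.reflexive (root^≡√^ n L₀.0#)) (RingHomomorphism.0#-homo (√^ n)))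

    root^-1 : ∀ n → L₀.1# L₀.≈ RL.root^ n L₀.1#
    root^-1 n = L₀.sym (L₀.trans (L₀.reflexive (root^≡√^ n L₀.1#)) (RingHomomorphism.1#-homo (√^ n)))

    -- An `x` with a pⁿ-th root above that of `z` for every n is the Teichmüller representative of
    -- `z`. The cases of interest are 0, 1 and the roots of the ωᵢ.
    coord-teichmüller : ∀ x (y : ℕ → L.Carrier) (z : L₀.Carrier) →
      (∀ n → ⟦ res ⟧ (y n) L₀.≈ RL.root^ n z) → (∀ n → pow L (y n) (p ℕ.^ n) L.≈ x) →
      ∀ i → firstOnly L₀.0# z i L₀.≈ coord x i
    coord-teichmüller x y z res-y y^≈x = coord-determined x (firstOnly L₀.0# z) (λ n → firstOnly L.0# (y n))
      (λ { n zero    _ → res-y n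
         ; n (suc i) _ → L₀.trans (RingHomomorphism.0#-homo res) (root^-0 n) })
      (λ n → LL.≈⇒mod (L.trans (w-first self n (y n)) (y^≈x n)))

    coord-0 : ∀ i → firstOnly L₀.0# L₀.0# i L₀.≈ coord L.0# i
    coord-0 = coord-teichmüller L.0# (λ _ → L.0#) L₀.0#
      (λ n → L₀.trans (RingHomomorphism.0#-homo res) (root^-0 n)) (zero-^p^ self)

    coord-1 : ∀ i → firstOnly L₀.0# L₀.1# i L₀.≈ coord L.1# i
    coord-1 = coord-teichmüller L.1# (λ _ → L.1#) L₀.1#
      (λ n → L₀.trans (RingHomomorphism.1#-homo res) (root^-1 n)) (λ n → RingTheory.one-^ L (p ℕ.^ n))

    coord-π : ∀ i → _◃_ L₀.0# L₀.0# (firstOnly L₀.0# L₀.1#) i L₀.≈ coord π i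
    coord-π = coord-determined π (_◃_ L₀.0# L₀.0# (firstOnly L₀.0# L₀.1#)) (λ _ → _◃_ L.0# L.0# (firstOnly L.0# L.1#))
      (λ { n zero          _ → L₀.trans (RingHomomorphism.0#-homo res) (root^-0 n)
         ; n (suc zero)    _ → L₀.trans (RingHomomorphism.1#-homo res) (root^-1 n)
         ; n (suc (suc i)) _ → L₀.trans (RingHomomorphism.0#-homo res) (root^-0 n) })
      (λ { zero    → LL.mod-sym (LL.divides L.1# (L.trans (L.*-identityˡ _) (L.trans (L.*-identityʳ π) (L.sym (x-0 π)))))
         ; (suc n) → LL.≈⇒mod (L.trans (L.+-cong (zero-^p^ self (suc n))
             (L.*-congˡ (L.trans (w-first self n L.1#) (RingTheory.one-^ L (p ℕ.^ n))))) (L.trans (L.+-identityˡ _) (L.*-identityʳ π))) })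
      where
      x-0 : ∀ x → x L.- L.0# L.≈ x
      x-0 x = L.trans (L.+-congˡ (Algebra.Properties.Ring.-0#≈0# L.ring)) (L.+-identityʳ x)

  module _ {R : Algebra L a} {k : Algebra L₀ b} (P : Pair R k) where
    private
      module R = OverL R
      module k = Algebra k
    open Pair P

    abstract
      -- Over the base ring, lifts of the pⁿ-th roots of the coordinates of `x` have n-th ghost
      -- component `x` mod πⁿ⁺¹, by `ŵ-coordinates`; the structure map carries this to `R`. Without
      -- the roots the scalars would not have themselves as ghost components.
      const-ghost : ∀ x n s → (∀ i → i ≤ n → red (s i) k.≈ ⟦ k.ι ⟧ (⟦ √^ n ⟧ (coord x i))) →
                    R.w n s R.≡ ⟦ R.ι ⟧ x [mod pow R.commutativeRing R.πᴿ (suc n) ]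
      const-ghost x n s e = R.mod-trans (R.w-mod-π n λ i i≤n → kernel (k.trans (e i i≤n)
          (k.sym (k.trans (red-ι _) (RingHomomorphism.⟦⟧-cong k.ι (L₀.trans (res-lift _) (L₀.reflexive (root^≡√^ n (coord x i)))))))))
        (R.mod-trans (R.≈⇒mod (R.sym (hom-ghost L R.commutativeRing R.ι p π n (λ i → lift (RL.root^ n (coord x i))))))
        (R.mod-divisor (hom-^ L R.commutativeRing R.ι π (suc n)) (hom-mod L R.commutativeRing R.ι (CL.ŵ-coordinates n x))))

  -- An operation on families of Witt vectors is given for algebras of every universe level, because
  -- an identity over `k` is tested on a polynomial ring over L₀, which lives at the lowest level.
  SequenceOp : Setω
  SequenceOp = ∀ {b} (k : Algebra L₀ b) → (ℕ → ℕ → Algebra.Carrier k) → ℕ → Algebra.Carrier k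

  Natural : SequenceOp → Setω
  Natural F = ∀ {b c} {k : Algebra L₀ b} {k′ : Algebra L₀ c} (f : AlgHom k k′) α n →
    Algebra._≈_ k′ (fun f (F k α n)) (F k′ (λ v → fun f ∘ α v) n)

  module _ {R : Algebra L a} {k : Algebra L₀ b} (P : Pair R k) where
    private
      module R = OverL R
      module k = Algebra k
    open Pair P

    Lifts : SequenceOp → ℕ → (ℕ → ℕ → R.Carrier) → (ℕ → R.Carrier) → Set b
    Lifts F n x s = ∀ i → i ≤ n → red (s i) k.≈ F (k ⁽ n ⁾) (λ v → red ∘ x v) i

  private
    G = ℕ × ℕ
    Rᵍ : Algebra L 0ℓ
    Rᵍ = Polynomial L G
    kᵍ : Algebra L₀ 0ℓ
    kᵍ = Polynomial L₀ G
    module Rᵍ = OverL Rᵍ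
    module kᵍ = Algebra kᵍ
    Pᵍ : Pair Rᵍ kᵍ
    Pᵍ = polynomialPair G
    module Pᵍ = Pair Pᵍ
    x : ℕ → ℕ → Rᵍ.Carrier
    x v i = gen (v , i)

  -- Over the generic pair alone: every k receives a map from a twist kᵍ ⁽ n ⁾ hitting given sequences.
  SameGhosts : SequenceOp → SequenceOp → Set
  SameGhosts F F′ = ∀ n s s′ → Lifts Pᵍ F n x s → Lifts Pᵍ F′ n x s′ →
    Rᵍ.w n s Rᵍ.≡ Rᵍ.w n s′ [mod pow Rᵍ.commutativeRing Rᵍ.πᴿ (suc n) ]

  module _ (F F′ : SequenceOp) (F-natural : Natural F) (F′-natural : Natural F′) (ghosts : SameGhosts F F′) where

    private
      -- Induction on the coordinate, for all algebras at once. At coordinate n the operations are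
      -- compared on `kᵍ ⁽ n ⁾`: the earlier coordinates agree there by induction and the ghost
      -- components agree by hypothesis, so `w-determines` settles the n-th one. Naturality along
      -- `ψ` transports the result to `k`.
      below : ∀ n {b} (k : Algebra L₀ b) α i → i < n → Algebra._≈_ k (F k α i) (F′ k α i)
      below (suc n) k α i (s≤s i≤n) with ℕ.m≤n⇒m<n∨m≡n i≤n
      ... | inj₁ i<n    = below n k α i i<n
      ... | inj₂ ≡.refl = k.trans (k.sym (F-natural ψ (λ v → Pᵍ.red ∘ x v) n))
          (k.trans (AlgHom.cong ψ {F (kᵍ ⁽ n ⁾) (λ v → Pᵍ.red ∘ x v) n} {F′ (kᵍ ⁽ n ⁾) (λ v → Pᵍ.red ∘ x v) n} generic)
          (F′-natural ψ (λ v → Pᵍ.red ∘ x v) n))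
        where
        module k = Algebra k
        value : G → k.Carrier
        value (v , i) = α v i
        -- The pⁿ-th powers applied to coefficients here cancel the pⁿ-th roots through which
        -- scalars act on `kᵍ ⁽ n ⁾`, so that `ψ` is linear over L₀.
        module ev = AlgHom (evaluation L₀ {G} (restrictScalars (frobenius^ n) k) value)
        ψ : AlgHom (kᵍ ⁽ n ⁾) k
        ψ = record { hom = ev.hom ; commutes = λ y → RingHomomorphism.⟦⟧-cong k.ι (frobenius^-√^ n y) }
        s s′ : ℕ → Rᵍ.Carrier
        s i  = Pᵍ.lifting (F (kᵍ ⁽ n ⁾) (λ v → Pᵍ.red ∘ x v) i)
        s′ i = Pᵍ.lifting (F′ (kᵍ ⁽ n ⁾) (λ v → Pᵍ.red ∘ x v) i)
        generic : F (kᵍ ⁽ n ⁾) (λ v → Pᵍ.red ∘ x v) n kᵍ.≈ F′ (kᵍ ⁽ n ⁾) (λ v → Pᵍ.red ∘ x v) n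
        generic = kᵍ.trans (kᵍ.sym (Pᵍ.red-lift _)) (kᵍ.trans (Pᵍ.red-mod (Rᵍ.w-determines
            (PolynomialCoefficients.con-regular L (≡-dec ℕ._≟_ ℕ._≟_) π-regular) n {s} {s′}
            (λ j j<n → Pᵍ.kernel (kᵍ.trans (Pᵍ.red-lift _) (kᵍ.trans (below n (kᵍ ⁽ n ⁾) (λ v → Pᵍ.red ∘ x v) j j<n) (kᵍ.sym (Pᵍ.red-lift _)))))
            (ghosts n s s′ (λ _ _ → Pᵍ.red-lift _) (λ _ _ → Pᵍ.red-lift _)))) (Pᵍ.red-lift _))

    sequenceOps-agree : (k : Algebra L₀ b) → ∀ α n → Algebra._≈_ k (F k α n) (F′ k α n)
    sequenceOps-agree k α n = below (suc n) k α n ℕ.≤-refl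

  evalᵂ : Term L.Carrier ℕ → SequenceOp
  evalᵂ (con c)  k α = ⟦ Algebra.ι k ⟧ ∘ coord c
  evalᵂ (gen v)  k α = α v
  evalᵂ (t :+ u) k α = opᵂ k add (evalᵂ t k α) (evalᵂ u k α)
  evalᵂ (t :* u) k α = opᵂ k mul (evalᵂ t k α) (evalᵂ u k α)
  -- The Qₙ provide only sums and products, so negation is multiplication by the image of -1.
  evalᵂ (:- t)   k α = opᵂ k mul (⟦ Algebra.ι k ⟧ ∘ coord (L.- L.1#)) (evalᵂ t k α)

  evalᵂ-natural : ∀ t → Natural (evalᵂ t)
  evalᵂ-natural (con c) f α n = AlgHom.commutes f (coord c n)
  evalᵂ-natural (gen v) {k′ = k′} f α n = Algebra.refl k′
  evalᵂ-natural (t :+ u) {k = k} {k′} f α n = Algebra.trans k′ (apply-natural {k = k} {k′ = k′} f (Q add) (evalᵂ t k α) (evalᵂ u k α) n)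
    (apply-cong k′ (Q add) {fun f ∘ evalᵂ t k α} {evalᵂ t k′ (λ v → fun f ∘ α v)} {fun f ∘ evalᵂ u k α} {evalᵂ u k′ (λ v → fun f ∘ α v)} n (λ j _ → evalᵂ-natural t f α j) (λ j _ → evalᵂ-natural u f α j))
  evalᵂ-natural (t :* u) {k = k} {k′} f α n = Algebra.trans k′ (apply-natural {k = k} {k′ = k′} f (Q mul) (evalᵂ t k α) (evalᵂ u k α) n)
    (apply-cong k′ (Q mul) {fun f ∘ evalᵂ t k α} {evalᵂ t k′ (λ v → fun f ∘ α v)} {fun f ∘ evalᵂ u k α} {evalᵂ u k′ (λ v → fun f ∘ α v)} n (λ j _ → evalᵂ-natural t f α j) (λ j _ → evalᵂ-natural u f α j))
  evalᵂ-natural (:- t) {k = k} {k′} f α n = Algebra.trans k′ (apply-natural {k = k} {k′ = k′} f (Q mul) (⟦ Algebra.ι k ⟧ ∘ coord (L.- L.1#)) (evalᵂ t k α) n)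
    (apply-cong k′ (Q mul) {fun f ∘ ⟦ Algebra.ι k ⟧ ∘ coord (L.- L.1#)} {⟦ Algebra.ι k′ ⟧ ∘ coord (L.- L.1#)} {fun f ∘ evalᵂ t k α} {evalᵂ t k′ (λ v → fun f ∘ α v)} n (λ j _ → AlgHom.commutes f (coord (L.- L.1#) j)) (λ j _ → evalᵂ-natural t f α j))

  module _ {R : Algebra L a} {k : Algebra L₀ b} (P : Pair R k) (n : ℕ) where
    private
      module R = OverL R
      module k = Algebra k
      _≃_ : R.Carrier → R.Carrier → Set a
      y ≃ z = y R.≡ z [mod pow R.commutativeRing R.πᴿ (suc n) ]
    open Pair P

    abstract
      op-ghost : ∀ ⋆ (α β : ℕ → k.Carrier) {y z} →
        (∀ s → (∀ i → i ≤ n → red (s i) k.≈ α i) → R.w n s ≃ y) →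
        (∀ s → (∀ i → i ≤ n → red (s i) k.≈ β i) → R.w n s ≃ z) →
        ∀ s → (∀ i → i ≤ n → red (s i) k.≈ opᵂ (k ⁽ n ⁾) ⋆ α β i) → R.w n s ≃ ⟪ ⋆ ⟫ R.commutativeRing y z
      op-ghost ⋆ α β gα gβ s e = R.mod-trans
        (opᵂ-ghost P ⋆ n (lifting ∘ α) (lifting ∘ β) s λ i i≤n → k.trans (e i i≤n)
          (apply-cong (k ⁽ n ⁾) (Q ⋆) i (λ j _ → k.sym (red-lift (α j))) (λ j _ → k.sym (red-lift (β j)))))
        (op-mod R.commutativeRing ⋆ (gα (lifting ∘ α) (λ i _ → red-lift (α i))) (gβ (lifting ∘ β) (λ i _ → red-lift (β i))))

      evalᵂ-ghost : ∀ t (x : ℕ → ℕ → R.Carrier) s → Lifts P (evalᵂ t) n x s → R.w n s ≃ eval R (λ v → R.w n (x v)) t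
      evalᵂ-ghost (con c)  x s e = const-ghost P c n s e
      evalᵂ-ghost (gen v)  x s e = R.w-mod-π n λ i i≤n → kernel (e i i≤n)
      evalᵂ-ghost (t :+ u) x s e = op-ghost add (evalᵂ t (k ⁽ n ⁾) (λ v → red ∘ x v)) (evalᵂ u (k ⁽ n ⁾) (λ v → red ∘ x v))
        (evalᵂ-ghost t x) (evalᵂ-ghost u x) s e
      evalᵂ-ghost (t :* u) x s e = op-ghost mul (evalᵂ t (k ⁽ n ⁾) (λ v → red ∘ x v)) (evalᵂ u (k ⁽ n ⁾) (λ v → red ∘ x v))
        (evalᵂ-ghost t x) (evalᵂ-ghost u x) s e
      evalᵂ-ghost (:- t)   x s e = R.mod-trans
        (op-ghost mul (⟦ Algebra.ι (k ⁽ n ⁾) ⟧ ∘ coord (L.- L.1#)) (evalᵂ t (k ⁽ n ⁾) (λ v → red ∘ x v))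
          (const-ghost P (L.- L.1#) n) (evalᵂ-ghost t x) s e)
        (R.≈⇒mod (R.trans (R.*-congʳ (R.trans (RingHomomorphism.-‿homo R.ι L.1#) (R.-‿cong (RingHomomorphism.1#-homo R.ι))))
          (Algebra.Properties.Ring.-1*x≈-x R.ring _)))

  abstract
    -- The ghost component of a Witt vector expression is the ordinary value of that expression at
    -- the ghost components of its arguments. Each law of a polynomial ring over L thus becomes a
    -- law of Witt vectors, the laws on constants included; those make `ιᵂ` a homomorphism.
    identityᵂ : ∀ {t u} → Algebra._≈_ (Polynomial L ℕ) t u → (k : Algebra L₀ b) → ∀ α n →
                Algebra._≈_ k (evalᵂ t k α n) (evalᵂ u k α n)
    identityᵂ {t = t} {u} t≈u k α n = sequenceOps-agree (evalᵂ t) (evalᵂ u) (evalᵂ-natural t) (evalᵂ-natural u)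
      (λ n s s′ e e′ → Rᵍ.mod-trans (evalᵂ-ghost Pᵍ n t x s e) (Rᵍ.mod-trans
        (Rᵍ.≈⇒mod (AlgHom.cong (evaluation L Rᵍ (λ v → Rᵍ.w n (x v))) {t} {u} t≈u)) (Rᵍ.mod-sym (evalᵂ-ghost Pᵍ n u x s′ e′))))
      k α n

  shiftOp : SequenceOp
  shiftOp k α = _◃_ (Algebra.0# k) (Algebra.0# k) λ i → pow (Algebra.commutativeRing k) (α 0 i) p

  splitOp : SequenceOp
  splitOp k α = opᵂ k add (firstOnly 0# (α 0 0)) (_◃_ 0# 0# (α 0 ∘ suc))
    where open Algebra k

  firstProduct firstsProduct : SequenceOp
  firstProduct k α = firstOnly 0# (α 0 0 * α 1 0)
    where open Algebra k
  firstsProduct k α = opᵂ k mul (firstOnly 0# (α 0 0)) (firstOnly 0# (α 1 0))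
    where open Algebra k

  module _ {k : Algebra L₀ b} {k′ : Algebra L₀ c} (f : AlgHom k k′) where
    private
      module k = Algebra k
      module k′ = Algebra k′
      module f = AlgHom f

    firstOnly-natural : ∀ x n → f.fun (firstOnly k.0# x n) k′.≈ firstOnly k′.0# (f.fun x) n
    firstOnly-natural x zero    = k′.refl
    firstOnly-natural x (suc n) = f.0#-homo

  shiftOp-natural : Natural shiftOp
  shiftOp-natural f α zero = AlgHom.0#-homo f
  shiftOp-natural {k = k} {k′} f α (suc n) = hom-^ (Algebra.commutativeRing k) (Algebra.commutativeRing k′) (AlgHom.hom f) (α 0 n) p

  splitOp-natural : Natural splitOp
  splitOp-natural {k = k} {k′} f α n = k′.trans (apply-natural {k = k} {k′ = k′} f (Q add) (firstOnly k.0# (α 0 0)) (_◃_ k.0# k.0# (α 0 ∘ suc)) n)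
    (apply-cong k′ (Q add) {fun f ∘ firstOnly k.0# (α 0 0)} {firstOnly k′.0# (fun f (α 0 0))} {fun f ∘ _◃_ k.0# k.0# (α 0 ∘ suc)} {_◃_ k′.0# k′.0# (fun f ∘ α 0 ∘ suc)} n
      (λ j _ → firstOnly-natural f (α 0 0) j) (λ { zero _ → AlgHom.0#-homo f ; (suc j) _ → k′.refl }))
    where
    module k = Algebra k
    module k′ = Algebra k′

  firstProduct-natural : Natural firstProduct
  firstProduct-natural f α zero    = AlgHom.*-homo f _ _
  firstProduct-natural f α (suc n) = AlgHom.0#-homo f

  firstsProduct-natural : Natural firstsProduct
  firstsProduct-natural {k = k} {k′} f α n = k′.trans (apply-natural {k = k} {k′ = k′} f (Q mul) (firstOnly k.0# (α 0 0)) (firstOnly k.0# (α 1 0)) n)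
    (apply-cong k′ (Q mul) {fun f ∘ firstOnly k.0# (α 0 0)} {firstOnly k′.0# (fun f (α 0 0))} {fun f ∘ firstOnly k.0# (α 1 0)} {firstOnly k′.0# (fun f (α 1 0))} n
      (λ j _ → firstOnly-natural f (α 0 0) j) (λ j _ → firstOnly-natural f (α 1 0) j))
    where
    module k = Algebra k
    module k′ = Algebra k′

  private
    w-lift : ∀ n {s t} → (∀ i → i ≤ n → Pᵍ.red (s i) kᵍ.≈ Pᵍ.red (t i)) → Rᵍ.w n s Rᵍ.≡ Rᵍ.w n t [mod pow Rᵍ.commutativeRing Rᵍ.πᴿ (suc n) ]
    w-lift n e = Rᵍ.w-mod-π n λ i i≤n → Pᵍ.kernel (e i i≤n)

  abstract
    π-shift : (k : Algebra L₀ b) → ∀ α n → Algebra._≈_ k (opᵂ k mul (⟦ Algebra.ι k ⟧ ∘ coord π) α n)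
                                                       (_◃_ (Algebra.0# k) (Algebra.0# k) (λ i → pow (Algebra.commutativeRing k) (α i) p) n)
    π-shift k α = sequenceOps-agree (evalᵂ (con π :* gen 0)) shiftOp (evalᵂ-natural (con π :* gen 0)) shiftOp-natural
      (λ n s s′ e e′ → Rᵍ.mod-trans (evalᵂ-ghost Pᵍ n (con π :* gen 0) x s e) (Rᵍ.mod-trans
        (Rᵍ.mod-sym (w-shift Rᵍ n (x 0)))
        (w-lift n {_◃_ Rᵍ.0# Rᵍ.0# (λ i → pow Rᵍ.commutativeRing (x 0 i) p)} {s′} (lifts {n} {s′} e′))))
      k (λ _ → α)
      where
      lifts : ∀ {n s′} → Lifts Pᵍ shiftOp n x s′ → ∀ i → i ≤ n → Pᵍ.red (_◃_ Rᵍ.0# Rᵍ.0# (λ i → pow Rᵍ.commutativeRing (x 0 i) p) i) kᵍ.≈ Pᵍ.red (s′ i)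
      lifts {n} {s′} e′ zero    i≤n = kᵍ.trans Pᵍ.red-0 (kᵍ.sym (e′ zero i≤n))
      lifts {n} {s′} e′ (suc i) i≤n = kᵍ.trans (hom-^ Rᵍ.commutativeRing kᵍ.commutativeRing Pᵍ.red-hom (x 0 i) p) (kᵍ.sym (e′ (suc i) i≤n))

    -- Ghost components are additive for sequences with disjoint supports, by `w-◃`.
    first+rest : (k : Algebra L₀ b) → ∀ α n → Algebra._≈_ k (α n)
      (opᵂ k add (firstOnly (Algebra.0# k) (α 0)) (_◃_ (Algebra.0# k) (Algebra.0# k) (α ∘ suc)) n)
    first+rest k α = sequenceOps-agree (evalᵂ (gen 0)) splitOp (evalᵂ-natural (gen 0)) splitOp-natural
      (λ n s s′ e e′ → Rᵍ.mod-trans (evalᵂ-ghost Pᵍ n (gen 0) x s e) (Rᵍ.mod-trans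
        (Rᵍ.≈⇒mod (Rᵍ.trans (Rᵍ.w-cong n {x 0} {_◃_ Rᵍ.0# (x 0 0) (x 0 ∘ suc)} (λ { zero _ → Rᵍ.refl ; (suc i) _ → Rᵍ.refl })) (w-◃ Rᵍ n (x 0 0) (x 0 ∘ suc))))
        (Rᵍ.mod-sym (opᵂ-ghost Pᵍ add n (firstOnly Rᵍ.0# (x 0 0)) (_◃_ Rᵍ.0# Rᵍ.0# (x 0 ∘ suc)) s′ λ i i≤n → kᵍ.trans (e′ i i≤n)
          (apply-cong (kᵍ ⁽ n ⁾) (Q add) {firstOnly kᵍ.0# (Pᵍ.red (x 0 0))} {Pᵍ.red ∘ firstOnly Rᵍ.0# (x 0 0)} {_◃_ kᵍ.0# kᵍ.0# (Pᵍ.red ∘ x 0 ∘ suc)} {Pᵍ.red ∘ _◃_ Rᵍ.0# Rᵍ.0# (x 0 ∘ suc)} i (λ { zero _ → kᵍ.refl ; (suc j) _ → kᵍ.sym Pᵍ.red-0 }) (λ { zero _ → kᵍ.sym Pᵍ.red-0 ; (suc j) _ → kᵍ.refl }))))))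
      k (λ _ → α)

    first-* : (k : Algebra L₀ b) → ∀ y z n → Algebra._≈_ k (firstOnly (Algebra.0# k) (Algebra._*_ k y z) n)
      (opᵂ k mul (firstOnly (Algebra.0# k) y) (firstOnly (Algebra.0# k) z) n)
    first-* k y z = sequenceOps-agree firstProduct firstsProduct firstProduct-natural firstsProduct-natural
      (λ n s s′ e e′ → Rᵍ.mod-trans (w-lift n {s} {firstOnly Rᵍ.0# (x 0 0 Rᵍ.* x 1 0)} (λ { zero i≤n → e zero i≤n ; (suc i) i≤n → kᵍ.trans (e (suc i) i≤n) (kᵍ.sym Pᵍ.red-0) }))
        (Rᵍ.mod-trans (Rᵍ.≈⇒mod (Rᵍ.trans (w-first Rᵍ n _) (Rᵍ.trans
            (Algebra.Properties.CommutativeSemiring.Exp.^-distrib-* Rᵍ.commutativeSemiring (x 0 0) (x 1 0) (p ℕ.^ n))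
            (Rᵍ.sym (Rᵍ.*-cong (w-first Rᵍ n (x 0 0)) (w-first Rᵍ n (x 1 0)))))))
        (Rᵍ.mod-sym (opᵂ-ghost Pᵍ mul n (firstOnly Rᵍ.0# (x 0 0)) (firstOnly Rᵍ.0# (x 1 0)) s′ λ i i≤n → kᵍ.trans (e′ i i≤n)
          (apply-cong (kᵍ ⁽ n ⁾) (Q mul) {firstOnly kᵍ.0# (Pᵍ.red (x 0 0))} {Pᵍ.red ∘ firstOnly Rᵍ.0# (x 0 0)} {firstOnly kᵍ.0# (Pᵍ.red (x 1 0))} {Pᵍ.red ∘ firstOnly Rᵍ.0# (x 1 0)} i (λ { zero _ → kᵍ.refl ; (suc j) _ → kᵍ.sym Pᵍ.red-0 }) (λ { zero _ → kᵍ.refl ; (suc j) _ → kᵍ.sym Pᵍ.red-0 }))))))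
      k (λ { 0 _ → y ; _ _ → z })

  module _ (k : Algebra L₀ b) where
    open Algebra k

    infix 4 _≈ᵂ_
    _≈ᵂ_ : (ℕ → Carrier) → (ℕ → Carrier) → Set b
    α ≈ᵂ β = ∀ n → α n ≈ β n

    ιᵂ : L.Carrier → ℕ → Carrier
    ιᵂ y = ⟦ ι ⟧ ∘ coord y

    negᵂ : (ℕ → Carrier) → ℕ → Carrier
    negᵂ = opᵂ k mul (ιᵂ (L.- L.1#))

    opᵂ-cong : ∀ ⋆ {α α′ β β′} → α ≈ᵂ α′ → β ≈ᵂ β′ → opᵂ k ⋆ α β ≈ᵂ opᵂ k ⋆ α′ β′
    opᵂ-cong ⋆ e e′ n = apply-cong k (Q ⋆) n (λ j _ → e j) (λ j _ → e′ j)

    -- Zero and one are parameters because `WittStructure` names them by a function of its own,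
    -- which agrees with `firstOnly` coordinate by coordinate.
    module _ (0ᵂ 1ᵂ : ℕ → Carrier) (0ᵂ-eq : 0ᵂ ≈ᵂ firstOnly 0# 0#) (1ᵂ-eq : 1ᵂ ≈ᵂ firstOnly 0# 1#) where
      private
        three : (α β γ : ℕ → Carrier) → ℕ → ℕ → Carrier
        three α β γ 0 = α
        three α β γ 1 = β
        three α β γ _ = γ

        firstOnly-ι : ∀ y n → firstOnly 0# (⟦ ι ⟧ y) n ≈ ⟦ ι ⟧ (firstOnly L₀.0# y n)
        firstOnly-ι y zero    = refl
        firstOnly-ι y (suc n) = sym (RingHomomorphism.0#-homo ι)

      abstract
        ιᵂ-0 : 0ᵂ ≈ᵂ ιᵂ L.0#
        ιᵂ-0 n = trans (0ᵂ-eq n) (trans (zeros n) (trans (firstOnly-ι L₀.0# n) (RingHomomorphism.⟦⟧-cong ι (coord-0 n))))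
          where
          zeros : ∀ n → firstOnly 0# 0# n ≈ firstOnly 0# (⟦ ι ⟧ L₀.0#) n
          zeros zero    = sym (RingHomomorphism.0#-homo ι)
          zeros (suc n) = refl

        ιᵂ-1 : 1ᵂ ≈ᵂ ιᵂ L.1#
        ιᵂ-1 n = trans (1ᵂ-eq n) (trans (ones n) (trans (firstOnly-ι L₀.1# n) (RingHomomorphism.⟦⟧-cong ι (coord-1 n))))
          where
          ones : ∀ n → firstOnly 0# 1# n ≈ firstOnly 0# (⟦ ι ⟧ L₀.1#) n
          ones zero    = sym (RingHomomorphism.1#-homo ι)
          ones (suc n) = refl

        isCommutativeRingᵂ : IsCommutativeRing _≈ᵂ_ (opᵂ k add) (opᵂ k mul) negᵂ 0ᵂ 1ᵂ
        isCommutativeRingᵂ = IsCommutativeRingˡ.isCommutativeRing (record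
          { isEquivalence = record { refl = λ _ → refl ; sym = λ e n → sym (e n) ; trans = λ e e′ n → trans (e n) (e′ n) }
          ; +-cong        = opᵂ-cong add
          ; +-assoc       = λ α β γ → identityᵂ (Equal.+-assoc (gen 0) (gen 1) (gen 2)) k (three α β γ)
          ; +-comm        = λ α β → identityᵂ (Equal.+-comm (gen 0) (gen 1)) k (three α β β)
          ; +-identityˡ   = λ α n → trans (opᵂ-cong add {β = α} ιᵂ-0 (λ _ → refl) n) (identityᵂ (Equal.+-identityˡ (gen 0)) k (three α α α) n)
          ; -‿cong        = λ e → opᵂ-cong mul {α = ιᵂ (L.- L.1#)} (λ _ → refl) e
          ; -‿inverseˡ    = λ α n → trans (identityᵂ (Equal.-‿inverseˡ (gen 0)) k (three α α α) n) (sym (ιᵂ-0 n))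
          ; *-cong        = opᵂ-cong mul
          ; *-assoc       = λ α β γ → identityᵂ (Equal.*-assoc (gen 0) (gen 1) (gen 2)) k (three α β γ)
          ; *-comm        = λ α β → identityᵂ (Equal.*-comm (gen 0) (gen 1)) k (three α β β)
          ; *-identityˡ   = λ α n → trans (opᵂ-cong mul {β = α} ιᵂ-1 (λ _ → refl) n) (identityᵂ (Equal.*-identityˡ (gen 0)) k (three α α α) n)
          ; distribˡ      = λ α β γ → identityᵂ (Equal.distribˡ (gen 0) (gen 1) (gen 2)) k (three α β γ)
          })

        ιᵂ-cong : ∀ {y z} → y L.≈ z → ιᵂ y ≈ᵂ ιᵂ z
        ιᵂ-cong y≈z = identityᵂ (Equal.con-cong y≈z) k (λ _ → 0ᵂ)

        ιᵂ-+ : ∀ y z → ιᵂ (y L.+ z) ≈ᵂ opᵂ k add (ιᵂ y) (ιᵂ z)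
        ιᵂ-+ y z = identityᵂ (Equal.con-+ y z) k (λ _ → 0ᵂ)

        ιᵂ-* : ∀ y z → ιᵂ (y L.* z) ≈ᵂ opᵂ k mul (ιᵂ y) (ιᵂ z)
        ιᵂ-* y z = identityᵂ (Equal.con-* y z) k (λ _ → 0ᵂ)

-- Teichmüller expansions and the defining equations of the Qₙ

module Arithmetic {p : ℕ} (pp : Prime p) (base : Base p) where
  open Witt pp base public
  open Lazard p using (Op; add; mul; ⟪_⟫; IsMultiplicativeSection; Teichmüller; IsRoots; Roots; root; _[_^1/p^∞]; eval-:^)

  module _ {R S : CommutativeRing 0ℓ 0ℓ} {red : R ⟶ S} {τ : ∣ S ∣ → ∣ R ∣} (isSection : IsMultiplicativeSection R S red τ) where
    private
      module R = CommutativeRing R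
      module S = CommutativeRing S
    open IsMultiplicativeSection isSection

    section-^p : ∀ x → τ (pow S x p) R.≈ pow R (τ x) p
    section-^p x = go p (prime⇒nonZero pp)
      where
      -- The induction starts at exponent one, as a multiplicative section is not assumed to
      -- preserve 1.
      go : ∀ n → ℕ.NonZero n → τ (pow S x n) R.≈ pow R (τ x) n
      go (suc zero)    _ = R.trans (cong (S.*-identityʳ x)) (R.sym (R.*-identityʳ _))
      go (suc (suc n)) _ = R.trans (*-homo x _) (R.*-congˡ (go (suc n) _))

  private
    module LL = OverL self
    module PL = PerfectPair basePair baseRoots
    module CL = PL.Complete separated limit
    module RL = HasRoots baseRoots
    open Algebra.Properties.Semiring.Sum L.semiring using (sum)

  teichmüllerᴸ : Teichmüller L L₀ res
  teichmüllerᴸ = record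
    { τ         = CL.τ
    ; isSection = record { cong = CL.τ-cong ; *-homo = CL.τ-* ; section = CL.red-τ }
    ; unique    = λ {τ′} isSection x → CL.separated-suc λ n → LL.mod-trans
        (PL.section-unique n τ′ (IsMultiplicativeSection.section isSection)
          (λ y → LL.≈⇒mod (L.trans (IsMultiplicativeSection.cong isSection (L₀.sym (√-^p y))) (section-^p isSection (⟦ √ ⟧ y)))) x)
        (LL.mod-sym (CL.τ≡τ̂ n x))
    }

  IsExpansionᴸ : L.Carrier → (ℕ → L₀.Carrier) → Set
  IsExpansionᴸ x α = ∃[ r ] IsRoots L₀ α r ×
    (∀ n → x LL.≡ sum {n} (λ i → CL.τ (r (toℕ i)) L.* pow L π (toℕ i)) [mod pow L π n ])

  private
    abstract
      sum≡ŵᴸ : ∀ α r → IsRoots L₀ α r → ∀ n → sum {suc n} (λ i → CL.τ (r (toℕ i)) L.* pow L π (toℕ i)) LL.≡ PL.ŵ n α [mod pow L π (suc n) ]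
      sum≡ŵᴸ α r roots n = PL.sum≡ŵ n n ℕ.≤-refl (CL.τ ∘ r) α λ i m _ _ → LL.mod-trans (CL.τ≡τ̂ m (r i))
        (PL.τ̂-cong m (L₀.trans (L₀.sym (RL.p^-root^ i (r i))) (RL.root^-cong i (roots i))))

  abstract
    expansionᴸ : ∀ x → IsExpansionᴸ x (coord x)
    expansionᴸ x = (λ i → RL.root^ i (coord x i)) , (λ i → RL.root^-p^ i (coord x i)) , λ
      { zero    → LL.mod-zero {π}
      ; (suc n) → LL.mod-sym (LL.mod-trans (sum≡ŵᴸ (coord x) (λ i → RL.root^ i (coord x i)) (λ i → RL.root^-p^ i (coord x i)) n) (CL.ŵ-coordinates n x))
      }

    expansionᴸ-unique : ∀ x α → IsExpansionᴸ x α → ∀ n → α n L₀.≈ coord x n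
    expansionᴸ-unique x α (r , roots , e) = coord-unique x α λ n → LL.mod-trans (LL.mod-sym (sum≡ŵᴸ α r roots n)) (LL.mod-sym (e (suc n)))

  module _ {R : Algebra L 0ℓ} {k : Algebra L₀ 0ℓ} (P : Pair R k) (hasRoots : HasRoots k) where
    private
      module R = OverL R
      module k = Algebra k
      C = Completion R.commutativeRing R.πᴿ
      module C = CommutativeRing C
      π^ = pow R.commutativeRing R.πᴿ
    open Pair P
    open HasRoots hasRoots hiding (root)
    open PerfectPair P hasRoots
    open Completed

    private
      abstract
        at≡at1 : ∀ (x : C.Carrier) n → at x (suc n) R.≡ at x 1 [mod R.πᴿ ]
        at≡at1 x zero    = R.mod-refl
        at≡at1 x (suc n) = R.mod-trans (R.mod^⇒mod R.πᴿ n (compatible x (suc n))) (at≡at1 x n)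

        at-^ : ∀ (x : C.Carrier) m n → at (pow C x m) n R.≡ pow R.commutativeRing (at x n) m [mod π^ n ]
        at-^ x zero    n = R.mod-refl
        at-^ x (suc m) n = R.mod-*-cong R.mod-refl (at-^ x m n)

    module _ (red̂ : C ⟶ k.commutativeRing) (red̂-eq : ∀ x → ⟦ red̂ ⟧ x k.≈ red (at x 1)) where

      -- In the completion the compatible approximations `τ̂ n x` already are the representative of
      -- `x`, so no limit has to be taken.
      completionTeichmüller : Teichmüller C k.commutativeRing red̂
      completionTeichmüller = record
        { τ         = τ-completed
        ; isSection = isSection
        ; unique    = unique
        }
        where
        abstract
          isSection : IsMultiplicativeSection C k.commutativeRing red̂ τ-completed
          isSection = record
            { cong    = λ e n → R.mod-≤ R.πᴿ n (suc n) (ℕ.n≤1+n n) (τ̂-cong n e)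
            ; *-homo  = λ x y n → R.mod-≤ R.πᴿ n (suc n) (ℕ.n≤1+n n) (τ̂-* n x y)
            ; section = λ x → k.trans (red̂-eq _) (red-τ̂ 1 x)
            }

          unique : ∀ {τ′} → IsMultiplicativeSection C k.commutativeRing red̂ τ′ → ∀ x → τ′ x C.≈ τ-completed x
          unique {τ′} sec x zero    = R.mod-zero {R.πᴿ}
          unique {τ′} sec x (suc n) = R.mod-trans
            (section-unique n (λ y → at (τ′ y) (suc n))
              (λ y → k.trans (red-mod (at≡at1 (τ′ y) n)) (k.trans (k.sym (red̂-eq (τ′ y))) (IsMultiplicativeSection.section sec y)))
              (λ y → R.mod-trans (IsMultiplicativeSection.cong sec (k.sym (root-^p y)) (suc n))
                       (R.mod-trans (section-^p sec (HasRoots.root hasRoots y) (suc n)) (at-^ (τ′ (HasRoots.root hasRoots y)) p (suc n)))) x)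
            (R.mod-sym (τ̂-compatible n x))

    private
      ∑ = series R.commutativeRing R.πᴿ

    -- ξᵢ is the Teichmüller representative of αᵢ^(p⁻ⁱ).
    Represents : (ℕ → R.Carrier) → (ℕ → k.Carrier) → Set
    Represents ξ α = ∀ i m → ξ i R.≡ τ̂ m (root^ i (α i)) [mod π^ (suc m) ]

    module _ {ξ υ : ℕ → R.Carrier} {α β : ℕ → k.Carrier} (ξ-α : Represents ξ α) (υ-β : Represents υ β) where
      private
        ξ^ υ^ : ℕ → C.Carrier
        ξ^ i = ⟦ toCompletion R.commutativeRing R.πᴿ ⟧ (ξ i)
        υ^ i = ⟦ toCompletion R.commutativeRing R.πᴿ ⟧ (υ i)

        abstract
          series≡ŵ : ∀ {ξ α} → Represents ξ α → ∀ n →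
            at (∑ (λ i → ⟦ toCompletion R.commutativeRing R.πᴿ ⟧ (ξ i))) (suc n) R.≡ ŵ n α [mod π^ (suc n) ]
          series≡ŵ {ξ} {α} ξ-α n = sum≡ŵ n n ℕ.≤-refl ξ α (λ i m _ _ → ξ-α i m)

          τ-series≡ŵ : ∀ q r → IsRoots k.commutativeRing q r → ∀ n → at (∑ (τ-completed ∘ r)) (suc n) R.≡ ŵ n q [mod π^ (suc n) ]
          τ-series≡ŵ q r roots n = sum≡ŵ n n ℕ.≤-refl (λ i → at (τ-completed (r i)) (suc n)) q λ i m i≤n m≤n → R.mod-trans
            (τ̂-≤ m (suc n) (ℕ.m≤n⇒m≤1+n m≤n) (r i))
            (τ̂-cong m (k.trans (k.sym (p^-root^ i (r i))) (root^-cong i (roots i))))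

          at-op : ∀ ⋆ x y n → at (⟪ ⋆ ⟫ C x y) n R.≈ ⟪ ⋆ ⟫ R.commutativeRing (at x n) (at y n)
          at-op add x y n = R.refl
          at-op mul x y n = R.refl

          op-series≡ŵ : ∀ ⋆ n → at (⟪ ⋆ ⟫ C (∑ ξ^) (∑ υ^)) (suc n) R.≡ ŵ n (opᵂ k ⋆ α β) [mod π^ (suc n) ]
          op-series≡ŵ ⋆ n = R.mod-trans (R.≈⇒mod (at-op ⋆ (∑ ξ^) (∑ υ^) (suc n)))
            (R.mod-trans (op-mod R.commutativeRing ⋆ (series≡ŵ ξ-α n) (series≡ŵ υ-β n)) (R.mod-sym (ŵ-op ⋆ n α β)))

      IsArithmeticᴾ : Op → (ℕ → k.Carrier) → Set
      IsArithmeticᴾ ⋆ q = ∃[ r ] IsRoots k.commutativeRing q r × ⟪ ⋆ ⟫ C (∑ ξ^) (∑ υ^) C.≈ ∑ (λ i → τ-completed (r i))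

      abstract
        opᵂ-arithmetic : ∀ ⋆ → IsArithmeticᴾ ⋆ (opᵂ k ⋆ α β)
        opᵂ-arithmetic ⋆ = (λ i → root^ i (opᵂ k ⋆ α β i)) , (λ i → root^-p^ i (opᵂ k ⋆ α β i)) , λ
          { zero    → R.mod-zero {R.πᴿ}
          ; (suc n) → R.mod-trans (op-series≡ŵ ⋆ n) (R.mod-sym
              (τ-series≡ŵ (opᵂ k ⋆ α β) (λ i → root^ i (opᵂ k ⋆ α β i)) (λ i → root^-p^ i (opᵂ k ⋆ α β i)) n))
          }

        opᵂ-arithmetic-unique : R.IsRegular R.πᴿ → ∀ ⋆ q → IsArithmeticᴾ ⋆ q → ∀ n → q n k.≈ opᵂ k ⋆ α β n
        opᵂ-arithmetic-unique reg ⋆ q (r , roots , e) i = ŵ-injective reg i {q} {opᵂ k ⋆ α β} λ n →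
          R.mod-trans (R.mod-sym (τ-series≡ŵ q r roots n)) (R.mod-trans (R.mod-sym (e (suc n))) (op-series≡ŵ ⋆ n))

  module RootPolynomials (G : Set) where
    P : Algebra L 0ℓ
    P = L [ G ^1/p^∞]
    P₀ : Algebra L₀ 0ℓ
    P₀ = L₀ [ G ^1/p^∞]
    private
      module P = OverL P
      module P₀ = Algebra P₀

      gen-^p : ∀ i n → pow P.commutativeRing (gen (i , suc n)) p P.≈ gen (i , n)
      gen-^p = RootPowers.root-^p p L G

      gen-^p₀ : ∀ i n → pow P₀.commutativeRing (gen (i , suc n)) p P₀.≈ gen (i , n)
      gen-^p₀ = RootPowers.root-^p p L₀ G

      P₀-over-L : Algebra L 0ℓ
      P₀-over-L = restrictScalars res P₀

      resp : ∀ {t u} → Roots L G t u → eval P₀-over-L gen t P₀.≈ eval P₀-over-L gen u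
      resp (root i n) = P₀.trans (eval-:^ L P₀-over-L gen (gen (i , suc n)) p) (gen-^p₀ i n)

      resp₀ : ∀ {t u} → Roots L₀ G t u → Algebra._≈_ P.moduloAlgebra (eval P.moduloAlgebra gen t) (eval P.moduloAlgebra gen u)
      resp₀ (root i n) = P.mod-trans (eval-:^ L₀ P.moduloAlgebra gen (gen (i , suc n)) p)
        (P.≈⇒mod (P.trans (P.reflexive (pow-/ P.commutativeRing P.πᴿ (gen (i , suc n)) p)) (gen-^p i n)))

    rootPair : Pair P P₀
    rootPair = presentedPair (Roots L G) (Roots L₀ G) resp resp₀

    private
      P₀-via-√ : Algebra L₀ 0ℓ
      P₀-via-√ = restrictScalars √ P₀

      root-algHom : AlgHom P₀ P₀-via-√
      root-algHom = induced L₀ (Roots L₀ G) P₀-via-√ (λ { (i , n) → gen (i , suc n) })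
        λ { (root i n) → P₀.trans (eval-:^ L₀ P₀-via-√ _ (gen (i , suc n)) p) (gen-^p₀ i (suc n)) }
      module root-map = AlgHom root-algHom

      abstract
        root-map-^p : ∀ x → pow P₀.commutativeRing (root-map.fun x) p P₀.≈ x
        root-map-^p = hom-ext L₀ (Roots L₀ G) P₀
          (record { hom = compose P₀.commutativeRing (AlgHom.hom (OverL₀.frobenius P₀)) root-map.hom
                  ; commutes = AlgHom.commutes (OverL₀.frobenius P₀) })
          (Category.idᶜ (Alg L₀ 0ℓ)) (λ { (i , n) → gen-^p₀ i n })

    hasRootsᴾ : HasRoots P₀
    hasRootsᴾ = record
      { root      = root-map.fun
      ; root-cong = root-map.cong
      ; root-^p   = root-map-^p
      ; ^p-root   = λ x → P₀.trans (hom-^ P₀.commutativeRing P₀.commutativeRing root-map.hom x p) (root-map-^p x)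
      }

    open HasRoots hasRootsᴾ using (root^)

    private
      root^-gen : ∀ m i n → root^ m (gen (i , n)) P₀.≈ gen (i , m ℕ.+ n)
      root^-gen zero    i n = P₀.refl
      root^-gen (suc m) i n = root-map.cong (root^-gen m i n)

    abstract
      -- The root X^(p⁻ⁱ) is the pᵐ-th power of a further root for every m, and these lift the
      -- corresponding roots over L₀; so it is its own Teichmüller representative.
      gen-represents : (ν : ℕ → G) → Represents rootPair hasRootsᴾ (λ i → gen (ν i , i)) (λ i → gen (ν i , 0))
      gen-represents ν i m = P.mod-trans (P.≈⇒mod (P.sym (RootPowers.root-pow p L G (ν i) i m)))
        (PerfectPair.τ̂-mod rootPair hasRootsᴾ m (P₀.sym (P₀.trans (HasRoots.root^-cong hasRootsᴾ m
          (P₀.trans (root^-gen i (ν i) 0) (P₀.reflexive (≡.cong (λ j → gen (ν i , j)) (ℕ.+-identityʳ i))))) (root^-gen m (ν i) i))))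

      π-regularᴾ : DecidableEquality G → P.IsRegular P.πᴿ
      π-regularᴾ _≟_ = RootCoefficients.con-regular p L _≟_ π-regular

-- The base ring ℒ and the data it determines.

module _ {p : ℕ} (pp : Prime p) where
  private
    module B = LazardBase pp
  open Lazard p

  lazardBase : Base p
  lazardBase = record
    { L          = ℒ
    ; L₀         = ℒ₀
    ; π          = π
    ; u          = B.u
    ; p≈uπ       = B.p≈uπ
    ; res        = residue
    ; res-π      = B.residue-π
    ; lift       = B.lift
    ; res-lift   = B.residue-lift
    ; res-kernel = λ {x} {y} → B.residue-kernel {x} {y}
    ; √          = B.√
    ; √-^p       = B.√-^p
    ; π-regular  = B.π-regular
    ; separated  = λ {x} {y} → B.ℒ-separated {x} {y}
    ; limit      = B.ℒ-limit
    }

  private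
    module A = Arithmetic pp lazardBase
    module RP = A.RootPolynomials (ℕ ⊎ ℕ)

  lazardData : LazardData
  lazardData = record
    { teichmüller  = A.teichmüllerᴸ
    ; teichmüller𝓡 = A.completionTeichmüller RP.rootPair RP.hasRootsᴾ residue𝓡 (λ _ → Equal.refl)
    ; coord        = A.coord
    ; expansion    = A.expansionᴸ
    ; coord-unique = A.expansionᴸ-unique
    ; Q            = A.Q
    ; Q-arithmetic = A.opᵂ-arithmetic RP.rootPair RP.hasRootsᴾ (RP.gen-represents inj₁) (RP.gen-represents inj₂)
    ; Q-unique     = A.opᵂ-arithmetic-unique RP.rootPair RP.hasRootsᴾ (RP.gen-represents inj₁) (RP.gen-represents inj₂)
                       (RP.π-regularᴾ (⊎.≡-dec ℕ._≟_ ℕ._≟_))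
    }

-- Residue algebras

module _ {R : CommutativeRing a ℓ} {A : Algebra R b} {B : Algebra R b} (f : AlgHom A B) where
  private
    module A = Algebra A
    module B = Algebra B
    module f = AlgHom f

  bijective⇒isIso : (∀ {x y} → f.fun x B.≈ f.fun y → x A.≈ y) → (g : B.Carrier → A.Carrier) → (∀ y → f.fun (g y) B.≈ y) →
                    Category.IsIso (Alg R b) f
  bijective⇒isIso inj g fg = record
    { inv = record
      { hom = mkHom B.commutativeRing A.commutativeRing g
          (λ e → inj (B.trans (fg _) (B.trans e (B.sym (fg _)))))
          (λ x y → inj (B.trans (fg _) (B.sym (B.trans (f.+-homo _ _) (B.+-cong (fg x) (fg y))))))
          (λ x y → inj (B.trans (fg _) (B.sym (B.trans (f.*-homo _ _) (B.*-cong (fg x) (fg y))))))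
          (inj (B.trans (fg _) (B.sym f.1#-homo)))
      ; commutes = λ x → inj (B.trans (fg _) (B.sym (f.commutes x)))
      }
    ; invˡ = λ x → inj (fg _)
    ; invʳ = fg
    }

module _ (R : CommutativeRing a ℓ) (ϖ : CommutativeRing.Carrier R) where
  private module R = CommutativeRing R
  open RingTheory R
  open Mod R using (_≡_[mod_])

  IsSeparated IsComplete : Set _
  IsSeparated = ∀ {x y} → (∀ n → x ≡ y [mod pow R ϖ n ]) → x R.≈ y
  IsComplete  = (x : Completed R ϖ) → Σ R.Carrier λ y → ∀ n → y ≡ Completed.at x n [mod pow R ϖ n ]

  at-stable : (x : Completed R ϖ) → ∀ {m n} → m ≤ n → Completed.at x n ≡ Completed.at x m [mod pow R ϖ m ]
  at-stable x {m} {zero}  z≤n = mod-refl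
  at-stable x {m} {suc n} m≤n with ℕ.m≤n⇒m<n∨m≡n m≤n
  ... | inj₁ (s≤s m≤n) = mod-trans (mod-≤ ϖ m n m≤n (Completed.compatible x n)) (at-stable x m≤n)
  ... | inj₂ ≡.refl    = mod-refl

  toCompletion-bijective : IsSeparated → IsComplete →
    Bijective R._≈_ (CommutativeRing._≈_ (Completion R ϖ)) ⟦ toCompletion R ϖ ⟧
  toCompletion-bijective separated limit = separated , λ y →
    proj₁ (limit y) , λ z≈x n → mod-trans (Mod.≈⇒mod R z≈x) (proj₂ (limit y) n)

  module _ (bij : Bijective R._≈_ (CommutativeRing._≈_ (Completion R ϖ)) ⟦ toCompletion R ϖ ⟧) where
    bijective⇒separated : IsSeparated
    bijective⇒separated = proj₁ bij

    bijective⇒limit : IsComplete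
    bijective⇒limit x = let y , h = proj₂ bij x in y , h R.refl

-- πL ⊗ B ≅ B by πx ⊗ b ↦ xb, since L is π-torsion free; so the multiplication map
-- πL ⊗ B → B becomes multiplication by π.
module Multiplication {L : CommutativeRing 0ℓ 0ℓ} {π : ∣ L ∣} (π-regular : RingTheory.IsRegular L π) (B : Algebra L b) where
  private
    module L = CommutativeRing L
    module B where
      open Algebra B public
      open RingTheory (Algebra.commutativeRing B) public
      πᴿ = ⟦ ι ⟧ π
    module ι = RingHomomorphism B.ι
    M = principalIdeal L π
    N = asModule L B
    infix 4 _≈ᵀ_
    _≈ᵀ_ = _≈⊗_ L M N

    quotientᴸ : (Σ L.Carrier λ x → Mod._∣_ L π x) → L.Carrier
    quotientᴸ (_ , d) = _∣ʳ_.quotient d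

    quotientᴸ-eq : ∀ x → quotientᴸ x L.* π L.≈ proj₁ x
    quotientᴸ-eq (_ , d) = _∣ʳ_.equality d

    quotientᴸ-unique : ∀ x y → proj₁ x L.≈ y L.* π → quotientᴸ x L.≈ y
    quotientᴸ-unique x y e = RingTheory.regular-cancel L π-regular
      (L.trans (L.*-comm π _) (L.trans (quotientᴸ-eq x) (L.trans e (L.*-comm y π))))

    πᴹ : Σ L.Carrier λ x → Mod._∣_ L π x
    πᴹ = π , Mod._,_ {R = L} L.1# (L.*-identityˡ π)

    divide : Tensor L M N → B.Carrier
    divide []             = B.0#
    divide ((x , m) ∷ xs) = ⟦ B.ι ⟧ (quotientᴸ x) B.* m B.+ divide xs

    divide-++ : ∀ xs ys → divide (xs ++ ys) B.≈ divide xs B.+ divide ys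
    divide-++ []             ys = B.sym (B.+-identityˡ _)
    divide-++ ((x , m) ∷ xs) ys = B.trans (B.+-congˡ (divide-++ xs ys)) (B.sym (B.+-assoc _ _ _))

    divide-cong : ∀ {xs ys} → xs ≈ᵀ ys → divide xs B.≈ divide ys
    divide-cong ≈⊗-refl        = B.refl
    divide-cong (≈⊗-sym d)     = B.sym (divide-cong d)
    divide-cong (≈⊗-trans d e) = B.trans (divide-cong d) (divide-cong e)
    divide-cong (++-cong {xs} {xs′} {ys} {ys′} d e) = B.trans (divide-++ xs ys)
      (B.trans (B.+-cong (divide-cong d) (divide-cong e)) (B.sym (divide-++ xs′ ys′)))
    divide-cong (++-comm xs ys) = B.trans (divide-++ xs ys) (B.trans (B.+-comm _ _) (B.sym (divide-++ ys xs)))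
    divide-cong (⊗-cong {m} {m′} d e) = B.+-congʳ (B.*-cong
      (ι.⟦⟧-cong (quotientᴸ-unique m (quotientᴸ m′) (L.trans d (L.sym (quotientᴸ-eq m′))))) e)
    divide-cong (⊗-zeroˡ n) = B.trans (B.+-identityʳ _) (B.trans (B.*-congʳ ι.0#-homo) (B.zeroˡ n))
    divide-cong (⊗-+ˡ m m′ n) = B.trans (B.+-congʳ (B.trans (B.*-congʳ (ι.+-homo (quotientᴸ m) (quotientᴸ m′))) (B.distribʳ n _ _)))
      (B.+-assoc _ _ _)
    divide-cong (⊗-+ʳ m n n′) = B.trans (B.+-congʳ (B.distribˡ _ n n′)) (B.+-assoc _ _ _)
    divide-cong (⊗-middle r m n) = B.+-congʳ (B.trans (B.*-congʳ (B.trans (ι.⟦⟧-cong (L.*-comm r (quotientᴸ m))) (ι.*-homo (quotientᴸ m) r))) (B.*-assoc _ _ n))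

    -- Only zero on the left of a tensor is a generating relation; zero on the right is reached by
    -- moving the scalar 0 across.
    [π,0] : (πᴹ , B.0#) ∷ [] ≈ᵀ []
    [π,0] = ≈⊗-trans (⊗-cong {m = πᴹ} {πᴹ} L.refl (B.sym (B.zeroʳ (⟦ B.ι ⟧ L.0#)))) (≈⊗-trans (≈⊗-sym (⊗-middle L.0# πᴹ B.0#))
      (≈⊗-trans (⊗-cong {m′ = LeftModule.0ᴹ M} (L.zeroˡ π) B.refl) (⊗-zeroˡ B.0#)))

    normalise : ∀ xs → xs ≈ᵀ (πᴹ , divide xs) ∷ []
    normalise []             = ≈⊗-sym [π,0]
    normalise ((x , m) ∷ xs) = ≈⊗-trans (++-cong {x = (x , m) ∷ []}
        (≈⊗-trans (⊗-cong {m′ = LeftModule._*ₗ_ M (quotientᴸ x) πᴹ} (L.sym (quotientᴸ-eq x)) B.refl) (⊗-middle (quotientᴸ x) πᴹ m)) (normalise xs))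
      (≈⊗-sym (⊗-+ʳ πᴹ (⟦ B.ι ⟧ (quotientᴸ x) B.* m) (divide xs)))

  module _ {multiply : Tensor L M N → B.Carrier}
           (multiply-[] : multiply [] B.≈ B.0#)
           (multiply-∷ : ∀ x m xs → multiply ((x , m) ∷ xs) B.≈ ⟦ B.ι ⟧ (proj₁ x) B.* m B.+ multiply xs) where

    private
      multiply≈ : ∀ xs → multiply xs B.≈ B.πᴿ B.* divide xs
      multiply≈ []             = B.trans multiply-[] (B.sym (B.zeroʳ _))
      multiply≈ ((x , m) ∷ xs) = B.trans (multiply-∷ x m xs) (B.trans (B.+-cong
          (B.trans (B.*-congʳ (B.trans (ι.⟦⟧-cong (L.trans (L.sym (quotientᴸ-eq x)) (L.*-comm _ π))) (ι.*-homo π (quotientᴸ x)))) (B.*-assoc _ _ m))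
          (multiply≈ xs))
        (B.sym (B.distribˡ B.πᴿ _ _)))

    injective⇒regular : Injective _≈ᵀ_ B._≈_ multiply → RingTheory.IsRegular (Algebra.commutativeRing B) (⟦ Algebra.ι B ⟧ π)
    injective⇒regular inj m πm≈0 = B.trans (B.sym (B.trans (B.+-identityʳ _) (B.trans (B.*-congʳ ι.1#-homo) (B.*-identityˡ m))))
      (divide-cong (inj {(πᴹ , m) ∷ []} {[]} (B.trans (multiply-∷ πᴹ m []) (B.trans (B.+-congˡ multiply-[]) (B.trans (B.+-identityʳ _) (B.trans πm≈0 (B.sym multiply-[])))))))

    regular⇒injective : RingTheory.IsRegular (Algebra.commutativeRing B) (⟦ Algebra.ι B ⟧ π) → Injective _≈ᵀ_ B._≈_ multiply
    regular⇒injective reg {xs} {ys} e = ≈⊗-trans (normalise xs) (≈⊗-trans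
      (⊗-cong {m = πᴹ} {πᴹ} L.refl (B.regular-cancel reg (B.trans (B.sym (multiply≈ xs)) (B.trans e (multiply≈ ys)))))
      (≈⊗-sym (normalise ys)))

module Residue {L : CommutativeRing 0ℓ 0ℓ} {π : ∣ L ∣} (C : Algebra L 0ℓ)
  (lift : Algebra.Carrier C → ∣ L ∣) (res-lift : ∀ x → Algebra._≈_ C (⟦ Algebra.ι C ⟧ (lift x)) x)
  (res-kernel : ∀ x y → Algebra._≈_ C (⟦ Algebra.ι C ⟧ x) (⟦ Algebra.ι C ⟧ y) → Mod._≡_[mod_] L x y π)
  (B : Algebra L b) where
  private
    module L = CommutativeRing L
    module L₀ = Algebra C
    res = Algebra.ι C
    B/πB = Algebra.commutativeRing B / ⟦ Algebra.ι B ⟧ π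
    module B where
      open Algebra B public
      open RingTheory (Algebra.commutativeRing B) public
      open Mod (Algebra.commutativeRing B) public using (≈⇒mod)
    module B/π = CommutativeRing B/πB
  open ResidueAction {L = L} {π = π} C lift res-lift res-kernel B

  private
    module action = RingHomomorphism residueAction
    module U = Algebra (B ⊗ C)

  reduce : B.commutativeRing ⟶ U.commutativeRing
  reduce = mkHom B.commutativeRing U.commutativeRing (λ x → (x , L₀.1#) ∷ []) (λ e → ⊗-cong e L₀.refl) (λ x y → ⊗-+ˡ x y L₀.1#)
    (λ x y → ⊗-cong B.refl (L₀.sym (L₀.*-identityˡ L₀.1#))) ≈⊗-refl

  -- Represents the inverse B ⊗ L₀ → B / π of `reduce`; it respects equality only modulo π, just as
  -- `lift` does.
  lifting : U.Carrier → B.Carrier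
  lifting []             = B.0#
  lifting ((x , c) ∷ xs) = x B.* ⟦ B.ι ⟧ (lift c) B.+ lifting xs

  lifting-++ : ∀ xs ys → lifting (xs ++ ys) B.≈ lifting xs B.+ lifting ys
  lifting-++ []             ys = B.sym (B.+-identityˡ _)
  lifting-++ ((x , c) ∷ xs) ys = B.trans (B.+-congˡ (lifting-++ xs ys)) (B.sym (B.+-assoc _ _ _))

  lifting-cong : ∀ {xs ys} → xs U.≈ ys → lifting xs B/π.≈ lifting ys
  lifting-cong ≈⊗-refl        = B/π.refl
  lifting-cong (≈⊗-sym d)     = B/π.sym (lifting-cong d)
  lifting-cong (≈⊗-trans d e) = B/π.trans (lifting-cong d) (lifting-cong e)
  lifting-cong (++-cong {xs} {xs′} {ys} {ys′} d e) = B/π.trans (B.≈⇒mod (lifting-++ xs ys))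
    (B/π.trans (B/π.+-cong (lifting-cong d) (lifting-cong e)) (B.≈⇒mod (B.sym (lifting-++ xs′ ys′))))
  lifting-cong (++-comm xs ys) = B.≈⇒mod (B.trans (lifting-++ xs ys) (B.trans (B.+-comm _ _) (B.sym (lifting-++ ys xs))))
  lifting-cong (⊗-cong d e)   = B/π.+-congʳ (B/π.*-cong (B.≈⇒mod d) (action.⟦⟧-cong e))
  lifting-cong (⊗-zeroˡ c)    = B.≈⇒mod (B.trans (B.+-identityʳ _) (B.zeroˡ _))
  lifting-cong (⊗-+ˡ x y c)   = B.≈⇒mod (B.trans (B.+-congʳ (B.distribʳ _ x y)) (B.+-assoc _ _ _))
  lifting-cong (⊗-+ʳ x c d)   = B/π.trans (B/π.+-congʳ (B/π.trans (B/π.*-congˡ {x} (action.+-homo c d)) (B/π.distribˡ x _ _))) (B.≈⇒mod (B.+-assoc _ _ _))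
  lifting-cong (⊗-middle r x c) = B/π.+-congʳ (B/π.trans
    (B.≈⇒mod (B.trans (B.*-congʳ (B.*-comm _ x)) (B.*-assoc x _ _)))
    (B/π.*-congˡ {x} (B/π.sym (B/π.trans (action.*-homo (⟦ res ⟧ r) c) (B/π.*-congʳ (ι-lift-mod (res-lift (⟦ res ⟧ r))))))))

  lifting-reduce : ∀ x → lifting (⟦ reduce ⟧ x) B/π.≈ x
  lifting-reduce x = B/π.trans (B.≈⇒mod (B.+-identityʳ _)) (B/π.trans (B/π.*-congˡ {x} action.1#-homo) (B/π.*-identityʳ x))

  reduce-ι : ∀ r → ⟦ reduce ⟧ (⟦ B.ι ⟧ r) U.≈ (B.1# , ⟦ res ⟧ r) ∷ []
  reduce-ι r = ≈⊗-trans (⊗-cong (B.sym (B.*-identityʳ _)) L₀.refl) (≈⊗-trans (⊗-middle r B.1# L₀.1#) (⊗-cong B.refl (L₀.*-identityʳ _)))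

  reduce-lifting : ∀ xs → ⟦ reduce ⟧ (lifting xs) U.≈ xs
  reduce-lifting []             = ⊗-zeroˡ L₀.1#
  reduce-lifting ((x , c) ∷ xs) = ≈⊗-trans (⊗-+ˡ _ _ L₀.1#) (++-cong {x = ⟦ reduce ⟧ (x B.* ⟦ B.ι ⟧ (lift c))} {x′ = (x , c) ∷ []}
    (≈⊗-trans (⊗-cong (B.*-comm _ _) L₀.refl) (≈⊗-trans (⊗-middle (lift c) x L₀.1#)
      (⊗-cong B.refl (L₀.trans (L₀.*-identityʳ _) (res-lift c)))))
    (reduce-lifting xs))

  reduce-kernel : ∀ {x y} → ⟦ reduce ⟧ x U.≈ ⟦ reduce ⟧ y → x B/π.≈ y
  reduce-kernel {x} {y} e = B/π.trans (B/π.sym (lifting-reduce x)) (B/π.trans (lifting-cong e) (lifting-reduce y))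

module Perfection {p : ℕ} (pp : Prime p) (base : Base p) where
  open Witt pp base
  open Lazard p using (Op; add; mul; ⟪_⟫)

  module _ {k : Algebra L₀ b} where
    private module k = Algebra k

    isPerfect : HasRoots k → IsPerfect p k.commutativeRing
    isPerfect hasRoots = record
      { char-p = OverL₀.char-p k
      ; frobenius-bijective = ^p-injective , λ y → root y , λ e →
          k.trans (Algebra.Properties.Semiring.Exp.^-congˡ k.semiring p e) (root-^p y)
      }
      where open HasRoots hasRoots

    hasRoots : IsPerfect p k.commutativeRing → HasRoots k
    hasRoots perfect = record
      { root      = root
      ; root-cong = λ e → injective (k.trans (root-^p _) (k.trans e (k.sym (root-^p _))))
      ; root-^p   = root-^p
      ; ^p-root   = λ x → injective (root-^p _)
      }
      where
      injective = proj₁ (IsPerfect.frobenius-bijective perfect)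
      root : k.Carrier → k.Carrier
      root y = proj₁ (proj₂ (IsPerfect.frobenius-bijective perfect) y)
      root-^p : ∀ y → pow k.commutativeRing (root y) p k.≈ y
      root-^p y = proj₂ (proj₂ (IsPerfect.frobenius-bijective perfect) y) k.refl

  module _ {R : Algebra L a} {k : Algebra L₀ b} (P : Pair R k) where
    private
      module R = OverL R
      module k = Algebra k
      module R/π = CommutativeRing R.modulo-π
    open Pair P
    open Algebra.Properties.Semiring.Exp k.semiring using (^-congˡ)

    private
      pow-red : ∀ x → red (pow R.modulo-π x p) k.≈ pow k.commutativeRing (red x) p
      pow-red x = k.trans (red-cong (R.reflexive (pow-/ R.commutativeRing R.πᴿ x p))) (hom-^ R.commutativeRing k.commutativeRing red-hom x p)

    residue-isPerfect : HasRoots k → IsPerfect p R.modulo-π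
    residue-isPerfect hasRoots = record
      { char-p = R/π.trans (R/π.sym (hom-times-1 L R.modulo-π quotient-ι p)) (R/π.trans (RingHomomorphism.⟦⟧-cong quotient-ι p≈uπ)
          (R/π.trans (RingHomomorphism.*-homo quotient-ι u π) (kernel (k.trans (red-* _ _) (k.trans (k.*-congˡ red-π) (k.trans (k.zeroʳ _) (k.sym red-0)))))))
      ; frobenius-bijective = (λ {x} {y} e → kernel (^p-injective (k.trans (k.sym (pow-red x)) (k.trans (red-mod e) (pow-red y)))))
          , λ y → lifting (root (red y)) , λ {z} e → kernel (k.trans (pow-red z) (k.trans (^-congˡ p (k.trans (red-mod e) (red-lift _))) (root-^p _)))
      }
      where
      open HasRoots hasRoots
      quotient-ι : L ⟶ R.modulo-π
      quotient-ι = compose R.modulo-π (quotientMap R.commutativeRing R.πᴿ) R.ι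

    residue-hasRoots : IsPerfect p R.modulo-π → HasRoots k
    residue-hasRoots perfect = record
      { root      = root
      ; root-cong = λ e → injective (k.trans (root-^p _) (k.trans e (k.sym (root-^p _))))
      ; root-^p   = root-^p
      ; ^p-root   = λ x → injective (root-^p _)
      }
      where
      r : R.Carrier → R.Carrier
      r y = proj₁ (proj₂ (IsPerfect.frobenius-bijective perfect) y)
      r-^p : ∀ y → pow R.modulo-π (r y) p R/π.≈ y
      r-^p y = proj₂ (proj₂ (IsPerfect.frobenius-bijective perfect) y) R/π.refl
      root : k.Carrier → k.Carrier
      root x = red (r (lifting x))
      root-^p : ∀ x → pow k.commutativeRing (root x) p k.≈ x
      root-^p x = k.trans (k.sym (pow-red _)) (k.trans (red-mod (r-^p (lifting x))) (red-lift x))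
      lift-pow : ∀ x → red (pow R.modulo-π (lifting x) p) k.≈ pow k.commutativeRing x p
      lift-pow x = k.trans (pow-red _) (^-congˡ p (red-lift x))
      injective : ∀ {x y} → pow k.commutativeRing x p k.≈ pow k.commutativeRing y p → x k.≈ y
      injective {x} {y} e = k.trans (k.sym (red-lift x)) (k.trans (red-mod (proj₁ (IsPerfect.frobenius-bijective perfect) {lifting x} {lifting y}
        (kernel (k.trans (lift-pow x) (k.trans e (k.sym (lift-pow y))))))) (red-lift y))

-- Witt vectors of perfect algebras

module WittEquivalence {p : ℕ} (pp : Prime p) (base : Base p) {c : Level}
  (0ᵂ 1ᵂ : (k : Algebra (Base.L₀ base) c) → ℕ → Algebra.Carrier k)
  (0ᵂ-eq : ∀ k n → Algebra._≈_ k (0ᵂ k n) (firstOnly (Algebra.0# k) (Algebra.0# k) n))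
  (1ᵂ-eq : ∀ k n → Algebra._≈_ k (1ᵂ k n) (firstOnly (Algebra.0# k) (Algebra.1# k) n))
  where
  open Witt pp base
  open Perfection pp base
  open Lazard p using (Op; add; mul; ⟪_⟫)

  ringᵂ : Algebra L₀ c → CommutativeRing c c
  ringᵂ k = record { isCommutativeRing = isCommutativeRingᵂ k (0ᵂ k) (1ᵂ k) (0ᵂ-eq k) (1ᵂ-eq k) }

  ιᵂ-hom : ∀ k → L ⟶ ringᵂ k
  ιᵂ-hom k = mkHom L (ringᵂ k) (ιᵂ k)
    (ιᵂ-cong k _ _ (0ᵂ-eq k) (1ᵂ-eq k)) (ιᵂ-+ k _ _ (0ᵂ-eq k) (1ᵂ-eq k)) (ιᵂ-* k _ _ (0ᵂ-eq k) (1ᵂ-eq k))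
    (λ n → Algebra.sym k (ιᵂ-1 k _ _ (0ᵂ-eq k) (1ᵂ-eq k) n))

  𝕎 : Algebra L₀ c → Algebra L c
  𝕎 k = record { commutativeRing = ringᵂ k ; ι = ιᵂ-hom k }

  module _ (k : Algebra L₀ c) (hasRoots : HasRoots k) where
    private
      module k = Algebra k
      module W = OverL (𝕎 k)
    open HasRoots hasRoots
    open Algebra.Properties.Semiring.Exp k.semiring using (^-congˡ)
    private
      π^ = pow W.commutativeRing W.πᴿ

    first : k.Carrier → W.Carrier
    first = firstOnly k.0#

    tail : W.Carrier → W.Carrier
    tail α = root ∘ α ∘ suc

    first-cong : ∀ {x y} → x k.≈ y → first x W.≈ first y
    first-cong e zero    = e
    first-cong e (suc n) = k.refl

    abstract
      -- By `π-shift`, multiplication by π shifts and takes p-th powers; as `k` has p-th roots, (0,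
      -- α₁, α₂, ...) is a multiple of π. The π-adic structure of W(k) is derived from this
      -- splitting.
      decompose : ∀ α → α W.≈ first (α 0) W.+ W.πᴿ W.* tail α
      decompose α n = k.trans (first+rest k α n) (opᵂ-cong k add {first (α 0)} {first (α 0)} {_◃_ k.0# k.0# (α ∘ suc)} {opᵂ k mul (ιᵂ k π) (tail α)}
        (λ _ → k.refl) (λ j → k.sym (k.trans (π-shift k (tail α) j) (shifted j))) n)
        where
        shifted : ∀ j → _◃_ k.0# k.0# (λ i → pow k.commutativeRing (tail α i) p) j k.≈ _◃_ k.0# k.0# (α ∘ suc) j
        shifted zero    = k.refl
        shifted (suc j) = root-^p (α (suc j))

      first-^ : ∀ x n → ℕ.NonZero n → pow W.commutativeRing (first x) n W.≈ first (pow k.commutativeRing x n)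
      first-^ x (suc zero)    _ = W.trans {first x W.* W.1#} {first x} {first (x k.* k.1#)} (W.*-identityʳ (first x)) (first-cong (k.sym (k.*-identityʳ x)))
      first-^ x (suc (suc n)) _ = W.trans {pow W.commutativeRing (first x) (suc (suc n))} {first x W.* first (pow k.commutativeRing x (suc n))} {first (pow k.commutativeRing x (suc (suc n)))}
        (W.*-congˡ {first x} {pow W.commutativeRing (first x) (suc n)} {first (pow k.commutativeRing x (suc n))} (first-^ x (suc n) _)) (λ i → k.sym (first-* k x (pow k.commutativeRing x (suc n)) i))

      private
        recompose : W.Carrier → W.Carrier
        recompose α = first (α 0) W.+ W.πᴿ W.* tail α

        decompose-mod : ∀ {f} α β → α W.≡ β [mod f ] → recompose α W.≡ recompose β [mod f ]
        decompose-mod α β d = W.mod-respˡ {x = recompose α} {α} {recompose β} (W.sym {α} {recompose α} (decompose α))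
          (W.mod-respʳ {x = α} {β} {recompose β} d (decompose β))

        recompose-mod : ∀ {f} α β → recompose α W.≡ recompose β [mod f ] → α W.≡ β [mod f ]
        recompose-mod α β d = W.mod-respˡ {x = α} {recompose α} {β} (decompose α)
          (W.mod-respʳ {x = recompose α} {recompose β} {β} d (W.sym {β} {recompose β} (decompose β)))

        first-mod : ∀ {f x y} → x k.≈ y → first x W.≡ first y [mod f ]
        first-mod {x = x} {y} e = W.≈⇒mod {x = first x} {first y} (first-cong e)

        parts-mod : ∀ {f} α β → α 0 k.≈ β 0 → W.πᴿ W.* tail α W.≡ W.πᴿ W.* tail β [mod f ] → recompose α W.≡ recompose β [mod f ]
        parts-mod α β e = W.mod-+-cong {x = first (α 0)} {first (β 0)} {W.πᴿ W.* tail α} {W.πᴿ W.* tail β} (first-mod e)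

      kernelᵂ : ∀ {α β} → α 0 k.≈ β 0 → α W.≡ β [mod W.πᴿ ]
      kernelᵂ {α} {β} e = recompose-mod α β (parts-mod α β e
          (W.mod-divisor {x = W.πᴿ W.* tail α} {y = W.πᴿ W.* tail β} (W.*-identityʳ W.πᴿ)
            (W.mod-scale {W.1#} {tail α} {tail β} W.πᴿ (W.divides {W.1#} {tail α} {tail β} (tail α W.- tail β) (W.*-identityʳ (tail α W.- tail β))))))

    wittPair : Pair (𝕎 k) k
    wittPair = record
      { red-hom  = mkHom W.commutativeRing k.commutativeRing (λ α → α 0) (λ e → e 0) (λ _ _ → k.refl) (λ _ _ → k.refl) (1ᵂ-eq k 0)
      ; red-ι    = λ _ → k.refl
      ; kernel   = λ {α} {β} → kernelᵂ {α} {β}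
      ; lifting  = first
      ; red-lift = λ _ → k.refl
      }

    abstract
      -- Multiplication by π is α ↦ (0, α₀ᵖ, α₁ᵖ, ...), which is injective because Frobenius on `k`
      -- is.
      π-regularᵂ : W.IsRegular W.πᴿ
      π-regularᵂ α e n = k.trans (k.sym (^p-root (α n))) (k.trans (root-cong (k.trans (k.sym (π-shift k α (suc n)))
        (k.trans (e (suc n)) (0ᵂ-eq k (suc n))))) (k.trans rootAlgHom.0#-homo (k.sym (zeros n))))
        where
        zeros : ∀ n → W.0# n k.≈ k.0#
        zeros zero    = 0ᵂ-eq k 0
        zeros (suc n) = 0ᵂ-eq k (suc n)

      -- Together with `mod⇒agree` this identifies congruence modulo πⁿ with equality of the first n
      -- coordinates, so the π-adic topology of W(k) is the product topology on sequences in the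
      -- discrete set `k`.
      agree⇒mod : ∀ n α β → (∀ i → i < n → α i k.≈ β i) → α W.≡ β [mod π^ n ]
      agree⇒mod zero    α β e = W.mod-zero {W.πᴿ} {α} {β}
      agree⇒mod (suc n) α β e = recompose-mod α β (parts-mod α β (e 0 (s≤s z≤n))
        (W.mod-scale {x = tail α} {y = tail β} W.πᴿ (agree⇒mod n (tail α) (tail β) λ i i<n → root-cong (e (suc i) (s≤s i<n)))))

      mod⇒agree : ∀ n α β → α W.≡ β [mod π^ n ] → ∀ i → i < n → α i k.≈ β i
      mod⇒agree (suc n) α β d = go
        where
        heads : α 0 k.≈ β 0
        heads = Pair.red-mod wittPair {α} {β} (W.mod^⇒mod W.πᴿ n {α} {β} d)
        tails : tail α W.≡ tail β [mod π^ n ]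
        tails = W.mod-unscale {x = tail α} {y = tail β} {z = W.πᴿ} π-regularᵂ
          (W.+-cancelˡ-mod {x = first (α 0)} {first (β 0)} {W.πᴿ W.* tail α} {W.πᴿ W.* tail β} (first-mod heads) (decompose-mod α β d))
        go : ∀ i → i < suc n → α i k.≈ β i
        go zero    _         = heads
        go (suc i) (s≤s i<n) = k.trans (k.sym (root-^p _)) (k.trans (^-congˡ p (mod⇒agree n (tail α) (tail β) tails i i<n)) (root-^p _))

      separatedᵂ : IsSeparated W.commutativeRing W.πᴿ
      separatedᵂ {α} {β} d n = mod⇒agree (suc n) α β (d (suc n)) n ℕ.≤-refl

      limitᵂ : IsComplete W.commutativeRing W.πᴿ
      -- Coordinate i is settled as soon as the element is known modulo πⁱ⁺¹.
      limitᵂ x = (λ i → at (suc i) i) , λ n → agree⇒mod n (λ i → at (suc i) i) (at n) λ i i<n →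
          k.sym (mod⇒agree (suc i) (at n) (at (suc i)) (at-stable W.commutativeRing W.πᴿ x i<n) i ℕ.≤-refl)
        where open Completed x

      -- In W(k) the Teichmüller map is `first`, and this is the expansion α = ∑ [αᵢ^(p⁻ⁱ)] πⁱ read
      -- modulo πⁿ⁺¹. It follows from `decompose` by recursion on the tail.
      w-first≡ : ∀ n α → W.w n (λ i → first (root^ n (α i))) W.≡ α [mod π^ (suc n) ]
      w-first≡ zero    α = W.mod⇒mod¹ {W.πᴿ} {first (α 0)} {α} (kernelᵂ {first (α 0)} {α} k.refl)
      w-first≡ (suc n) α = W.mod-respʳ {x = teich W.+ W.πᴿ W.* rest} {recompose α} {α}
          (W.mod-+-cong {x = teich} {first (α 0)} {W.πᴿ W.* rest} {W.πᴿ W.* tail α}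
            (W.≈⇒mod {x = teich} {first (α 0)} (W.trans {teich} {first (pow k.commutativeRing (root^ (suc n) (α 0)) (p ℕ.^ suc n))} {first (α 0)}
              (first-^ _ (p ℕ.^ suc n) (ℕ.m^n≢0 p (suc n) {{prime⇒nonZero pp}})) (first-cong (root^-p^ (suc n) (α 0)))))
            (W.mod-scale {x = rest} {tail α} W.πᴿ (W.mod-trans {x = rest} {W.w n (λ i → first (root^ n (tail α i)))} {tail α}
              (W.≈⇒mod {x = rest} {W.w n (λ i → first (root^ n (tail α i)))}
                (W.w-cong n {λ i → first (root^ (suc n) (α (suc i)))} {λ i → first (root^ n (tail α i))} λ i _ → first-cong (root^-suc n (α (suc i)))))
              (w-first≡ n (tail α)))))
          (W.sym {α} {recompose α} (decompose α))
        where
        teich rest : W.Carrier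
        teich = pow W.commutativeRing (first (root^ (suc n) (α 0))) (p ℕ.^ suc n)
        rest = W.w n (λ i → first (root^ (suc n) (α (suc i))))

  module _ {R : Algebra L c} {k : Algebra L₀ c} (P : Pair R k) (hasRoots : HasRoots k) where
    private
      module R = OverL R
      module k = Algebra k
    open Pair P
    open HasRoots hasRoots
    open PerfectPair P hasRoots

    module _ (separated : IsSeparated R.commutativeRing R.πᴿ) (limit : IsComplete R.commutativeRing R.πᴿ) where
      open Complete separated limit

      private
        abstract
          Θ-ι : ∀ x → Θ (ιᵂ k x) R.≈ ⟦ R.ι ⟧ x
          Θ-ι x = R.sym (Θ-unique _ _ λ n → R.mod-sym (const-ghost P x n _ λ i _ → k.trans (red-lift _) (root^-ι n (coord x i))))

          Θ-1 : Θ (1ᵂ k) R.≈ R.1#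
          Θ-1 = R.trans (Θ-cong (ιᵂ-1 k _ _ (0ᵂ-eq k) (1ᵂ-eq k))) (R.trans (Θ-ι L.1#) (RingHomomorphism.1#-homo R.ι))

      ΘAlgHom : AlgHom (𝕎 k) R
      ΘAlgHom = record
        { hom      = mkHom (ringᵂ k) R.commutativeRing Θ Θ-cong (Θ-op add) (Θ-op mul) Θ-1
        ; commutes = Θ-ι
        }

  root-natural : {k k′ : Algebra L₀ c} (r : HasRoots k) (r′ : HasRoots k′) (f : AlgHom k k′) → ∀ n x →
                 Algebra._≈_ k′ (fun f (HasRoots.root^ r n x)) (HasRoots.root^ r′ n (fun f x))
  root-natural {k} {k′} r r′ f zero    x = Algebra.refl k′
  root-natural {k} {k′} r r′ f (suc n) x = k′.trans
    (r′.^p-injective (k′.trans (k′.sym (hom-^ k.commutativeRing k′.commutativeRing (AlgHom.hom f) _ p))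
      (k′.trans (AlgHom.cong f (r.root-^p _)) (k′.sym (r′.root-^p _)))))
    (r′.root-cong (root-natural r r′ f n x))
    where
    module k = Algebra k
    module k′ = Algebra k′
    module r = HasRoots r
    module r′ = HasRoots r′

  module _ (k : Algebra L₀ c) (hasRoots : HasRoots k) {k′ : Algebra L₀ c} (P′ : Pair (𝕎 k) k′) where
    private
      module k = Algebra k
      module W = OverL (𝕎 k)
      module k′ = Algebra k′
      module P′ = Pair P′
      teich = first k hasRoots

      same-residue : ∀ α β → α 0 k.≈ β 0 → P′.red α k′.≈ P′.red β
      same-residue α β e = P′.red-mod {α} {β} (kernelᵂ k hasRoots {α} {β} e)

    -- On W(k) the map `first` is multiplicative but not additive. It becomes additive after
    -- reduction, since by `kernelᵂ` the residue of a Witt vector depends only on coordinate 0.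
    residueHom : AlgHom k k′
    residueHom = record
      { hom = mkHom k.commutativeRing k′.commutativeRing (λ x → P′.red (teich x))
          (λ {x} {y} e → P′.red-cong {teich x} {teich y} (first-cong k hasRoots e))
          (λ x y → k′.trans (same-residue (teich (x k.+ y)) (teich x W.+ teich y) k.refl) (P′.red-+ (teich x) (teich y)))
          (λ x y → k′.trans (same-residue (teich (x k.* y)) (teich x W.* teich y) k.refl) (P′.red-* (teich x) (teich y)))
          (k′.trans (same-residue (teich k.1#) W.1# (k.sym (1ᵂ-eq k 0))) P′.red-1)
      ; commutes = λ x → k′.trans (same-residue (teich (⟦ k.ι ⟧ x)) (ιᵂ k (lift x)) (RingHomomorphism.⟦⟧-cong k.ι (L₀.sym (res-lift x))))
          (k′.trans (P′.red-ι (lift x)) (RingHomomorphism.⟦⟧-cong k′.ι (res-lift x)))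
      }

    residueHom-isIso : Category.IsIso (Alg L₀ c) residueHom
    residueHom-isIso = bijective⇒isIso residueHom
      (λ {x} {y} e → Pair.red-mod (wittPair k hasRoots) {teich x} {teich y} (P′.kernel {teich x} {teich y} e))
      (λ t → P′.lifting t 0)
      (λ t → k′.trans (same-residue (teich (P′.lifting t 0)) (P′.lifting t) k.refl) (P′.red-lift t))

  module _ {B B′ : Algebra L c} (f : AlgHom B B′) where
    private
      module B = OverL B
      module B′ = OverL B′
      module f = AlgHom f

    abstract
      algHom-mod : ∀ n {x y} → x B.≡ y [mod pow B.commutativeRing B.πᴿ n ] → f.fun x B′.≡ f.fun y [mod pow B′.commutativeRing B′.πᴿ n ]
      algHom-mod n {x} {y} d = B′.mod-divisor {x = f.fun x} {f.fun y} (B′.trans (hom-^ B.commutativeRing B′.commutativeRing f.hom B.πᴿ n)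
        (Algebra.Properties.Semiring.Exp.^-congˡ B′.semiring n (f.commutes π))) (hom-mod B.commutativeRing B′.commutativeRing f.hom {x = x} {y} d)

      algHom-ghost : ∀ n s → f.fun (B.w n s) B′.≈ B′.w n (f.fun ∘ s)
      algHom-ghost n s = B′.trans (hom-ghost B.commutativeRing B′.commutativeRing f.hom p B.πᴿ n s) (ghost-cong n (f.commutes π) (f.fun ∘ s))
        where
        ghost-cong : ∀ n {ϖ ϖ′} → ϖ B′.≈ ϖ′ → ∀ s → RingTheory.ghost B′.commutativeRing p ϖ n s B′.≈ RingTheory.ghost B′.commutativeRing p ϖ′ n s
        ghost-cong zero    e s = B′.refl
        ghost-cong (suc n) e s = B′.+-congˡ (B′.*-cong e (ghost-cong n e (s ∘ suc)))

  module _ {k : Algebra L₀ c} (hasRoots : HasRoots k) {B : Algebra L c} {k′ : Algebra L₀ c} (P : Pair B k′) (r : HasRoots k′)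
           (separated : IsSeparated (Algebra.commutativeRing B) (OverL.πᴿ B)) (limit : IsComplete (Algebra.commutativeRing B) (OverL.πᴿ B))
           (j : AlgHom (𝕎 k) B) (e : AlgHom k k′)
           (j-first : ∀ x → Algebra._≈_ k′ (Pair.red P (fun j (first k hasRoots x))) (fun e x))
           where
    private
      module B = OverL B
      module W = OverL (𝕎 k)
      module k′ = Algebra k′
      module PP = PerfectPair P r
      module C = PP.Complete separated limit
      module h = HasRoots hasRoots

    abstract
      -- A homomorphism `j` from W(k) to a complete algebra is determined by its effect `e` on
      -- residues: applied to the expansion of α in `w-first≡`, it yields ghost components of lifts
      -- of the roots of `e` applied to α.
      Θ-first : ∀ α → C.Θ (fun e ∘ α) B.≈ fun j α
      Θ-first α = B.sym (C.Θ-unique (fun e ∘ α) (fun j α) λ n → B.mod-trans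
        (B.mod-sym (algHom-mod j (suc n) {W.w n (λ i → first k hasRoots (h.root^ n (α i)))} {α} (w-first≡ k hasRoots n α)))
        (B.mod-trans (B.≈⇒mod (algHom-ghost j n (λ i → first k hasRoots (h.root^ n (α i)))))
        (PP.w≡ŵ n (fun e ∘ α) _ λ i _ → k′.trans (j-first _) (root-natural hasRoots r e n (α i)))))

  module _ {B : Algebra L c} {k : Algebra L₀ c} (P : Pair B k) (r : HasRoots k)
           (separated : IsSeparated (Algebra.commutativeRing B) (OverL.πᴿ B)) (limit : IsComplete (Algebra.commutativeRing B) (OverL.πᴿ B))
           {B′ : Algebra L c} {k′ : Algebra L₀ c} (P′ : Pair B′ k′) (r′ : HasRoots k′)
           (separated′ : IsSeparated (Algebra.commutativeRing B′) (OverL.πᴿ B′)) (limit′ : IsComplete (Algebra.commutativeRing B′) (OverL.πᴿ B′))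
           (f : AlgHom B B′) (f₀ : AlgHom k k′)
           (f-red : ∀ x → Algebra._≈_ k′ (Pair.red P′ (fun f x)) (fun f₀ (Pair.red P x)))
           where
    private
      module B = OverL B
      module PP = PerfectPair P r
      module C = PP.Complete separated limit
      module B′ = OverL B′
      module k′ = Algebra k′
      module PP′ = PerfectPair P′ r′
      module C′ = PP′.Complete separated′ limit′

    abstract
      Θ-natural : ∀ α → C′.Θ (fun f₀ ∘ α) B′.≈ fun f (C.Θ α)
      Θ-natural α = B′.sym (C′.Θ-unique (fun f₀ ∘ α) (fun f (C.Θ α)) λ n →
        B′.mod-trans (algHom-mod f (suc n) (C.Θ≡ŵ n α)) (B′.mod-trans (B′.≈⇒mod (algHom-ghost f n _))
        (PP′.w≡ŵ n (fun f₀ ∘ α) _ λ i _ → k′.trans (f-red _) (k′.trans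
          (AlgHom.cong f₀ (Pair.red-lift P (HasRoots.root^ r n (α i))))
          (root-natural r r′ f₀ n (α i))))))

-- The Witt structure over ℒ.

module _ {p : ℕ} (pp : Prime p) where
  private
    module A = Arithmetic pp (lazardBase pp)
    module B = LazardBase pp
    module RL = A.HasRoots A.baseRoots
  open Lazard p
  private
    module ℒ₀ = CommutativeRing ℒ₀

  private
    root^-ω : ∀ i n m → RL.root^ m ω₀^[ i , n ] ≡ ω₀^[ i , m ℕ.+ n ]
    root^-ω i n zero    = ≡.refl
    root^-ω i n (suc m) = ≡.cong RL.root (root^-ω i n m)

    abstract
      coord-ω : ∀ i n j → firstOnly ℒ₀.0# ω₀^[ i , n ] j ℒ₀.≈ A.coord ω^[ i , n ] j
      coord-ω i n = A.coord-teichmüller ω^[ i , n ] (λ m → ω^[ i , m ℕ.+ n ]) ω₀^[ i , n ]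
        (λ m → ℒ₀.reflexive (≡.sym (root^-ω i n m))) (B.ω-^p^ i n)

  private
    𝒟 = lazardData pp

    first≈ : (k : Algebra ℒ₀ c) → ∀ x n → Algebra._≈_ k (first 𝒟 k x n) (firstOnly (Algebra.0# k) x n)
    first≈ k x zero    = Algebra.refl k
    first≈ k x (suc n) = Algebra.refl k

  module Equivalence c = WittEquivalence pp (lazardBase pp) {c}
    (λ k → first 𝒟 k (Algebra.0# k)) (λ k → first 𝒟 k (Algebra.1# k))
    (λ k → first≈ k (Algebra.0# k)) (λ k → first≈ k (Algebra.1# k))

  wittStructure : ∀ c → WittStructure 𝒟 c
  wittStructure c = record
    { negᵂ              = A.negᵂ
    ; isCommutativeRing = λ k → CommutativeRing.isCommutativeRing (E.ringᵂ k)
    ; ιᵂ                = E.ιᵂ-hom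
    ; ι-ω               = ι-ω
    ; ι-π               = ι-π
    ; ι-natural         = λ f x n → AlgHom.commutes f (A.coord x n)
    }
    where
    module E = Equivalence c
    module _ (k : Algebra ℒ₀ c) where
      open Algebra k using (1#; refl; sym; trans; ι)
      ι-ω : ∀ i n → _≈ᵂ_ 𝒟 k (A.ιᵂ k ω^[ i , n ]) (first 𝒟 k (⟦ ι ⟧ ω₀^[ i , n ]))
      ι-ω i n j = trans (RingHomomorphism.⟦⟧-cong ι (ℒ₀.sym (coord-ω i n j))) (go j)
        where
        go : ∀ j → Algebra._≈_ k (⟦ ι ⟧ (firstOnly ℒ₀.0# ω₀^[ i , n ] j)) (first 𝒟 k (⟦ ι ⟧ ω₀^[ i , n ]) j)
        go zero    = refl
        go (suc j) = RingHomomorphism.0#-homo ι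
      ι-π : _≈ᵂ_ 𝒟 k (A.ιᵂ k π) (second 𝒟 k 1#)
      ι-π n = trans (RingHomomorphism.⟦⟧-cong ι (ℒ₀.sym (A.coord-π n))) (go n)
        where
        go : ∀ n → Algebra._≈_ k (⟦ ι ⟧ (_◃_ ℒ₀.0# ℒ₀.0# (firstOnly ℒ₀.0# ℒ₀.1#) n)) (second 𝒟 k 1# n)
        go zero          = RingHomomorphism.0#-homo ι
        go (suc zero)    = RingHomomorphism.1#-homo ι
        go (suc (suc n)) = RingHomomorphism.0#-homo ι

-- The adjunction between jet algebras and Witt vectors.

module Adjunction {c : Level} (p : ℕ) (𝒟 : Lazard.LazardData p) (𝒲 : Lazard.WittStructure p 𝒟 c)
  (ι-coord : ∀ k x n → Algebra._≈_ k (⟦ Lazard.WittStructure.ιᵂ 𝒲 k ⟧ x n) (⟦ Algebra.ι k ⟧ (Lazard.LazardData.coord 𝒟 x n))) where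
  open Lazard p
  open LazardData 𝒟
  open WittStructure 𝒲

  private
    module _ (A : Algebra ℒ c) where
      private
        module A = Algebra A
        module Δ = Algebra (Δ₀ 𝒟 A)
        module WΔ = Algebra (W₀ (Δ₀ 𝒟 A))

      eval≈>>= : {G : Set} (σ : G → Δ.Carrier) (t : Term ∣ ℒ₀ ∣ G) → eval (Δ₀ 𝒟 A) σ t Δ.≈ (t >>= σ)
      eval≈>>= σ (con x)  = Δ.refl
      eval≈>>= σ (gen i)  = Δ.refl
      eval≈>>= σ (t :+ u) = Δ.+-cong (eval≈>>= σ t) (eval≈>>= σ u)
      eval≈>>= σ (t :* u) = Δ.*-cong (eval≈>>= σ t) (eval≈>>= σ u)
      eval≈>>= σ (:- t)   = Δ.-‿cong (eval≈>>= σ t)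

      jet : A.Carrier → ℕ → Δ.Carrier
      jet x n = gen (n , x)

      jet-op : ∀ ⋆ x y n → jet (⟪ ⋆ ⟫ A.commutativeRing x y) n Δ.≈ opᵂ 𝒟 (Δ₀ 𝒟 A) ⋆ (jet x) (jet y) n
      jet-op ⋆ x y n = Δ.trans (Equal.relation (d-op ⋆ n x y)) (Δ.trans (Δ.sym (eval≈>>= _ (Q ⋆ n)))
        (eval-cong-ρ (Δ₀ 𝒟 A) (λ { (inj₁ i) → Δ.refl ; (inj₂ i) → Δ.refl }) (Q ⋆ n)))

      -- The relations d^[n] x = xₙ of Δ make the jet map linear over ℒ. This compares every
      -- coordinate of the structure map with `coord`, whereas a `WittStructure` prescribes its
      -- values only at π and at the roots of the ωᵢ; hence the hypothesis `ι-coord`.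
      jet-ι : ∀ x n → jet (⟦ A.ι ⟧ x) n Δ.≈ ⟦ WΔ.ι ⟧ x n
      jet-ι x n = Δ.trans (Equal.relation (d-const n x)) (Δ.sym (ι-coord (Δ₀ 𝒟 A) x n))

      unit : AlgHom A (W₀ (Δ₀ 𝒟 A))
      unit = record
        { hom = mkHom A.commutativeRing WΔ.commutativeRing jet
            (λ e n → Equal.relation (d-cong n e)) (jet-op add) (jet-op mul)
            (λ n → Δ.trans (Equal.relation (d-cong n (A.sym (RingHomomorphism.1#-homo A.ι))))
              (Δ.trans (jet-ι (CommutativeRing.1# ℒ) n) (RingHomomorphism.1#-homo WΔ.ι n)))
        ; commutes = jet-ι
        }

    module _ (k : Algebra ℒ₀ c) where
      private
        module k = Algebra k
        component : ℕ × (ℕ → k.Carrier) → k.Carrier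
        component (n , α) = α n

      component-resp : ∀ {t u} → JetRelation 𝒟 (W₀ k) t u → eval k component t k.≈ eval k component u
      component-resp (d-cong n e)    = e n
      component-resp (d-op add n α β) = k.sym (k.trans (eval->>= k component _ (Q add n))
        (eval-cong-ρ k (λ { (inj₁ i) → k.refl ; (inj₂ i) → k.refl }) (Q add n)))
      component-resp (d-op mul n α β) = k.sym (k.trans (eval->>= k component _ (Q mul n))
        (eval-cong-ρ k (λ { (inj₁ i) → k.refl ; (inj₂ i) → k.refl }) (Q mul n)))
      component-resp (d-const n x)   = ι-coord k x n

      counit : AlgHom (Δ₀ 𝒟 (W₀ k)) k
      counit = induced ℒ₀ (JetRelation 𝒟 (W₀ k)) k component component-resp

  Δ⊣W : Δ 𝒟 ⊣ W
  Δ⊣W = record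
    { unit           = unit
    ; unit-natural   = λ {A} {B} f x n → Equal.refl
    ; counit         = counit
    ; counit-natural = λ {X} {Y} f → hom-ext ℒ₀ (JetRelation 𝒟 (W₀ X)) Y
        (Category._∘ᶜ_ (Alg ℒ₀ c) (counit Y) (Δ₁ 𝒟 (W₁ f))) (Category._∘ᶜ_ (Alg ℒ₀ c) f (counit X)) (λ _ → Algebra.refl Y)
    ; triangleˡ      = λ A → hom-ext ℒ₀ (JetRelation 𝒟 A) (Δ₀ 𝒟 A)
        (Category._∘ᶜ_ (Alg ℒ₀ c) (counit (Δ₀ 𝒟 A)) (Δ₁ 𝒟 (unit A))) (Category.idᶜ (Alg ℒ₀ c)) (λ _ → Equal.refl)
    ; triangleʳ      = λ X α n → Algebra.refl X
    }

-- The adjoint equivalence between perfect algebras and `CRP`.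

module CRPEquivalence {p : ℕ} (pp : Prime p) (c : Level) where
  𝒟 = lazardData pp
  𝒲 = wittStructure pp c
  module E = Equivalence pp c
  module F = Perfection pp (lazardBase pp)
  module P = Perfect pp (lazardBase pp)
  module OB = OverBase pp (lazardBase pp)
  module LB = LazardBase pp

  W₀ : Algebra (Lazard.ℒ₀ p) c → Algebra (Lazard.ℒ p) c
  W₀ = Lazard.WittStructure.W₀ 𝒲

  U₀ : Algebra (Lazard.ℒ p) c → Algebra (Lazard.ℒ₀ p) c
  U₀ B = B ⊗ Lazard.ℒ₀-over-ℒ p

  module Mul (B : Algebra (Lazard.ℒ p) c) = Multiplication {L = Lazard.ℒ p} {π = Lazard.π p} LB.π-regular B
  module Res (B : Algebra (Lazard.ℒ p) c) = Residue {L = Lazard.ℒ p} {π = Lazard.π p} (Lazard.ℒ₀-over-ℒ p) LB.lift LB.residue-lift (λ x y → LB.residue-kernel {x} {y}) B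

  residuePair : (B : Algebra (Lazard.ℒ p) c) → OB.Pair B (U₀ B)
  residuePair B = record
    { red-hom  = Res.reduce B
    ; red-ι    = Res.reduce-ι B
    ; kernel   = λ {x} {y} → Res.reduce-kernel B {x} {y}
    ; lifting  = Res.lifting B
    ; red-lift = Res.reduce-lifting B
    }

  module _ (B : Algebra (Lazard.ℒ p) c) where
    private
      module B = Algebra B
      πᴮ = ⟦ B.ι ⟧ (Lazard.π p)

    isCRP : IsSeparated B.commutativeRing πᴮ → IsComplete B.commutativeRing πᴮ →
            IsPerfect p (B.commutativeRing / πᴮ) → RingTheory.IsRegular B.commutativeRing πᴮ → Lazard.IsCRP p B
    isCRP separated limit perfect regular = record
      { complete      = toCompletion-bijective B.commutativeRing πᴮ separated limit
      ; perfect       = perfect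
      ; πℒ⊗-injective = Mul.regular⇒injective B B.refl (λ _ _ _ → B.refl) regular
      }

    module _ (crp : Lazard.IsCRP p B) where
      open Lazard.IsCRP crp using (complete; perfect; πℒ⊗-injective)

      residueRoots : P.HasRoots (U₀ B)
      residueRoots = F.residue-hasRoots (residuePair B) perfect

      separated : IsSeparated B.commutativeRing πᴮ
      separated = bijective⇒separated B.commutativeRing πᴮ complete

      limit : IsComplete B.commutativeRing πᴮ
      limit = bijective⇒limit B.commutativeRing πᴮ complete

      regular : RingTheory.IsRegular B.commutativeRing πᴮ
      regular = Mul.injective⇒regular B B.refl (λ _ _ _ → B.refl) πℒ⊗-injective

      U-perfect : Lazard.IsPerfectAlgebra p (U₀ B)
      U-perfect = F.isPerfect residueRoots

  -- W₀ k and E.𝕎 k are the same algebra, but comparing their tensor products with ℒ₀ is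
  -- infeasible for Agda; rebuilding the pair field by field avoids it.
  pairᵂ : (k : Algebra (Lazard.ℒ₀ p) c) → OB.Pair (E.𝕎 k) (U₀ (W₀ k))
  pairᵂ k = record
    { red-hom  = Res.reduce (W₀ k)
    ; red-ι    = Res.reduce-ι (W₀ k)
    ; kernel   = λ {x} {y} → Res.reduce-kernel (W₀ k) {x} {y}
    ; lifting  = Res.lifting (W₀ k)
    ; red-lift = Res.reduce-lifting (W₀ k)
    }

  𝕎≅W₀ : (k : Algebra (Lazard.ℒ₀ p) c) → AlgHom (E.𝕎 k) (W₀ k)
  𝕎≅W₀ k = record { hom = idʰ (E.ringᵂ k) ; commutes = λ x → Algebra.refl (W₀ k) {⟦ Algebra.ι (W₀ k) ⟧ x} }

  -- Unfolding counit (W₀ k) would make type checking infeasible.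
  abstract
    counit : (B : Algebra (Lazard.ℒ p) c) → Lazard.IsCRP p B → AlgHom (W₀ (U₀ B)) B
    counit B crp = record { hom = AlgHom.hom Θ ; commutes = AlgHom.commutes Θ }
      where
      Θ : AlgHom (E.𝕎 (U₀ B)) B
      Θ = E.ΘAlgHom (residuePair B) (residueRoots B crp) (separated B crp) (limit B crp)

    counit-isIso : ∀ B (crp : Lazard.IsCRP p B) → Category.IsIso (Alg (Lazard.ℒ p) c) (counit B crp)
    counit-isIso B crp = bijective⇒isIso (counit B crp) (λ {α} {β} → Θ-injective (regular B crp) {α} {β}) coordinates Θ-coordinates
      where open P.PerfectPair.Complete (residuePair B) (residueRoots B crp) (separated B crp) (limit B crp)

    counit-natural : ∀ B B′ (crp : Lazard.IsCRP p B) (crp′ : Lazard.IsCRP p B′) (f : AlgHom B B′) (α : ℕ → Algebra.Carrier (U₀ B)) →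
      Algebra._≈_ B′ (fun (counit B′ crp′) (fun (Functor.F₁ (Lazard.U p) f) ∘ α)) (fun f (fun (counit B crp) α))
    counit-natural B B′ crp crp′ f = E.Θ-natural (residuePair B) (residueRoots B crp) (separated B crp) (limit B crp)
      (residuePair B′) (residueRoots B′ crp′) (separated B′ crp′) (limit B′ crp′) f (Functor.F₁ (Lazard.U p) f)
      (λ x → Algebra.refl (U₀ B′))

    -- The triangle identity is the case in which `B` is `W₀ k`, `j` the identity and `e` the unit.
    counit-first : ∀ k (r : P.HasRoots k) B (crp : Lazard.IsCRP p B) (j : AlgHom (E.𝕎 k) B) (e : AlgHom k (U₀ B)) →
      (∀ x → Algebra._≈_ (U₀ B) (⟦ Res.reduce B ⟧ (fun j (E.first k r x))) (fun e x)) →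
      ∀ (α : ℕ → Algebra.Carrier k) → Algebra._≈_ B (fun (counit B crp) (fun e ∘ α)) (fun j α)
    counit-first k r B crp j e h = E.Θ-first r (residuePair B) (residueRoots B crp) (separated B crp) (limit B crp) j e h

    reduce-counit : ∀ B (crp : Lazard.IsCRP p B) α → Algebra._≈_ (U₀ B) (⟦ Res.reduce B ⟧ (fun (counit B crp) α)) (α 0)
    reduce-counit B crp = P.PerfectPair.Complete.red-Θ (residuePair B) (residueRoots B crp) (separated B crp) (limit B crp)

  module _ (k : Algebra (Lazard.ℒ₀ p) c) (perfect : Lazard.IsPerfectAlgebra p k) where
    private
      r : P.HasRoots k
      r = F.hasRoots perfect

    unit : AlgHom k (U₀ (W₀ k))
    unit = E.residueHom k r (pairᵂ k)

    unit-isIso : Category.IsIso (Alg (Lazard.ℒ₀ p) c) unit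
    unit-isIso = E.residueHom-isIso k r (pairᵂ k)

    triangleˡ : (crp : Lazard.IsCRP p (W₀ k)) (α : ℕ → Algebra.Carrier k) →
      Algebra._≈_ (W₀ k) (fun (counit (W₀ k) crp) (fun unit ∘ α)) (fun (𝕎≅W₀ k) α)
    triangleˡ crp = counit-first k r (W₀ k) crp (𝕎≅W₀ k) unit (λ x → Algebra.refl (U₀ (W₀ k)) {fun unit x})

  W-crp : ∀ k → Lazard.IsPerfectAlgebra p k → Lazard.IsCRP p (W₀ k)
  W-crp k perfect = isCRP (W₀ k) (E.separatedᵂ k r) (E.limitᵂ k r) (F.residue-isPerfect (E.wittPair k r) r) (E.π-regularᵂ k r)
    where r = F.hasRoots perfect

theoremB : ∀ {c : Level} (p : ℕ) → Prime p →
    let open Lazard p in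
    Σ[ 𝒟 ∈ LazardData ]
    Σ[ 𝒲 ∈ WittStructure 𝒟 c ]
    let open WittStructure 𝒲 using (W) in
    (Δ 𝒟 ⊣ W) ×
    (Σ[ W-crp ∈ (∀ k → IsPerfectAlgebra k → IsCRP (Functor.F₀ W k)) ]
    Σ[ U-perfect ∈ (∀ B → IsCRP B → IsPerfectAlgebra (Functor.F₀ U B)) ]
    _⊣ₑ_ {C = PerfAlg c} {D = CRP c} (restrict W W-crp) (restrict U U-perfect))
theoremB {c} p pp = lazardData pp , wittStructure pp c ,
  Adjunction.Δ⊣W p (lazardData pp) (wittStructure pp c) (λ k x n → Algebra.refl k) ,
  W-crp , U-perfect , record
    { adjunction = record
      { unit           = λ { (k , perfect) → unit k perfect }
      ; unit-natural   = λ {A} {B} f x → ⊗-cong (unit-natural (proj₁ A) (proj₁ B) f x) (CommutativeRing.refl (Lazard.ℒ₀ p))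
      ; counit         = λ { (B , crp) → counit B crp }
      ; counit-natural = λ {X} {Y} f → counit-natural (proj₁ X) (proj₁ Y) (proj₂ X) (proj₂ Y) f
      ; triangleˡ      = λ { (k , perfect) → triangleˡ k perfect (W-crp k perfect) }
      -- The unit sends `x` to the class of (x, 0, 0, ...), and the residue of its image under the
      -- counit is coordinate 0, which is `x` again.
      ; triangleʳ      = λ { (B , crp) x → reduce-counit B crp (E.first (U₀ B) (residueRoots B crp) x) }
      }
    ; unit-iso   = λ { (k , perfect) → record { Category.IsIso (unit-isIso k perfect) } }
    ; counit-iso = λ { (B , crp) → record { Category.IsIso (counit-isIso B crp) } }
    }
  where
  open CRPEquivalence pp c
  unit-natural : ∀ k k′ (f : AlgHom k k′) x n →
    Algebra._≈_ k′ (firstOnly (Algebra.0# k′) (fun f x) n) (fun f (firstOnly (Algebra.0# k) x n))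
  unit-natural k k′ f x zero    = Algebra.refl k′
  unit-natural k k′ f x (suc n) = Algebra.sym k′ (AlgHom.0#-homo f)
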